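{- Let $p,q$ be distinct odd primes and $\alpha,\beta$ positive integers. Then $$\sum_{\substack{i+j+k=p^{\alpha}q^{\beta}\\ i,j,k\in\mathcal{P}_{pq}}}\frac{(-1)^{i}}{ijk}\equiv-\frac{1}{4}Z(p^{\alpha}q^{\beta})\equiv \frac{1}{2}(q-2)\Bigl(1-\frac{1}{q^{3}}\Bigr)p^{\alpha-1}q^{\beta-1}B_{p-3}\pmod{p^{\alpha}}.$$
   Context: For a positive integer $n$, $\mathcal{P}_n$ denotes the set of positive integers coprime to $n$, and $Z(n)=\sum_{i+j+k=n,\ i,j,k\in\mathcal{P}_n}\frac{1}{ijk}$. All sums are over ordered triples $(i,j,k)$ of positive integers. The Bernoulli numbers $B_k$ are defined by $B_0=1$ and $\sum_{i=0}^{n}\binom{n+1}{i}B_i=0$ for $n\ge1$. A congruence between rational numbers modulo $p^{\alpha}$ means that the difference, written in lowest terms, has numerator divisible by $p^{\alpha}$ and denominator coprime to $p$. -}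

module Defs where

open import Data.Nat as ℕ using (ℕ; zero; suc; _∸_; _^_)
open import Data.Nat.Coprimality using (coprime?)
open import Data.Nat.Properties using (m*n≢0)
open import Data.Nat.Combinatorics using (_C_)
open import Data.Nat.Divisibility using (_∣_)
open import Data.Nat.Coprimality using (Coprime)
open import Data.Integer as ℤ using (ℤ; +_; -[1+_])
open import Data.Rational as ℚ using (ℚ; _/_; ↥_; ↧ₙ_)
open import Data.List using (List; []; _∷_; upTo; map; concatMap; foldr; lookup; length)
open import Data.Bool using (Bool; true; false; if_then_else_; _∧_)
open import Relation.Nullary.Decidable using (does)
open import Data.Product using (_×_)

sumℚ : List ℚ → ℚ
sumℚ = foldr ℚ._+_ ℚ.0ℚ

inP : ℕ → ℕ → Bool
inP m i = does (coprime? i m)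

-- Sum over ordered triples (i,j,k) of positive integers with i + j + k = n
-- and i, j, k ∈ 𝒫_m of  f(i) / (i j k).
-- i = suc a, j = suc b with a, b < n; k = n ∸ (i + j) must be positive.
tripleSum : (m n : ℕ) → (ℕ → ℤ) → ℚ
tripleSum m n f =
  sumℚ (concatMap (λ a → map (λ b → term (suc a) (suc b)) (upTo n)) (upTo n))
  where
  term : (i j : ℕ) → .{{ℕ.NonZero i}} → .{{ℕ.NonZero j}} → ℚ
  term i j with n ∸ (i ℕ.+ j)
  ... | zero = ℚ.0ℚ
  ... | suc k' =
    if inP m i ∧ inP m j ∧ inP m (suc k')
    then (f i / (i ℕ.* j ℕ.* suc k'))
           {{m*n≢0 (i ℕ.* j) (suc k') {{m*n≢0 i j}}}}
    else ℚ.0ℚ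

Z : ℕ → ℚ
Z n = tripleSum n n (λ _ → + 1)

signℤ : ℕ → ℤ
signℤ zero = + 1
signℤ (suc i) = ℤ.- signℤ i

-- Bernoulli numbers: B_0 = 1, Σ_{i=0}^{n} C(n+1,i) B_i = 0 for n ≥ 1,
-- i.e. B_n = -(1/(n+1)) Σ_{i<n} C(n+1,i) B_i.
-- bernList n = [B_0, …, B_{n-1}]  (built by appending)
private
  snoc : List ℚ → ℚ → List ℚ
  snoc [] x = x ∷ []
  snoc (y ∷ ys) x = y ∷ snoc ys x

  weighted : ℕ → ℕ → List ℚ → ℚ
  weighted N i [] = ℚ.0ℚ
  weighted N i (b ∷ bs) = ℚ._+_ (ℚ._*_ ((+ (N C i)) / 1) b) (weighted N (suc i) bs)

  nextB : List ℚ → ℚ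
  nextB bs with length bs
  ... | zero = ℚ.1ℚ
  ... | suc n' = ℚ.-_ (ℚ._*_ ((+ 1) / (suc (suc n'))) (weighted (suc (suc n')) 0 bs))

bernList : ℕ → List ℚ
bernList zero = []
bernList (suc n) = snoc (bernList n) (nextB (bernList n))

lastOr : List ℚ → ℚ
lastOr [] = ℚ.0ℚ
lastOr (x ∷ []) = x
lastOr (_ ∷ y ∷ ys) = lastOr (y ∷ ys)

B : ℕ → ℚ
B n = lastOr (bernList (suc n))

CongMod : (p α : ℕ) → ℚ → ℚ → Set
CongMod p α x y = (p ^ α ∣ ℤ.∣ ↥ (ℚ._-_ x y) ∣) × Coprime (↧ₙ (ℚ._-_ x y)) p

open import Relation.Binary.PropositionalEquality using (_≡_; refl)
private
  t1 : B 1 ≡ ℚ.-_ ((+ 1) / 2)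
  t1 = refl
  t2 : B 4 ≡ ℚ.-_ ((+ 1) / 30)
  t2 = refl
  t3 : B 3 ≡ ℚ.0ℚ
  t3 = refl
  t4 : Z 5 ≡ (+ 7) / 4
  t4 = refl
  t5 : Z 4 ≡ ℚ.0ℚ
  t5 = refl

-- Let N = p ^ (α + 1), n = N * q ^ (β + 1), and let f i be 1 / i modulo N if i is prime to p q, and 0 otherwise. Let S
-- and Z be the sums of (-1) ^ i * f i * f j * f k and of f i * f j * f k over i + j + k = n. The function f is odd and
-- periodic modulo n, and n is odd.
-- Doubling the indices modulo n multiplies each term by 1 / 8, and a triple with sum n is the double of one with sum n
-- or 2n according to its parities; hence 6 (4 S + Z) ≡ 0. For p = 3 the rotation symmetry of the sums makes this true
-- even modulo 3 N, so that 4 S + Z ≡ 0 modulo N in all cases.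
-- Reflecting i ↦ n - i gives 2 S ≡ Σ (-1) ^ i * f i * Y i, where Y i sums f j * f k over i + j + k ≡ 0 modulo n. Partial
-- fractions and the Chinese remainder theorem give Y i ≡ - 2 p ^ α q ^ β (q - 2) (f i)² for i prime to p q. Therefore
-- S ≡ - p ^ α q ^ β (q - 2) Σ (-1) ^ i (f i)³, where the last sum matters only modulo p; there it is (1 - 1 / q³) Γ with
-- Γ = Σ (-1) ^ i / i³ over 0 < i < p. Finally 2 Γ ≡ - B (p - 3) modulo p, by evaluating Σ i ^ (p - 3) modulo p² once
-- through the recursion of the Bernoulli numbers and once through doubling.

module Submission where

open import Defs
open import Data.Bool using (Bool; true; false; _∧_; if_then_else_)
open import Data.Empty using (⊥-elim)
open import Data.Integer as ℤ using (ℤ; +_; _+_; _*_; -_; _-_; 0ℤ; 1ℤ)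
open import Data.Integer.DivMod using (_%ℕ_; _/ℕ_; n%ℕd<d; a≡a%ℕn+[a/ℕn]*n)
open import Data.Integer.Divisibility.Signed as ℤ∣ using (∣ᵤ⇒∣; ∣⇒∣ᵤ)
import Data.Integer.Properties as ℤₚ
open import Data.Integer.Tactic.RingSolver using (solve-∀)
open import Data.List using (List; []; _∷_; _++_; length; drop; map; concatMap; applyUpTo; upTo)
open import Data.Nat as ℕ using (ℕ; zero; suc; _∸_; _^_; _<_; _≤_; z≤n; s≤s)
open import Data.Nat.Combinatorics using (_C_; nCk+nC[k+1]≡[n+1]C[k+1]; nCn≡1; nC1≡n; nCk≡nC[n∸k]; k>n⇒nCk≡0)
open import Data.Nat.Coprimality as Coprimality using (Coprime; coprime?; coprime-Bézout)
open import Data.Nat.Divisibility as ℕ∣ using (_∣_; _∣?_; divides)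
open import Data.Nat.GCD using (module Bézout)
import Data.Nat.Induction as ℕ-Ind
open import Data.Nat.Primality using (Prime; euclidsLemma; prime⇒irreducible; prime⇒nonZero; prime⇒nonTrivial)
import Data.Nat.Properties as ℕₚ
open import Data.Nat.Tactic.RingSolver using () renaming (solve-∀ to ℕ-solve-∀)
open import Data.Product using (_×_; _,_; proj₁; proj₂; ∃-syntax)
open import Data.Rational as ℚ using (ℚ; ↥_; ↧_; ↧ₙ_; toℚᵘ)
import Data.Rational.Properties as ℚₚ
open import Data.Rational.Unnormalised using (mkℚᵘ; *≡*) renaming (_≃_ to _≃ᵘ_)
import Data.Rational.Unnormalised.Properties as ℚᵘₚ
open import Data.Sum using (_⊎_; inj₁; inj₂; [_,_]′)
open import Function using (_∘_)
open import Relation.Binary.Bundles using (Setoid)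
open import Relation.Binary.PropositionalEquality using (_≡_; _≢_; refl; sym; trans; cong; cong₂; subst; module ≡-Reasoning)
import Relation.Binary.Reasoning.Setoid as SetoidReasoning
open import Relation.Nullary using (¬_; Dec; yes; no)
open import Relation.Nullary.Decidable using (does; _×-dec_; dec-true; dec-false)
open import Tactic.Cong using (cong!)
import Algebra.Properties.AbelianGroup ℤₚ.+-0-abelianGroup as ℤ-group

-- The conditions of coprimality are absorbed into zeros of `f`, so that every sum runs over
-- complete periods, on which reflection and doubling merely permute the terms. The relation between
-- S and Z comes from carries: if a, b, c < n are doubled modulo n with B carries in all, the three
-- signs of the doubles add up to 3 - 2 B, and doubles with sum n force B = 1 or B = 3. In Y i, the
-- factor q - 2 counts the residues x modulo q for which x and i + x are both nonzero. The factor p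
-- ^ α arises because the sum of all inverses modulo N vanishes, so that only the excluded class of
-- - i modulo p matters, and this class has p ^ α members modulo N. Since p ^ α * p = N, the same
-- factor is the reason why the sum of inverse cubes is needed modulo p alone. The obstacle at p = 3
-- is twofold: 6 is not invertible, and the exponent p - 4 that would express inverse cubes as
-- powers is negative.

-- Congruences of integers with explicit quotients.

infix 4 _≋_mod_

-- The equation is solved for `a`, so that a match on `by x refl` eliminates `a` and leaves a ring
-- identity. The modulus may be any integer, including 1 and products such as `N * d`.
record _≋_mod_ (a b M : ℤ) : Set where
  constructor by
  field
    quotient : ℤ
    difference : a ≡ b + quotient * M

≡⇒≋ : ∀ {a b M} → a ≡ b → a ≋ b mod M
≡⇒≋ {a} {M = M} refl = by 0ℤ (lemma a M)
  where
  lemma : ∀ a M → a ≡ a + 0ℤ * M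
  lemma = solve-∀

≋-refl : ∀ {a M} → a ≋ a mod M
≋-refl = ≡⇒≋ refl

≋-sym : ∀ {a b M} → a ≋ b mod M → b ≋ a mod M
≋-sym {b = b} {M} (by c refl) = by (- c) (lemma b c M)
  where
  lemma : ∀ b c M → b ≡ b + c * M + - c * M
  lemma = solve-∀

≋-trans : ∀ {a b c M} → a ≋ b mod M → b ≋ c mod M → a ≋ c mod M
≋-trans {c = c} {M} (by x refl) (by y refl) = by (y + x) (lemma c x y M)
  where
  lemma : ∀ c x y M → c + y * M + x * M ≡ c + (y + x) * M
  lemma = solve-∀

≋-setoid : ℤ → Setoid _ _
≋-setoid M = record
  { Carrier = ℤ
  ; _≈_ = λ a b → a ≋ b mod M
  ; isEquivalence = record { refl = ≋-refl ; sym = ≋-sym ; trans = ≋-trans }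
  }

module ≋-Reasoning (M : ℤ) = SetoidReasoning (≋-setoid M)

≋-+ : ∀ {a b c d M} → a ≋ b mod M → c ≋ d mod M → a + c ≋ b + d mod M
≋-+ {b = b} {d = d} {M} (by x refl) (by y refl) = by (x + y) (lemma b d x y M)
  where
  lemma : ∀ b d x y M → b + x * M + (d + y * M) ≡ b + d + (x + y) * M
  lemma = solve-∀

≋-+ˡ : ∀ {a b M} c → a ≋ b mod M → c + a ≋ c + b mod M
≋-+ˡ c = ≋-+ (≋-refl {c})

≋-+ʳ : ∀ {a b M} c → a ≋ b mod M → a + c ≋ b + c mod M
≋-+ʳ c e = ≋-+ e (≋-refl {c})

≋-* : ∀ {a b c d M} → a ≋ b mod M → c ≋ d mod M → a * c ≋ b * d mod M
≋-* {b = b} {d = d} {M} (by x refl) (by y refl) =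
  by (x * d + b * y + x * y * M) (lemma b d x y M)
  where
  lemma : ∀ b d x y M →
    (b + x * M) * (d + y * M) ≡ b * d + (x * d + b * y + x * y * M) * M
  lemma = solve-∀

≋-*ˡ : ∀ {a b M} c → a ≋ b mod M → c * a ≋ c * b mod M
≋-*ˡ c = ≋-* (≋-refl {c})

≋-*ʳ : ∀ {a b M} c → a ≋ b mod M → a * c ≋ b * c mod M
≋-*ʳ c e = ≋-* e (≋-refl {c})

≋-neg : ∀ {a b M} → a ≋ b mod M → - a ≋ - b mod M
≋-neg {b = b} {M} (by x refl) = by (- x) (lemma b x M)
  where
  lemma : ∀ b x M → - (b + x * M) ≡ - b + - x * M
  lemma = solve-∀

≋-weaken : ∀ {a b} M d → a ≋ b mod (M * d) → a ≋ b mod M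
≋-weaken {b = b} M d (by x refl) = by (x * d) (lemma b x M d)
  where
  lemma : ∀ b x M d → b + x * (M * d) ≡ b + x * d * M
  lemma = solve-∀

≋-scale : ∀ {a b M} c → a ≋ b mod M → c * a ≋ c * b mod (c * M)
≋-scale {b = b} {M} c (by x refl) = by x (lemma b x M c)
  where
  lemma : ∀ b x M c → c * (b + x * M) ≡ c * b + x * (c * M)
  lemma = solve-∀

≋-unscale : ∀ {a b M} c .{{_ : ℤ.NonZero c}} → c * a ≋ c * b mod (c * M) → a ≋ b mod M
≋-unscale {a} {b} {M} c (by x e) = by x (ℤₚ.*-cancelˡ-≡ c a _ (trans e (lemma b x M c)))
  where
  lemma : ∀ b x M c → c * b + x * (c * M) ≡ c * (b + x * M)
  lemma = solve-∀

≋-cancel : ∀ {a b M} c v → v * c ≋ 1ℤ mod M → c * a ≋ c * b mod M → a ≋ b mod M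
≋-cancel {a} {b} {M} c v vc e = begin
  a           ≡⟨ ℤₚ.*-identityˡ a ⟨
  1ℤ * a      ≈⟨ ≋-*ʳ a vc ⟨
  v * c * a   ≡⟨ ℤₚ.*-assoc v c a ⟩
  v * (c * a) ≈⟨ ≋-*ˡ v e ⟩
  v * (c * b) ≡⟨ ℤₚ.*-assoc v c b ⟨
  v * c * b   ≈⟨ ≋-*ʳ b vc ⟩
  1ℤ * b      ≡⟨ ℤₚ.*-identityˡ b ⟩
  b           ∎
  where open ≋-Reasoning M

multiple≋0 : ∀ c M → c * M ≋ 0ℤ mod M
multiple≋0 c M = by c (sym (ℤₚ.+-identityˡ (c * M)))

≋-inverse-unique : ∀ {M} x {v w} → x * v ≋ 1ℤ mod M → x * w ≋ 1ℤ mod M → v ≋ w mod M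
≋-inverse-unique {M} x {v} {w} xv xw =
  ≋-cancel x v (≋-trans (≡⇒≋ (ℤₚ.*-comm v x)) xv) (≋-trans xv (≋-sym xw))

-- Finite sums over initial segments of ℕ.

∑ : ℕ → (ℕ → ℤ) → ℤ
∑ zero    g = 0ℤ
∑ (suc n) g = ∑ n g + g n

∑-cong< : ∀ n {g h} → (∀ i → i < n → g i ≡ h i) → ∑ n g ≡ ∑ n h
∑-cong< zero    e = refl
∑-cong< (suc n) e = cong₂ _+_ (∑-cong< n λ i i<n → e i (ℕₚ.m<n⇒m<1+n i<n)) (e n (ℕₚ.n<1+n n))

∑-cong : ∀ n {g h} → (∀ i → g i ≡ h i) → ∑ n g ≡ ∑ n h
∑-cong n e = ∑-cong< n λ i _ → e i

∑-≋< : ∀ {M} n {g h} → (∀ i → i < n → g i ≋ h i mod M) → ∑ n g ≋ ∑ n h mod M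
∑-≋< zero    e = ≋-refl
∑-≋< (suc n) e = ≋-+ (∑-≋< n λ i i<n → e i (ℕₚ.m<n⇒m<1+n i<n)) (e n (ℕₚ.n<1+n n))

∑-≋ : ∀ {M} n {g h} → (∀ i → g i ≋ h i mod M) → ∑ n g ≋ ∑ n h mod M
∑-≋ n e = ∑-≋< n λ i _ → e i

∑-0 : ∀ n → ∑ n (λ _ → 0ℤ) ≡ 0ℤ
∑-0 zero    = refl
∑-0 (suc n) = trans (ℤₚ.+-identityʳ _) (∑-0 n)

∑-const : ∀ n c → ∑ n (λ _ → c) ≡ + n * c
∑-const zero    c = refl
∑-const (suc n) c = begin
  ∑ n (λ _ → c) + c ≡⟨ cong (_+ c) (∑-const n c) ⟩
  + n * c + c       ≡⟨ lemma (+ n) c ⟩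
  (1ℤ + + n) * c    ∎
  where
  open ≡-Reasoning
  lemma : ∀ n c → n * c + c ≡ (1ℤ + n) * c
  lemma = solve-∀

∑-+ : ∀ n g h → ∑ n (λ i → g i + h i) ≡ ∑ n g + ∑ n h
∑-+ zero    g h = refl
∑-+ (suc n) g h = trans (cong (_+ (g n + h n)) (∑-+ n g h)) (lemma (∑ n g) (∑ n h) (g n) (h n))
  where
  lemma : ∀ a b c d → a + b + (c + d) ≡ a + c + (b + d)
  lemma = solve-∀

∑-*ˡ : ∀ n c g → ∑ n (λ i → c * g i) ≡ c * ∑ n g
∑-*ˡ zero    c g = sym (ℤₚ.*-zeroʳ c)
∑-*ˡ (suc n) c g = trans (cong (_+ c * g n) (∑-*ˡ n c g)) (sym (ℤₚ.*-distribˡ-+ c (∑ n g) (g n)))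

∑-*ʳ : ∀ n c g → ∑ n (λ i → g i * c) ≡ ∑ n g * c
∑-*ʳ n c g = trans (∑-cong n λ i → ℤₚ.*-comm (g i) c) (trans (∑-*ˡ n c g) (ℤₚ.*-comm c _))

∑-neg : ∀ n g → ∑ n (λ i → - g i) ≡ - ∑ n g
∑-neg n g = begin
  ∑ n (λ i → - g i)      ≡⟨ ∑-cong n (λ i → sym (ℤₚ.-1*i≡-i (g i))) ⟩
  ∑ n (λ i → - 1ℤ * g i) ≡⟨ ∑-*ˡ n (- 1ℤ) g ⟩
  - 1ℤ * ∑ n g           ≡⟨ ℤₚ.-1*i≡-i _ ⟩
  - ∑ n g                ∎
  where open ≡-Reasoning

∑-- : ∀ n g h → ∑ n (λ i → g i - h i) ≡ ∑ n g - ∑ n h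
∑-- n g h = trans (∑-+ n g (λ i → - h i)) (cong (λ z → ∑ n g + z) (∑-neg n h))

∑-swap : ∀ m n (g : ℕ → ℕ → ℤ) → ∑ m (λ i → ∑ n (g i)) ≡ ∑ n (λ j → ∑ m (λ i → g i j))
∑-swap zero    n g = sym (∑-0 n)
∑-swap (suc m) n g = begin
  ∑ m (λ i → ∑ n (g i)) + ∑ n (g m)             ≡⟨ cong (_+ ∑ n (g m)) (∑-swap m n g) ⟩
  ∑ n (λ j → ∑ m (λ i → g i j)) + ∑ n (g m)     ≡⟨ ∑-+ n _ (g m) ⟨
  ∑ n (λ j → ∑ m (λ i → g i j) + g m j)         ∎
  where open ≡-Reasoning

∑-split : ∀ m n g → ∑ (m ℕ.+ n) g ≡ ∑ m g + ∑ n (λ i → g (m ℕ.+ i))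
∑-split m zero    g = trans (cong (λ k → ∑ k g) (ℕₚ.+-identityʳ m)) (sym (ℤₚ.+-identityʳ _))
∑-split m (suc n) g = begin
  ∑ (m ℕ.+ suc n) g                                      ≡⟨ cong (λ k → ∑ k g) (ℕₚ.+-suc m n) ⟩
  ∑ (m ℕ.+ n) g + g (m ℕ.+ n)                            ≡⟨ cong (_+ g (m ℕ.+ n)) (∑-split m n g) ⟩
  ∑ m g + ∑ n (λ i → g (m ℕ.+ i)) + g (m ℕ.+ n)          ≡⟨ ℤₚ.+-assoc (∑ m g) _ _ ⟩
  ∑ m g + (∑ n (λ i → g (m ℕ.+ i)) + g (m ℕ.+ n))        ∎
  where open ≡-Reasoning

∑-head : ∀ n g → ∑ (suc n) g ≡ g 0 + ∑ n (g ∘ suc)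
∑-head n g = trans (∑-split 1 n g) (cong (_+ ∑ n (g ∘ suc)) (ℤₚ.+-identityˡ (g 0)))

∑-block : ∀ m n g → ∑ (m ℕ.* n) g ≡ ∑ m (λ d → ∑ n (λ c → g (d ℕ.* n ℕ.+ c)))
∑-block zero    n g = refl
∑-block (suc m) n g = begin
  ∑ (n ℕ.+ m ℕ.* n) g                                     ≡⟨ cong (λ k → ∑ k g) (ℕₚ.+-comm n (m ℕ.* n)) ⟩
  ∑ (m ℕ.* n ℕ.+ n) g                                     ≡⟨ ∑-split (m ℕ.* n) n g ⟩
  ∑ (m ℕ.* n) g + ∑ n (λ c → g (m ℕ.* n ℕ.+ c))           ≡⟨ cong (_+ ∑ n (λ c → g (m ℕ.* n ℕ.+ c))) (∑-block m n g) ⟩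
  ∑ m (λ d → ∑ n (λ c → g (d ℕ.* n ℕ.+ c))) + ∑ n (λ c → g (m ℕ.* n ℕ.+ c)) ∎
  where open ≡-Reasoning

∑-shift : ∀ n g → g n ≡ g 0 → ∑ n (g ∘ suc) ≡ ∑ n g
∑-shift n g e = ℤ-group.∙-cancelˡ (g 0) _ _ (begin
  g 0 + ∑ n (g ∘ suc) ≡⟨ ∑-head n g ⟨
  ∑ n g + g n         ≡⟨ cong (λ z → ∑ n g + z) e ⟩
  ∑ n g + g 0         ≡⟨ ℤₚ.+-comm _ (g 0) ⟩
  g 0 + ∑ n g         ∎)
  where open ≡-Reasoning

∑-reverse≤ : ∀ n g → ∑ (suc n) g ≡ ∑ (suc n) (λ i → g (n ∸ i))
∑-reverse≤ zero    g = refl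
∑-reverse≤ (suc n) g = begin
  ∑ (suc n) g + g (suc n)                    ≡⟨ cong (_+ g (suc n)) (∑-reverse≤ n g) ⟩
  ∑ (suc n) (λ i → g (n ∸ i)) + g (suc n)    ≡⟨ ℤₚ.+-comm _ (g (suc n)) ⟩
  g (suc n) + ∑ (suc n) (λ i → g (n ∸ i))    ≡⟨ ∑-head (suc n) (λ i → g (suc n ∸ i)) ⟨
  ∑ (suc (suc n)) (λ i → g (suc n ∸ i))      ∎
  where open ≡-Reasoning

-- On 0 ≤ i < n the reflection trades the index 0 for `n`; the hypothesis makes the two end terms
-- equal.
∑-reverse : ∀ n g → g n ≡ g 0 → ∑ n g ≡ ∑ n (λ i → g (n ∸ i))
∑-reverse n g e = ℤ-group.∙-cancelʳ (g n) _ _ (begin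
  ∑ n g + g n                        ≡⟨ ∑-reverse≤ n g ⟩
  ∑ n (λ i → g (n ∸ i)) + g (n ∸ n)  ≡⟨ cong (λ k → ∑ n (λ i → g (n ∸ i)) + g k) (ℕₚ.n∸n≡0 n) ⟩
  ∑ n (λ i → g (n ∸ i)) + g 0        ≡⟨ cong (λ z → ∑ n (λ i → g (n ∸ i)) + z) e ⟨
  ∑ n (λ i → g (n ∸ i)) + g n        ∎)
  where open ≡-Reasoning

-- Indicators of decidable propositions.

⟦_⟧ : ∀ {A : Set} → Dec A → ℤ
⟦ d ⟧ = if does d then 1ℤ else 0ℤ

⟦⟧-yes : ∀ {A} (d : Dec A) → A → ⟦ d ⟧ ≡ 1ℤ
⟦⟧-yes d a = cong (λ b → if b then 1ℤ else 0ℤ) (dec-true d a)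

⟦⟧-no : ∀ {A} (d : Dec A) → ¬ A → ⟦ d ⟧ ≡ 0ℤ
⟦⟧-no d ¬a = cong (λ b → if b then 1ℤ else 0ℤ) (dec-false d ¬a)

⟦⟧-⇔ : ∀ {A B} (d : Dec A) (e : Dec B) → (A → B) → (B → A) → ⟦ d ⟧ ≡ ⟦ e ⟧
⟦⟧-⇔ (yes a) e f g = sym (⟦⟧-yes e (f a))
⟦⟧-⇔ (no ¬a) e f g = sym (⟦⟧-no e (¬a ∘ g))

⟦⟧-cases : ∀ {A} (d : Dec A) (P : ℤ → Set) → (A → P 1ℤ) → (¬ A → P 0ℤ) → P ⟦ d ⟧
⟦⟧-cases (yes a) P f g = f a
⟦⟧-cases (no ¬a) P f g = g ¬a

⟦⟧-× : ∀ {A B} (d : Dec A) (e : Dec B) → ⟦ d ⟧ * ⟦ e ⟧ ≡ ⟦ d ×-dec e ⟧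
⟦⟧-× (yes a) e = ℤₚ.*-identityˡ ⟦ e ⟧
⟦⟧-× (no ¬a) e = refl

∑-δ-out : ∀ n m (g : ℕ → ℤ) → n ≤ m → ∑ n (λ k → ⟦ k ℕ.≟ m ⟧ * g k) ≡ 0ℤ
∑-δ-out n m g n≤m = trans (∑-cong< n λ k k<n →
  cong (_* g k) (⟦⟧-no (k ℕ.≟ m) (λ k≡m → ℕₚ.<⇒≢ (ℕₚ.<-≤-trans k<n n≤m) k≡m))) (∑-0 n)

∑-δ : ∀ n m (g : ℕ → ℤ) → m < n → ∑ n (λ k → ⟦ k ℕ.≟ m ⟧ * g k) ≡ g m
∑-δ (suc n) m g m<1+n = [ last , before ]′ (ℕₚ.m≤n⇒m<n∨m≡n (ℕₚ.≤-pred m<1+n))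
  where
  open ≡-Reasoning
  before : m ≡ n → ∑ (suc n) (λ k → ⟦ k ℕ.≟ m ⟧ * g k) ≡ g m
  before m≡n = begin
    ∑ n (λ k → ⟦ k ℕ.≟ m ⟧ * g k) + ⟦ n ℕ.≟ m ⟧ * g n
      ≡⟨ cong₂ (λ x y → x + y * g n) (∑-δ-out n m g (ℕₚ.≤-reflexive (sym m≡n))) (⟦⟧-yes (n ℕ.≟ m) (sym m≡n)) ⟩
    0ℤ + 1ℤ * g n
      ≡⟨ lemma (g n) ⟩
    g n
      ≡⟨ cong g m≡n ⟨
    g m ∎
    where
    lemma : ∀ a → 0ℤ + 1ℤ * a ≡ a
    lemma = solve-∀
  last : m < n → ∑ (suc n) (λ k → ⟦ k ℕ.≟ m ⟧ * g k) ≡ g m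
  last m<n = begin
    ∑ n (λ k → ⟦ k ℕ.≟ m ⟧ * g k) + ⟦ n ℕ.≟ m ⟧ * g n
      ≡⟨ cong₂ (λ x y → x + y * g n) (∑-δ n m g m<n) (⟦⟧-no (n ℕ.≟ m) (λ n≡m → ℕₚ.<⇒≢ m<n (sym n≡m))) ⟩
    g m + 0ℤ * g n
      ≡⟨ lemma (g m) (g n) ⟩
    g m ∎
    where
    lemma : ∀ a b → a + 0ℤ * b ≡ a
    lemma = solve-∀

-- Triple sums over a cube and their symmetries.

-- Conditions on i + j + k are left to an indicator inside `F`, so that each coordinate can be
-- permuted independently of the others.
∑³ : ℕ → (ℕ → ℕ → ℕ → ℤ) → ℤ
∑³ n F = ∑ n λ i → ∑ n λ j → ∑ n λ k → F i j k

∑³-cong< : ∀ n {F G : ℕ → ℕ → ℕ → ℤ} →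
  (∀ i j k → i < n → j < n → k < n → F i j k ≡ G i j k) → ∑³ n F ≡ ∑³ n G
∑³-cong< n e = ∑-cong< n λ i i<n → ∑-cong< n λ j j<n → ∑-cong< n λ k k<n → e i j k i<n j<n k<n

∑³-cong : ∀ n {F G : ℕ → ℕ → ℕ → ℤ} → (∀ i j k → F i j k ≡ G i j k) → ∑³ n F ≡ ∑³ n G
∑³-cong n e = ∑³-cong< n λ i j k _ _ _ → e i j k

∑³-≋< : ∀ {M} n {F G : ℕ → ℕ → ℕ → ℤ} →
  (∀ i j k → i < n → j < n → k < n → F i j k ≋ G i j k mod M) → ∑³ n F ≋ ∑³ n G mod M
∑³-≋< n e = ∑-≋< n λ i i<n → ∑-≋< n λ j j<n → ∑-≋< n λ k k<n → e i j k i<n j<n k<n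

∑³-rotate : ∀ n (F : ℕ → ℕ → ℕ → ℤ) → ∑³ n F ≡ ∑³ n (λ i j k → F k i j)
∑³-rotate n F = trans
  (∑-swap n n λ i j → ∑ n (F i j))
  (∑-cong n λ j → ∑-swap n n λ i k → F i j k)

∑³-+ : ∀ n (F G : ℕ → ℕ → ℕ → ℤ) → ∑³ n (λ i j k → F i j k + G i j k) ≡ ∑³ n F + ∑³ n G
∑³-+ n F G = trans
  (∑-cong n λ i → trans (∑-cong n λ j → ∑-+ n (F i j) (G i j)) (∑-+ n (λ j → ∑ n (F i j)) (λ j → ∑ n (G i j))))
  (∑-+ n (λ i → ∑ n λ j → ∑ n (F i j)) (λ i → ∑ n λ j → ∑ n (G i j)))

∑³-*ˡ : ∀ n c (F : ℕ → ℕ → ℕ → ℤ) → ∑³ n (λ i j k → c * F i j k) ≡ c * ∑³ n F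
∑³-*ˡ n c F = trans
  (∑-cong n λ i → trans (∑-cong n λ j → ∑-*ˡ n c (F i j)) (∑-*ˡ n c (λ j → ∑ n (F i j))))
  (∑-*ˡ n c (λ i → ∑ n λ j → ∑ n (F i j)))

∑³-reindex : ∀ n (φ : ℕ → ℕ) → (∀ g → ∑ n g ≡ ∑ n (g ∘ φ)) →
  ∀ F → ∑³ n F ≡ ∑³ n (λ i j k → F (φ i) (φ j) (φ k))
∑³-reindex n φ e F = trans (e λ i → ∑ n λ j → ∑ n (F i j))
  (∑-cong n λ i → trans (e λ j → ∑ n (F (φ i) j)) (∑-cong n λ j → e (F (φ i) (φ j))))

∑³-reverse : ∀ n (F : ℕ → ℕ → ℕ → ℤ) →
  (∀ j k → F n j k ≡ F 0 j k) → (∀ i k → F i n k ≡ F i 0 k) → (∀ i j → F i j n ≡ F i j 0) →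
  ∑³ n F ≡ ∑³ n (λ i j k → F (n ∸ i) (n ∸ j) (n ∸ k))
∑³-reverse n F e₁ e₂ e₃ = trans
  (∑-reverse n (λ i → ∑ n λ j → ∑ n (F i j)) (∑-cong n λ j → ∑-cong n λ k → e₁ j k))
  (∑-cong n λ i → trans
    (∑-reverse n (λ j → ∑ n (F (n ∸ i) j)) (∑-cong n λ k → e₂ (n ∸ i) k))
    (∑-cong n λ j → ∑-reverse n (F (n ∸ i) (n ∸ j)) (e₃ (n ∸ i) (n ∸ j))))

-- Each quotient depends on a proof of i < n. Made total with the default 0, the quotients form a
-- function that can stand as one factor of a cubic sum.
quotients : ∀ {N} n (f g : ℕ → ℤ) → (∀ i → i < n → f i ≋ g i mod N) →
  ∃[ e ] ∀ i → i < n → f i ≡ g i + e i * N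
quotients {N} n f g f≋g = e , law
  where
  e : ℕ → ℤ
  e i with i ℕ.<? n
  ... | yes i<n = _≋_mod_.quotient (f≋g i i<n)
  ... | no  _   = 0ℤ
  law : ∀ i → i < n → f i ≡ g i + e i * N
  law i i<n with i ℕ.<? n
  ... | yes i<n′ = _≋_mod_.difference (f≋g i i<n′)
  ... | no  i≮n  = ⊥-elim (i≮n i<n)

-- A change of f by multiples of N changes each of the three factors, and the three first-order
-- changes agree by rotation: this gains the factor d = 3 modulo N * d, needed when p = 3.
module _ {N d : ℤ} (n : ℕ) (W : ℕ → ℕ → ℕ → ℤ) (W-rotate : ∀ i j k → W k i j ≡ W i j k)
  (3≋0 : + 3 ≋ 0ℤ mod d) (N≋0 : N ≋ 0ℤ mod d) where

  private
    T : (x y z : ℕ → ℤ) → ℤ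
    T x y z = ∑³ n λ i j k → W i j k * (x i * y j * z k)

    T-rotate : ∀ x y z → T x y z ≡ T y z x
    T-rotate x y z = trans (∑³-rotate n _) (∑³-cong n λ i j k →
      trans (cong (_* (x k * y i * z j)) (W-rotate i j k)) (lemma (W i j k) (x k) (y i) (z j)))
      where
      lemma : ∀ w a b c → w * (a * b * c) ≡ w * (b * c * a)
      lemma = solve-∀

    T-linear : ∀ f g e y z → (∀ i → i < n → f i ≡ g i + e i * N) → T f y z ≡ T g y z + N * T e y z
    T-linear f g e y z f≡ = begin
      T f y z
        ≡⟨ ∑³-cong< n (λ i j k i<n _ _ → trans
             (cong (λ a → W i j k * (a * y j * z k)) (f≡ i i<n))
             (lemma (W i j k) (g i) (e i) N (y j) (z k))) ⟩
      ∑³ n (λ i j k → W i j k * (g i * y j * z k) + N * (W i j k * (e i * y j * z k)))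
        ≡⟨ ∑³-+ n _ _ ⟩
      T g y z + ∑³ n (λ i j k → N * (W i j k * (e i * y j * z k)))
        ≡⟨ cong (λ t → T g y z + t) (∑³-*ˡ n N _) ⟩
      T g y z + N * T e y z ∎
      where
      open ≡-Reasoning
      lemma : ∀ w g e N y z → w * ((g + e * N) * y * z) ≡ w * (g * y * z) + N * (w * (e * y * z))
      lemma = solve-∀

    T-≋ : ∀ e {y y′ z z′ : ℕ → ℤ} → (∀ i → i < n → y i ≋ y′ i mod d) → (∀ i → i < n → z i ≋ z′ i mod d) →
      T e y z ≋ T e y′ z′ mod d
    T-≋ e y≋ z≋ = ∑³-≋< n λ i j k i<n j<n k<n → ≋-*ˡ (W i j k) (≋-* (≋-*ˡ (e i) (y≋ j j<n)) (z≋ k k<n))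

  cubic-sum-lift : ∀ (f g : ℕ → ℤ) → (∀ i → i < n → f i ≋ g i mod N) →
    ∑³ n (λ i j k → W i j k * (f i * f j * f k)) ≋ ∑³ n (λ i j k → W i j k * (g i * g j * g k)) mod (N * d)
  cubic-sum-lift f g f≋g = begin
    T f f f
      ≡⟨ expand ⟩
    T g g g + N * (T e f f + T e f g + T e g g)
      ≈⟨ ≋-+ˡ (T g g g) (≋-scale N first-order≋0) ⟩
    T g g g + N * 0ℤ
      ≡⟨ trans (cong (λ t → T g g g + t) (ℤₚ.*-zeroʳ N)) (ℤₚ.+-identityʳ _) ⟩
    T g g g ∎
    where
    e = proj₁ (quotients n f g f≋g)
    f≡ = proj₂ (quotients n f g f≋g)
    f≋g′ : ∀ i → i < n → f i ≋ g i mod d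
    f≋g′ i i<n = begin
      f i            ≡⟨ f≡ i i<n ⟩
      g i + e i * N  ≈⟨ ≋-+ˡ (g i) (≋-*ˡ (e i) N≋0) ⟩
      g i + e i * 0ℤ ≡⟨ trans (cong (λ t → g i + t) (ℤₚ.*-zeroʳ (e i))) (ℤₚ.+-identityʳ _) ⟩
      g i            ∎
      where open ≋-Reasoning d
    -- Since `d` divides `N`, `f` and `g` agree modulo `d`; the three terms coincide there and 3 ≋ 0
    -- kills their sum.
    first-order≋0 : T e f f + T e f g + T e g g ≋ 0ℤ mod d
    first-order≋0 = begin
      T e f f + T e f g + T e g g
        ≈⟨ ≋-+ (≋-+ (T-≋ e f≋g′ f≋g′) (T-≋ e f≋g′ (λ _ _ → ≋-refl))) ≋-refl ⟩
      T e g g + T e g g + T e g g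
        ≡⟨ triple (T e g g) ⟩
      + 3 * T e g g
        ≈⟨ ≋-*ʳ (T e g g) 3≋0 ⟩
      0ℤ * T e g g
        ≡⟨⟩
      0ℤ ∎
      where
      open ≋-Reasoning d
      triple : ∀ t → t + t + t ≡ + 3 * t
      triple = solve-∀
    -- The factors are exchanged one at a time, a rotation bringing the next `f` to the front. The
    -- identity is exact, without terms of second order in `e`.
    expand : T f f f ≡ T g g g + N * (T e f f + T e f g + T e g g)
    expand = begin
      T f f f
        ≡⟨ T-linear f g e f f f≡ ⟩
      T g f f + N * T e f f
        ≡⟨ cong (_+ N * T e f f) (trans (T-rotate g f f) (T-linear f g e f g f≡)) ⟩
      T g f g + N * T e f g + N * T e f f
        ≡⟨ cong (λ t → t + N * T e f g + N * T e f f) (trans (T-rotate g f g) (T-linear f g e g g f≡)) ⟩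
      T g g g + N * T e g g + N * T e f g + N * T e f f
        ≡⟨ collect N (T g g g) (T e f f) (T e f g) (T e g g) ⟩
      T g g g + N * (T e f f + T e f g + T e g g) ∎
      where
      open ≡-Reasoning
      collect : ∀ N t a b c → t + N * c + N * b + N * a ≡ t + N * (a + b + c)
      collect = solve-∀
    open ≋-Reasoning (N * d)

-- Doubling modulo the odd number 1 + 2m.

signℤ-+ : ∀ i j → signℤ (i ℕ.+ j) ≡ signℤ i * signℤ j
signℤ-+ zero    j = sym (ℤₚ.*-identityˡ (signℤ j))
signℤ-+ (suc i) j = trans (cong -_ (signℤ-+ i j)) (ℤₚ.neg-distribˡ-* (signℤ i) (signℤ j))

signℤ-square : ∀ i → signℤ i * signℤ i ≡ 1ℤ
signℤ-square zero    = refl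
signℤ-square (suc i) = trans (lemma (signℤ i)) (signℤ-square i)
  where
  lemma : ∀ s → - s * - s ≡ s * s
  lemma = solve-∀

signℤ-double : ∀ i → signℤ (i ℕ.+ i) ≡ 1ℤ
signℤ-double i = trans (signℤ-+ i i) (signℤ-square i)

signℤ-∸ : ∀ m i → i ≤ suc (m ℕ.+ m) → signℤ (suc (m ℕ.+ m) ∸ i) ≡ - signℤ i
signℤ-∸ m i i≤n = begin
  signℤ (n ∸ i)                       ≡⟨ ℤₚ.*-identityʳ _ ⟨
  signℤ (n ∸ i) * 1ℤ                  ≡⟨ cong (signℤ (n ∸ i) *_) (signℤ-square i) ⟨
  signℤ (n ∸ i) * (signℤ i * signℤ i) ≡⟨ ℤₚ.*-assoc (signℤ (n ∸ i)) _ _ ⟨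
  signℤ (n ∸ i) * signℤ i * signℤ i   ≡⟨ cong (_* signℤ i) (signℤ-+ (n ∸ i) i) ⟨
  signℤ (n ∸ i ℕ.+ i) * signℤ i       ≡⟨ cong (λ k → signℤ k * signℤ i) (ℕₚ.m∸n+n≡m i≤n) ⟩
  - signℤ (m ℕ.+ m) * signℤ i         ≡⟨ cong (λ s → - s * signℤ i) (signℤ-double m) ⟩
  - 1ℤ * signℤ i                      ≡⟨ ℤₚ.-1*i≡-i (signℤ i) ⟩
  - signℤ i                           ∎
  where
  open ≡-Reasoning
  n = suc (m ℕ.+ m)

even≢odd : ∀ a m → a ℕ.+ a ≢ suc (m ℕ.+ m)
even≢odd a m e = 1≢-1 (trans (sym (signℤ-double a)) (trans (cong signℤ e) (cong -_ (signℤ-double m))))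
  where
  1≢-1 : 1ℤ ≢ - 1ℤ
  1≢-1 ()

-- The carry in doubling `a` modulo n = 1 + 2m, that is, the quotient of 2a by n when a < n;
-- `double m a` is the remainder.
big : ℕ → ℕ → ℕ
big m a = if does (a ℕ.≤? m) then 0 else 1

double : ℕ → ℕ → ℕ
double m a = if does (a ℕ.≤? m) then a ℕ.+ a else (a ℕ.+ a) ∸ suc (m ℕ.+ m)

data Half (m a : ℕ) : (b d : ℕ) → Set where
  small : a ≤ m → Half m a 0 (a ℕ.+ a)
  large : m < a → Half m a 1 ((a ℕ.+ a) ∸ suc (m ℕ.+ m))

half : ∀ m a → Half m a (big m a) (double m a)
half m a with a ℕ.≤? m
... | yes a≤m rewrite dec-true (a ℕ.≤? m) a≤m = small a≤m
... | no  a≰m rewrite dec-false (a ℕ.≤? m) a≰m = large (ℕₚ.≰⇒> a≰m)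

∑-even-odd : ∀ m g → ∑ (suc (m ℕ.+ m)) g ≡ ∑ (suc m) (λ a → g (a ℕ.+ a)) + ∑ m (λ a → g (suc (a ℕ.+ a)))
∑-even-odd zero    g = sym (ℤₚ.+-identityʳ _)
∑-even-odd (suc m) g = begin
  ∑ (suc (suc m ℕ.+ suc m)) g
    ≡⟨ cong (λ k → ∑ k g) (cong (suc ∘ suc) (ℕₚ.+-suc m m)) ⟩
  ∑ (suc (m ℕ.+ m)) g + g (suc (m ℕ.+ m)) + g (suc (suc (m ℕ.+ m)))
    ≡⟨ cong₂ (λ s k → s + g (suc (m ℕ.+ m)) + g k) (∑-even-odd m g) (cong suc (sym (ℕₚ.+-suc m m))) ⟩
  ∑ (suc m) (λ a → g (a ℕ.+ a)) + ∑ m (λ a → g (suc (a ℕ.+ a))) + g (suc (m ℕ.+ m)) + g (suc m ℕ.+ suc m)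
    ≡⟨ lemma (∑ (suc m) (λ a → g (a ℕ.+ a))) (∑ m (λ a → g (suc (a ℕ.+ a)))) _ _ ⟩
  ∑ (suc (suc m)) (λ a → g (a ℕ.+ a)) + ∑ (suc m) (λ a → g (suc (a ℕ.+ a))) ∎
  where
  open ≡-Reasoning
  lemma : ∀ a b c d → a + b + c + d ≡ a + d + (b + c)
  lemma = solve-∀

-- Doubling permutes the residues modulo 1 + 2m: 0, ..., m go in order to the even ones and m + 1,
-- ..., 2m to the odd ones.
∑-double : ∀ m g → ∑ (suc (m ℕ.+ m)) g ≡ ∑ (suc (m ℕ.+ m)) (g ∘ double m)
∑-double m g = begin
  ∑ (suc (m ℕ.+ m)) g
    ≡⟨ ∑-even-odd m g ⟩
  ∑ (suc m) (λ a → g (a ℕ.+ a)) + ∑ m (λ a → g (suc (a ℕ.+ a)))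
    ≡⟨ cong₂ _+_ (∑-cong< (suc m) λ a a≤m → cong g (sym (lower a (ℕₚ.≤-pred a≤m)))) (∑-cong m λ a → cong g (sym (upper a))) ⟩
  ∑ (suc m) (g ∘ double m) + ∑ m (λ a → g (double m (suc m ℕ.+ a)))
    ≡⟨ ∑-split (suc m) m (g ∘ double m) ⟨
  ∑ (suc (m ℕ.+ m)) (g ∘ double m) ∎
  where
  open ≡-Reasoning
  lower : ∀ a → a ≤ m → double m a ≡ a ℕ.+ a
  lower a a≤m = cong (λ b → if b then a ℕ.+ a else (a ℕ.+ a) ∸ suc (m ℕ.+ m)) (dec-true (a ℕ.≤? m) a≤m)
  upper : ∀ a → double m (suc m ℕ.+ a) ≡ suc (a ℕ.+ a)
  upper a = begin
    double m (suc m ℕ.+ a)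
      ≡⟨ cong (λ b → if b then x ℕ.+ x else (x ℕ.+ x) ∸ suc (m ℕ.+ m)) (dec-false (x ℕ.≤? m) (ℕₚ.m+1+n≰m m ∘ subst (_≤ m) (sym (ℕₚ.+-suc m a)))) ⟩
    (x ℕ.+ x) ∸ suc (m ℕ.+ m)
      ≡⟨ cong (_∸ suc (m ℕ.+ m)) (shuffle m a) ⟩
    (suc (m ℕ.+ m) ℕ.+ suc (a ℕ.+ a)) ∸ suc (m ℕ.+ m)
      ≡⟨ ℕₚ.m+n∸m≡n (suc (m ℕ.+ m)) _ ⟩
    suc (a ℕ.+ a) ∎
    where
    x = suc m ℕ.+ a
    shuffle : ∀ m a → suc m ℕ.+ a ℕ.+ (suc m ℕ.+ a) ≡ suc (m ℕ.+ m) ℕ.+ suc (a ℕ.+ a)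
    shuffle = ℕ-solve-∀

double-big : ∀ m a → double m a ℕ.+ suc (m ℕ.+ m) ℕ.* big m a ≡ a ℕ.+ a
double-big m a with big m a | double m a | half m a
... | _ | _ | small a≤m = trans (cong (a ℕ.+ a ℕ.+_) (ℕₚ.*-zeroʳ (suc (m ℕ.+ m)))) (ℕₚ.+-identityʳ _)
... | _ | _ | large m<a = trans (cong ((a ℕ.+ a) ∸ suc (m ℕ.+ m) ℕ.+_) (ℕₚ.*-identityʳ _))
  (ℕₚ.m∸n+n≡m (ℕₚ.+-mono-≤ m<a (ℕₚ.<⇒≤ m<a)))

-- Subtracting the odd modulus from 2a flips its parity, so the parity of the double is the carry; 1
-- - 2x is (-1) ^ x for x = 0, 1.
signℤ-double-big : ∀ m a → signℤ (double m a) ≡ 1ℤ - + 2 * + big m a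
signℤ-double-big m a with big m a | double m a | half m a
... | _ | _ | small a≤m = signℤ-double a
... | _ | _ | large m<a = begin
  signℤ x                           ≡⟨ lemma (signℤ x) ⟩
  - (signℤ x * - 1ℤ)                ≡⟨ cong (λ s → - (signℤ x * - s)) (signℤ-double m) ⟨
  - (signℤ x * signℤ n)             ≡⟨ cong -_ (signℤ-+ x n) ⟨
  - signℤ (x ℕ.+ n)                 ≡⟨ cong (λ k → - signℤ k) (ℕₚ.m∸n+n≡m (ℕₚ.+-mono-≤ m<a (ℕₚ.<⇒≤ m<a))) ⟩
  - signℤ (a ℕ.+ a)                 ≡⟨ cong -_ (signℤ-double a) ⟩
  - 1ℤ                              ∎
  where
  open ≡-Reasoning
  n = suc (m ℕ.+ m)
  x = (a ℕ.+ a) ∸ n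
  lemma : ∀ s → s ≡ - (s * - 1ℤ)
  lemma = solve-∀

-- Let D be the sum of the doubles, A = a + b + c and B the number of carries, so that D + n B = 2
-- A. If D = n, then n (1 + B) = 2 A with n odd leaves B = 1, A = n or B = 3, A = 2n, and the sign
-- factor 4 - 2 B is 2 or - 2. Conversely, A = n excludes B ≥ 2, since two large entries exceed n,
-- and its triples with B = 0 are subtracted. The added 1 makes the two values opposite, so that the
-- two corrections later cancel under reflection.
double-weight : ∀ m a b c → let n = suc (m ℕ.+ m) in
  ⟦ double m a ℕ.+ double m b ℕ.+ double m c ℕ.≟ n ⟧
    * (signℤ (double m a) + signℤ (double m b) + signℤ (double m c) + 1ℤ)
  ≡ + 2 * ⟦ a ℕ.+ b ℕ.+ c ℕ.≟ n ⟧
  - + 2 * (⟦ a ℕ.+ b ℕ.+ c ℕ.≟ n ⟧ * ((1ℤ - + big m a) * (1ℤ - + big m b) * (1ℤ - + big m c)))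
  - + 2 * (⟦ a ℕ.+ b ℕ.+ c ℕ.≟ n ℕ.+ n ⟧ * (+ big m a * + big m b * + big m c))
double-weight m a b c = trans (cong (x *_) signs) identity
  where
  n = suc (m ℕ.+ m)
  D = double m a ℕ.+ double m b ℕ.+ double m c
  A = a ℕ.+ b ℕ.+ c
  x = ⟦ D ℕ.≟ n ⟧
  y = ⟦ A ℕ.≟ n ⟧
  z = ⟦ A ℕ.≟ n ℕ.+ n ⟧
  Identity : ℤ → ℤ → ℤ → Set
  Identity B s t = x * (+ 4 - + 2 * B) ≡ + 2 * y - + 2 * (y * s) - + 2 * (z * t)

  signs : signℤ (double m a) + signℤ (double m b) + signℤ (double m c) + 1ℤ
        ≡ + 4 - + 2 * (+ big m a + + big m b + + big m c)
  signs = trans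
    (cong (_+ 1ℤ) (cong₂ _+_ (cong₂ _+_ (signℤ-double-big m a) (signℤ-double-big m b)) (signℤ-double-big m c)))
    (lemma (+ big m a) (+ big m b) (+ big m c))
    where
    lemma : ∀ a b c → 1ℤ - + 2 * a + (1ℤ - + 2 * b) + (1ℤ - + 2 * c) + 1ℤ ≡ + 4 - + 2 * (a + b + c)
    lemma = solve-∀

  total : D ℕ.+ n ℕ.* (big m a ℕ.+ big m b ℕ.+ big m c) ≡ A ℕ.+ A
  total = begin
    D ℕ.+ n ℕ.* (big m a ℕ.+ big m b ℕ.+ big m c)
      ≡⟨ lemma₁ (double m a) (double m b) (double m c) (big m a) (big m b) (big m c) n ⟩
    double m a ℕ.+ n ℕ.* big m a ℕ.+ (double m b ℕ.+ n ℕ.* big m b) ℕ.+ (double m c ℕ.+ n ℕ.* big m c)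
      ≡⟨ cong₂ ℕ._+_ (cong₂ ℕ._+_ (double-big m a) (double-big m b)) (double-big m c) ⟩
    a ℕ.+ a ℕ.+ (b ℕ.+ b) ℕ.+ (c ℕ.+ c)
      ≡⟨ lemma₂ a b c ⟩
    A ℕ.+ A ∎
    where
    open ≡-Reasoning
    lemma₁ : ∀ p q r u v w n → p ℕ.+ q ℕ.+ r ℕ.+ n ℕ.* (u ℕ.+ v ℕ.+ w)
      ≡ p ℕ.+ n ℕ.* u ℕ.+ (q ℕ.+ n ℕ.* v) ℕ.+ (r ℕ.+ n ℕ.* w)
    lemma₁ = ℕ-solve-∀
    lemma₂ : ∀ a b c → a ℕ.+ a ℕ.+ (b ℕ.+ b) ℕ.+ (c ℕ.+ c) ≡ a ℕ.+ b ℕ.+ c ℕ.+ (a ℕ.+ b ℕ.+ c)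
    lemma₂ = ℕ-solve-∀

  halve : ∀ {i j} → i ℕ.+ i ≡ j ℕ.+ j → i ≡ j
  halve {i} {j} e = ℕₚ.*-cancelˡ-≡ i j 2 (trans (two i) (trans e (sym (two j))))
    where
    two : ∀ i → 2 ℕ.* i ≡ i ℕ.+ i
    two = ℕ-solve-∀

  none-big : D ℕ.+ n ℕ.* 0 ≡ A ℕ.+ A → Identity 0ℤ 1ℤ 0ℤ
  none-big e = trans (cong (_* (+ 4 - + 2 * 0ℤ)) x≡0) (lemma y z)
    where
    x≡0 : x ≡ 0ℤ
    x≡0 = ⟦⟧-no (D ℕ.≟ n) λ D≡n → even≢odd A m
      (trans (sym e) (trans (cong₂ ℕ._+_ D≡n (ℕₚ.*-zeroʳ n)) (ℕₚ.+-identityʳ n)))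
    lemma : ∀ y z → 0ℤ * (+ 4 - + 2 * 0ℤ) ≡ + 2 * y - + 2 * (y * 1ℤ) - + 2 * (z * 0ℤ)
    lemma = solve-∀

  one-big : D ℕ.+ n ℕ.* 1 ≡ A ℕ.+ A → Identity (+ 1) 0ℤ 0ℤ
  one-big e = trans (cong (_* (+ 4 - + 2 * + 1)) x≡y) (lemma y z)
    where
    e′ : D ℕ.+ n ≡ A ℕ.+ A
    e′ = trans (cong (D ℕ.+_) (sym (ℕₚ.*-identityʳ n))) e
    x≡y : x ≡ y
    x≡y = ⟦⟧-⇔ (D ℕ.≟ n) (A ℕ.≟ n)
      (λ D≡n → halve (trans (sym e′) (cong (ℕ._+ n) D≡n)))
      (λ A≡n → ℕₚ.+-cancelʳ-≡ n D n (trans e′ (cong₂ ℕ._+_ A≡n A≡n)))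
    lemma : ∀ y z → y * (+ 4 - + 2 * + 1) ≡ + 2 * y - + 2 * (y * 0ℤ) - + 2 * (z * 0ℤ)
    lemma = solve-∀

  A≢n : n < A → y ≡ 0ℤ
  A≢n n<A = ⟦⟧-no (A ℕ.≟ n) λ A≡n → ℕₚ.<⇒≢ n<A (sym A≡n)

  two-big : n < A → Identity (+ 2) 0ℤ 0ℤ
  two-big n<A = trans (lemma x z) (cong (λ y → + 2 * y - + 2 * (y * 0ℤ) - + 2 * (z * 0ℤ)) (sym (A≢n n<A)))
    where
    lemma : ∀ x z → x * (+ 4 - + 2 * + 2) ≡ + 2 * 0ℤ - + 2 * (0ℤ * 0ℤ) - + 2 * (z * 0ℤ)
    lemma = solve-∀

  three-big : D ℕ.+ n ℕ.* 3 ≡ A ℕ.+ A → n < A → Identity (+ 3) 0ℤ 1ℤ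
  three-big e n<A = begin
    x * (+ 4 - + 2 * + 3)                                    ≡⟨ cong (_* (+ 4 - + 2 * + 3)) x≡z ⟩
    z * (+ 4 - + 2 * + 3)                                    ≡⟨ lemma z ⟩
    + 2 * 0ℤ - + 2 * (0ℤ * 0ℤ) - + 2 * (z * 1ℤ)              ≡⟨ cong (λ y → + 2 * y - + 2 * (y * 0ℤ) - + 2 * (z * 1ℤ)) (A≢n n<A) ⟨
    + 2 * y - + 2 * (y * 0ℤ) - + 2 * (z * 1ℤ)                ∎
    where
    open ≡-Reasoning
    four : ∀ n → n ℕ.+ n ℕ.* 3 ≡ n ℕ.+ n ℕ.+ (n ℕ.+ n)
    four = ℕ-solve-∀
    x≡z : x ≡ z
    x≡z = ⟦⟧-⇔ (D ℕ.≟ n) (A ℕ.≟ n ℕ.+ n)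
      (λ D≡n → halve (trans (sym e) (trans (cong (ℕ._+ n ℕ.* 3) D≡n) (four n))))
      (λ A≡2n → ℕₚ.+-cancelʳ-≡ (n ℕ.* 3) D n (trans e (trans (cong₂ ℕ._+_ A≡2n A≡2n) (sym (four n)))))
    lemma : ∀ z → z * (+ 4 - + 2 * + 3) ≡ + 2 * 0ℤ - + 2 * (0ℤ * 0ℤ) - + 2 * (z * 1ℤ)
    lemma = solve-∀

  n<sum : ∀ {i j} → m < i → m < j → n < i ℕ.+ j
  n<sum {i} {j} m<i m<j = subst (ℕ._≤ i ℕ.+ j) (cong suc (ℕₚ.+-suc m m)) (ℕₚ.+-mono-≤ m<i m<j)

  cases : ∀ {u v w u′ v′ w′} → Half m a u u′ → Half m b v v′ → Half m c w w′ →
    D ℕ.+ n ℕ.* (u ℕ.+ v ℕ.+ w) ≡ A ℕ.+ A →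
    Identity (+ u + + v + + w) ((1ℤ - + u) * (1ℤ - + v) * (1ℤ - + w)) (+ u * + v * + w)
  cases (small _) (small _) (small _) = none-big
  cases (small _) (small _) (large _) = one-big
  cases (small _) (large _) (small _) = one-big
  cases (large _) (small _) (small _) = one-big
  cases (small _) (large q) (large r) _ =
    two-big (ℕₚ.<-≤-trans (n<sum q r) (ℕₚ.≤-trans (ℕₚ.m≤n+m _ a) (ℕₚ.≤-reflexive (sym (ℕₚ.+-assoc a b c)))))
  cases (large p) (small _) (large r) _ =
    two-big (ℕₚ.<-≤-trans (n<sum p r) (ℕₚ.+-monoˡ-≤ c (ℕₚ.m≤m+n a b)))
  cases (large p) (large q) (small _) _ = two-big (ℕₚ.<-≤-trans (n<sum p q) (ℕₚ.m≤m+n _ c))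
  cases (large p) (large q) (large _) e = three-big e (ℕₚ.<-≤-trans (n<sum p q) (ℕₚ.m≤m+n _ c))

  identity : Identity (+ big m a + + big m b + + big m c)
    ((1ℤ - + big m a) * (1ℤ - + big m b) * (1ℤ - + big m c)) (+ big m a * + big m b * + big m c)
  identity = cases (half m a) (half m b) (half m c) total

-- Signed triple sums of an odd function.

module OddTripleSums (m : ℕ) (N : ℤ) (f : ℕ → ℤ) (f-0 : f 0 ≡ 0ℤ) (f-n : f (suc (m ℕ.+ m)) ≡ 0ℤ)
  (f-neg : ∀ i → i ≤ suc (m ℕ.+ m) → f (suc (m ℕ.+ m) ∸ i) ≋ - f i mod N) where

  n : ℕ
  n = suc (m ℕ.+ m)

  -- For i, j, k < n the multiples of n among the sums i + j + k are 0, n and 2n, and 0 occurs only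
  -- at i = j = k = 0, where `f` vanishes. So `W₁` and `W₂` together stand for i + j + k ≡ 0 modulo
  -- n.
  W₁ W₂ : ℕ → ℕ → ℕ → ℤ
  W₁ i j k = ⟦ i ℕ.+ j ℕ.+ k ℕ.≟ n ⟧
  W₂ i j k = ⟦ i ℕ.+ j ℕ.+ k ℕ.≟ n ℕ.+ n ⟧

  Z′ S′ : ℤ
  Z′ = ∑³ n λ i j k → W₁ i j k * (f i * f j * f k)
  S′ = ∑³ n λ i j k → W₁ i j k * (signℤ i * f i * f j * f k)

  rotate-+ : ∀ i j k → k ℕ.+ i ℕ.+ j ≡ i ℕ.+ j ℕ.+ k
  rotate-+ i j k = trans (ℕₚ.+-assoc k i j) (ℕₚ.+-comm k (i ℕ.+ j))

  W₁-rotate : ∀ i j k → W₁ k i j ≡ W₁ i j k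
  W₁-rotate i j k = cong (λ s → ⟦ s ℕ.≟ n ⟧) (rotate-+ i j k)

  W₂-reverse : ∀ i j k → i < n → j < n → k < n → W₂ (n ∸ i) (n ∸ j) (n ∸ k) ≡ W₁ i j k
  W₂-reverse i j k i<n j<n k<n = ⟦⟧-⇔ (n ∸ i ℕ.+ (n ∸ j) ℕ.+ (n ∸ k) ℕ.≟ n ℕ.+ n) (i ℕ.+ j ℕ.+ k ℕ.≟ n)
    (λ e → ℕₚ.+-cancelˡ-≡ (n ℕ.+ n) _ _ (trans (cong (ℕ._+ (i ℕ.+ j ℕ.+ k)) (sym e)) total))
    (λ e → ℕₚ.+-cancelʳ-≡ (i ℕ.+ j ℕ.+ k) _ _ (trans total (cong (n ℕ.+ n ℕ.+_) (sym e))))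
    where
    total : n ∸ i ℕ.+ (n ∸ j) ℕ.+ (n ∸ k) ℕ.+ (i ℕ.+ j ℕ.+ k) ≡ n ℕ.+ n ℕ.+ n
    total = trans (lemma (n ∸ i) (n ∸ j) (n ∸ k) i j k)
      (cong₂ ℕ._+_ (cong₂ ℕ._+_ (ℕₚ.m∸n+n≡m (ℕₚ.<⇒≤ i<n)) (ℕₚ.m∸n+n≡m (ℕₚ.<⇒≤ j<n))) (ℕₚ.m∸n+n≡m (ℕₚ.<⇒≤ k<n)))
      where
      lemma : ∀ a b c i j k → a ℕ.+ b ℕ.+ c ℕ.+ (i ℕ.+ j ℕ.+ k) ≡ a ℕ.+ i ℕ.+ (b ℕ.+ j) ℕ.+ (c ℕ.+ k)
      lemma = ℕ-solve-∀

  -- The summands vanish when an index is 0 or n, so i ↦ n ∸ i permutes the terms.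
  ∑³-reverse-f : ∀ (V : ℕ → ℕ → ℕ → ℤ) →
    ∑³ n (λ i j k → V i j k * (f i * f j * f k))
    ≡ ∑³ n (λ i j k → V (n ∸ i) (n ∸ j) (n ∸ k) * (f (n ∸ i) * f (n ∸ j) * f (n ∸ k)))
  ∑³-reverse-f V = ∑³-reverse n (λ i j k → V i j k * (f i * f j * f k))
    (λ j k → trans (vanish₁ (V n j k) f-n (f j) (f k)) (sym (vanish₁ (V 0 j k) f-0 (f j) (f k))))
    (λ i k → trans (vanish₂ (V i n k) (f i) f-n (f k)) (sym (vanish₂ (V i 0 k) (f i) f-0 (f k))))
    (λ i j → trans (vanish₃ (V i j n) (f i) (f j) f-n) (sym (vanish₃ (V i j 0) (f i) (f j) f-0)))
    where
    vanish₁ : ∀ v {a} → a ≡ 0ℤ → ∀ b c → v * (a * b * c) ≡ 0ℤ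
    vanish₁ v refl = lemma v
      where
      lemma : ∀ v b c → v * (0ℤ * b * c) ≡ 0ℤ
      lemma = solve-∀
    vanish₂ : ∀ v a {b} → b ≡ 0ℤ → ∀ c → v * (a * b * c) ≡ 0ℤ
    vanish₂ v a refl = lemma v a
      where
      lemma : ∀ v a c → v * (a * 0ℤ * c) ≡ 0ℤ
      lemma = solve-∀
    vanish₃ : ∀ v a b {c} → c ≡ 0ℤ → v * (a * b * c) ≡ 0ℤ
    vanish₃ v a b refl = lemma v a b
      where
      lemma : ∀ v a b → v * (a * b * 0ℤ) ≡ 0ℤ
      lemma = solve-∀

  rotate-sum : ∀ (V : ℕ → ℕ → ℕ → ℤ) → (∀ i j k → V k i j ≡ V i j k) → ∀ (s : ℕ → ℤ) →
    ∑³ n (λ i j k → V i j k * (s i * f i * f j * f k)) ≡ ∑³ n (λ i j k → V i j k * (s k * (f i * f j * f k)))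
  rotate-sum V V-rotate s = trans (∑³-rotate n (λ i j k → V i j k * (s i * f i * f j * f k)))
    (∑³-cong n λ i j k → trans
      (cong (_* (s k * f k * f i * f j)) (V-rotate i j k))
      (lemma (V i j k) (s k) (f i) (f j) (f k)))
    where
    lemma : ∀ v s a b c → v * (s * c * a * b) ≡ v * (s * (a * b * c))
    lemma = solve-∀

  -- By rotation each of the three signs contributes `S′`. The left side has the weight that
  -- `double-weight` can evaluate.
  symmetrized-sum : ∑³ n (λ i j k → W₁ i j k * (signℤ i + signℤ j + signℤ k + 1ℤ) * (f i * f j * f k)) ≡ + 3 * S′ + Z′
  symmetrized-sum = begin
    ∑³ n (λ i j k → W₁ i j k * (signℤ i + signℤ j + signℤ k + 1ℤ) * (f i * f j * f k))
      ≡⟨ ∑³-cong n (λ i j k → distribute (W₁ i j k) (signℤ i) (signℤ j) (signℤ k) (f i) (f j) (f k)) ⟩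
    ∑³ n (λ i j k → F₁ i j k + F₂ i j k + F₃ i j k + F₀ i j k)
      ≡⟨ trans (∑³-+ n (λ i j k → F₁ i j k + F₂ i j k + F₃ i j k) F₀)
           (cong (_+ Z′) (trans (∑³-+ n (λ i j k → F₁ i j k + F₂ i j k) F₃)
             (cong (_+ ∑³ n F₃) (∑³-+ n F₁ F₂)))) ⟩
    S′ + ∑³ n F₂ + ∑³ n F₃ + Z′
      ≡⟨ cong₂ (λ a b → S′ + a + b + Z′) F₂≡S F₃≡S ⟩
    S′ + S′ + S′ + Z′
      ≡⟨ triple S′ Z′ ⟩
    + 3 * S′ + Z′ ∎
    where
    open ≡-Reasoning
    F₀ F₁ F₂ F₃ : ℕ → ℕ → ℕ → ℤ
    F₀ i j k = W₁ i j k * (f i * f j * f k)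
    F₁ i j k = W₁ i j k * (signℤ i * f i * f j * f k)
    F₂ i j k = W₁ i j k * (signℤ j * (f i * f j * f k))
    F₃ i j k = W₁ i j k * (signℤ k * (f i * f j * f k))
    F₃≡S : ∑³ n F₃ ≡ S′
    F₃≡S = sym (rotate-sum W₁ W₁-rotate signℤ)
    F₂≡S : ∑³ n F₂ ≡ S′
    F₂≡S = sym (trans (sym F₃≡S) (trans (∑³-rotate n F₃) (∑³-cong n λ i j k → trans
      (cong (_* (signℤ j * (f k * f i * f j))) (W₁-rotate i j k))
      (lemma (W₁ i j k) (signℤ j) (f i) (f j) (f k)))))
      where
      lemma : ∀ w s a b c → w * (s * (c * a * b)) ≡ w * (s * (a * b * c))
      lemma = solve-∀
    distribute : ∀ w r s t a b c → w * (r + s + t + 1ℤ) * (a * b * c)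
      ≡ w * (r * a * b * c) + w * (s * (a * b * c)) + w * (t * (a * b * c)) + w * (a * b * c)
    distribute = solve-∀
    triple : ∀ s z → s + s + s + z ≡ + 3 * s + z
    triple = solve-∀

  module _ {d : ℤ} (3≋0 : + 3 ≋ 0ℤ mod d) (N≋0 : N ≋ 0ℤ mod d)
    (f-double : ∀ a → a < n → + 2 * f (double m a) ≋ f a mod N) where

    private
      s b : ℕ → ℤ
      s a = 1ℤ - + big m a
      b a = + big m a

      R : ℤ
      R = ∑³ n λ i j k → W₁ i j k * (s i * s j * s k) * (f i * f j * f k)

      big-reverse : ∀ i → i < n → b (n ∸ i) ≡ s i
      big-reverse i i<n with big m i | double m i | half m i | big m (n ∸ i) | double m (n ∸ i) | half m (n ∸ i)
      ... | _ | _ | small i≤m | _ | _ | large _   = refl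
      ... | _ | _ | large m<i | _ | _ | small _   = refl
      ... | _ | _ | small i≤m | _ | _ | small ≤m = ⊥-elim (ℕₚ.<⇒≱ (ℕₚ.n<1+n (m ℕ.+ m))
        (subst (_≤ m ℕ.+ m) (ℕₚ.m∸n+n≡m (ℕₚ.<⇒≤ i<n)) (ℕₚ.+-mono-≤ ≤m i≤m)))
      ... | _ | _ | large m<i | _ | _ | large m< = ⊥-elim (ℕₚ.<⇒≱ (ℕₚ.n<1+n n)
        (subst (suc n ≤_) (ℕₚ.m∸n+n≡m (ℕₚ.<⇒≤ i<n)) (subst (_≤ n ∸ i ℕ.+ i) (cong suc (ℕₚ.+-suc m m)) (ℕₚ.+-mono-≤ m< m<i))))

      -- Reflection turns large indices with sum 2n into small ones with sum n, and three odd
      -- factors give the sign. Oddness of `f` is known only modulo `N`; `cubic-sum-lift` gains the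
      -- factor `d`.
      all-big : ∑³ n (λ i j k → W₂ i j k * (b i * b j * b k) * (f i * f j * f k)) ≋ - R mod (N * d)
      all-big = begin
        ∑³ n (λ i j k → W₂ i j k * (b i * b j * b k) * (f i * f j * f k))
          ≡⟨ ∑³-reverse-f (λ i j k → W₂ i j k * (b i * b j * b k)) ⟩
        ∑³ n (λ i j k → W₂ (n ∸ i) (n ∸ j) (n ∸ k) * (b (n ∸ i) * b (n ∸ j) * b (n ∸ k)) * (f (n ∸ i) * f (n ∸ j) * f (n ∸ k)))
          ≡⟨ ∑³-cong< n (λ i j k i<n j<n k<n → cong (_* (f (n ∸ i) * f (n ∸ j) * f (n ∸ k)))
               (cong₂ _*_ (W₂-reverse i j k i<n j<n k<n)
                 (cong₂ _*_ (cong₂ _*_ (big-reverse i i<n) (big-reverse j j<n)) (big-reverse k k<n)))) ⟩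
        ∑³ n (λ i j k → W₁ i j k * (s i * s j * s k) * (f (n ∸ i) * f (n ∸ j) * f (n ∸ k)))
          ≈⟨ cubic-sum-lift n (λ i j k → W₁ i j k * (s i * s j * s k)) rotate 3≋0 N≋0
               (λ i → f (n ∸ i)) (λ i → - f i) (λ i i<n → f-neg i (ℕₚ.<⇒≤ i<n)) ⟩
        ∑³ n (λ i j k → W₁ i j k * (s i * s j * s k) * (- f i * - f j * - f k))
          ≡⟨ ∑³-cong n (λ i j k → negate (W₁ i j k * (s i * s j * s k)) (f i) (f j) (f k)) ⟩
        ∑³ n (λ i j k → - 1ℤ * (W₁ i j k * (s i * s j * s k) * (f i * f j * f k)))
          ≡⟨ ∑³-*ˡ n (- 1ℤ) _ ⟩
        - 1ℤ * R
          ≡⟨ ℤₚ.-1*i≡-i R ⟩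
        - R ∎
        where
        open ≋-Reasoning (N * d)
        rotate : ∀ i j k → W₁ k i j * (s k * s i * s j) ≡ W₁ i j k * (s i * s j * s k)
        rotate i j k = cong₂ _*_ (W₁-rotate i j k) (lemma (s i) (s j) (s k))
          where
          lemma : ∀ a b c → c * a * b ≡ a * b * c
          lemma = solve-∀
        negate : ∀ w a b c → w * (- a * - b * - c) ≡ - 1ℤ * (w * (a * b * c))
        negate = solve-∀

    -- The 8 = 2³ supplies a 2 for each factor, as 2 f (2a) ≡ f a. After reindexing by doubling,
    -- `double-weight` leaves 2 `Z′` and two corrections, which `all-big` makes opposite. The
    -- outcome amounts to 24 `S′` + 6 `Z′` ≡ 0.
    alternating-relation : + 8 * (+ 3 * S′ + Z′) ≋ + 2 * Z′ mod (N * d)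
    alternating-relation = begin
      + 8 * (+ 3 * S′ + Z′)
        ≡⟨ cong (+ 8 *_) symmetrized-sum ⟨
      + 8 * ∑³ n (λ i j k → V i j k * (f i * f j * f k))
        ≡⟨ ∑³-*ˡ n (+ 8) _ ⟨
      ∑³ n (λ i j k → + 8 * (V i j k * (f i * f j * f k)))
        ≡⟨ ∑³-cong n (λ i j k → eight (V i j k) (f i) (f j) (f k)) ⟩
      ∑³ n (λ i j k → V i j k * (+ 2 * f i * (+ 2 * f j) * (+ 2 * f k)))
        ≡⟨ ∑³-reindex n (double m) (∑-double m) _ ⟩
      ∑³ n (λ i j k → V (δ i) (δ j) (δ k) * (+ 2 * f (δ i) * (+ 2 * f (δ j)) * (+ 2 * f (δ k))))
        ≈⟨ cubic-sum-lift n (λ i j k → V (δ i) (δ j) (δ k)) (λ i j k → V-rotate (δ i) (δ j) (δ k)) 3≋0 N≋0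
             (λ i → + 2 * f (δ i)) f f-double ⟩
      ∑³ n (λ i j k → V (δ i) (δ j) (δ k) * (f i * f j * f k))
        ≡⟨ ∑³-cong n (λ i j k → trans (cong (_* (f i * f j * f k)) (double-weight m i j k))
             (distribute (W₁ i j k) (s i * s j * s k) (W₂ i j k) (b i * b j * b k) (f i * f j * f k))) ⟩
      ∑³ n (λ i j k → + 2 * (W₁ i j k * (f i * f j * f k))
        + (- + 2 * (W₁ i j k * (s i * s j * s k) * (f i * f j * f k))
        + - + 2 * (W₂ i j k * (b i * b j * b k) * (f i * f j * f k))))
        ≡⟨ trans (∑³-+ n _ _) (cong₂ _+_ (∑³-*ˡ n (+ 2) _) (trans (∑³-+ n _ _)
             (cong₂ _+_ (∑³-*ˡ n (- + 2) _) (∑³-*ˡ n (- + 2) _)))) ⟩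
      + 2 * Z′ + (- + 2 * R + - + 2 * ∑³ n (λ i j k → W₂ i j k * (b i * b j * b k) * (f i * f j * f k)))
        ≈⟨ ≋-+ˡ (+ 2 * Z′) (≋-+ˡ (- + 2 * R) (≋-*ˡ (- + 2) all-big)) ⟩
      + 2 * Z′ + (- + 2 * R + - + 2 * - R)
        ≡⟨ cancel Z′ R ⟩
      + 2 * Z′ ∎
      where
      open ≋-Reasoning (N * d)
      δ = double m
      V : ℕ → ℕ → ℕ → ℤ
      V i j k = W₁ i j k * (signℤ i + signℤ j + signℤ k + 1ℤ)
      V-rotate : ∀ i j k → V k i j ≡ V i j k
      V-rotate i j k = cong₂ _*_ (W₁-rotate i j k) (lemma (signℤ i) (signℤ j) (signℤ k))
        where
        lemma : ∀ a b c → c + a + b + 1ℤ ≡ a + b + c + 1ℤ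
        lemma = solve-∀
      eight : ∀ v a b c → + 8 * (v * (a * b * c)) ≡ v * (+ 2 * a * (+ 2 * b) * (+ 2 * c))
      eight = solve-∀
      distribute : ∀ w s z t x → (+ 2 * w - + 2 * (w * s) - + 2 * (z * t)) * x
        ≡ + 2 * (w * x) + (- + 2 * (w * s * x) + - + 2 * (z * t * x))
      distribute = solve-∀
      cancel : ∀ z r → + 2 * z + (- + 2 * r + - + 2 * - r) ≡ + 2 * z
      cancel = solve-∀

  -- Reflection carries the sum over i + j + k = 2n to the one over n; the sign changes because n is
  -- odd, and so do the three factors, which makes four changes in all.
  twice-alternating-sum : + 2 * S′ ≋ ∑³ n (λ i j k → (W₁ i j k + W₂ i j k) * (signℤ i * f i * f j * f k)) mod N
  twice-alternating-sum = begin
    + 2 * S′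
      ≡⟨ two S′ ⟩
    S′ + S′
      ≈⟨ ≋-+ˡ S′ reversed ⟨
    S′ + ∑³ n (λ i j k → W₂ i j k * (signℤ i * f i * f j * f k))
      ≡⟨ ∑³-+ n _ _ ⟨
    ∑³ n (λ i j k → W₁ i j k * (signℤ i * f i * f j * f k) + W₂ i j k * (signℤ i * f i * f j * f k))
      ≡⟨ ∑³-cong n (λ i j k → ℤₚ.*-distribʳ-+ (signℤ i * f i * f j * f k) (W₁ i j k) (W₂ i j k)) ⟨
    ∑³ n (λ i j k → (W₁ i j k + W₂ i j k) * (signℤ i * f i * f j * f k)) ∎
    where
    open ≋-Reasoning N
    two : ∀ s → + 2 * s ≡ s + s
    two = solve-∀
    assoc : ∀ w s a b c → w * (s * a * b * c) ≡ w * s * (a * b * c)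
    assoc = solve-∀
    cube : ∀ w s a b c → w * - s * (- a * - b * - c) ≡ w * (s * a * b * c)
    cube = solve-∀
    reversed : ∑³ n (λ i j k → W₂ i j k * (signℤ i * f i * f j * f k)) ≋ S′ mod N
    reversed = begin
      ∑³ n (λ i j k → W₂ i j k * (signℤ i * f i * f j * f k))
        ≡⟨ ∑³-cong n (λ i j k → assoc (W₂ i j k) (signℤ i) (f i) (f j) (f k)) ⟩
      ∑³ n (λ i j k → W₂ i j k * signℤ i * (f i * f j * f k))
        ≡⟨ ∑³-reverse-f (λ i j k → W₂ i j k * signℤ i) ⟩
      ∑³ n (λ i j k → W₂ (n ∸ i) (n ∸ j) (n ∸ k) * signℤ (n ∸ i) * (f (n ∸ i) * f (n ∸ j) * f (n ∸ k)))
        ≈⟨ ∑³-≋< n (λ i j k i<n j<n k<n → ≋-*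
             (≡⇒≋ (cong₂ _*_ (W₂-reverse i j k i<n j<n k<n) (signℤ-∸ m i (ℕₚ.<⇒≤ i<n))))
             (≋-* (≋-* (f-neg i (ℕₚ.<⇒≤ i<n)) (f-neg j (ℕₚ.<⇒≤ j<n))) (f-neg k (ℕₚ.<⇒≤ k<n)))) ⟩
      ∑³ n (λ i j k → W₁ i j k * - signℤ i * (- f i * - f j * - f k))
        ≡⟨ ∑³-cong n (λ i j k → cube (W₁ i j k) (signℤ i) (f i) (f j) (f k)) ⟩
      S′ ∎

-- Divisibility, units and residues.

∣⇒≋0 : ∀ {k a} → k ∣ ℤ.∣ a ∣ → a ≋ 0ℤ mod + k
∣⇒≋0 {k} {a} k∣a with ∣ᵤ⇒∣ {+ k} {a} k∣a
... | ℤ∣.divides c e = by c (trans e (sym (ℤₚ.+-identityˡ (c * + k))))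

≋0⇒∣ : ∀ {k a} → a ≋ 0ℤ mod + k → k ∣ ℤ.∣ a ∣
≋0⇒∣ {k} {a} (by c e) = ∣⇒∣ᵤ {+ k} {a} (ℤ∣.divides c (trans e (ℤₚ.+-identityˡ (c * + k))))

≋⇒≋0 : ∀ {a b M} → a ≋ b mod M → a - b ≋ 0ℤ mod M
≋⇒≋0 {b = b} {M} (by c refl) = by c (lemma b c M)
  where
  lemma : ∀ b c M → b + c * M - b ≡ 0ℤ + c * M
  lemma = solve-∀

≋0⇒≋ : ∀ {a b M} → a - b ≋ 0ℤ mod M → a ≋ b mod M
≋0⇒≋ {a} {b} {M} e = begin
  a         ≡⟨ lemma a b ⟩
  a - b + b ≈⟨ ≋-+ʳ b e ⟩
  0ℤ + b    ≡⟨ ℤₚ.+-identityˡ b ⟩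
  b         ∎
  where
  open ≋-Reasoning M
  lemma : ∀ a b → a ≡ a - b + b
  lemma = solve-∀

≋-modulus : ∀ {a b M d} c → M ≡ d * c → a ≋ b mod M → a ≋ b mod d
≋-modulus c refl e = ≋-weaken _ c e

≋-pos-cong : ∀ {i j M} → i ≡ j → + i ≋ + j mod M
≋-pos-cong e = ≡⇒≋ (cong +_ e)

∣-unit : ∀ {k x y} s t → t * s ≋ 1ℤ mod + k → s * + x ≋ + y mod + k →
  (k ∣ x → k ∣ y) × (k ∣ y → k ∣ x)
∣-unit {k} {x} {y} s t ts sx≋y = forward , backward
  where
  forward : k ∣ x → k ∣ y
  forward k∣x = ≋0⇒∣ (begin
    + y     ≈⟨ sx≋y ⟨
    s * + x ≈⟨ ≋-*ˡ s (∣⇒≋0 k∣x) ⟩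
    s * 0ℤ  ≡⟨ ℤₚ.*-zeroʳ s ⟩
    0ℤ      ∎)
    where open ≋-Reasoning (+ k)
  backward : k ∣ y → k ∣ x
  backward k∣y = ≋0⇒∣ (≋-cancel s t ts (begin
    s * + x ≈⟨ sx≋y ⟩
    + y     ≈⟨ ∣⇒≋0 k∣y ⟩
    0ℤ      ≡⟨ ℤₚ.*-zeroʳ s ⟨
    s * 0ℤ  ∎))
    where open ≋-Reasoning (+ k)

⟦∣⟧-unit : ∀ {k x y} s t → t * s ≋ 1ℤ mod + k → s * + x ≋ + y mod + k → ⟦ k ∣? x ⟧ ≡ ⟦ k ∣? y ⟧
⟦∣⟧-unit {k} {x} {y} s t ts sx≋y =
  ⟦⟧-⇔ (k ∣? x) (k ∣? y) (proj₁ (∣-unit s t ts sx≋y)) (proj₂ (∣-unit s t ts sx≋y))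

-1-unit : ∀ {M} → - 1ℤ * - 1ℤ ≋ 1ℤ mod M
-1-unit = ≡⇒≋ refl

1-unit : ∀ {M} → 1ℤ * 1ℤ ≋ 1ℤ mod M
1-unit = ≡⇒≋ refl

⟦∣⟧-periodic : ∀ {k} x y → + x ≋ + y mod + k → ⟦ k ∣? x ⟧ ≡ ⟦ k ∣? y ⟧
⟦∣⟧-periodic {k} x y x≋y = ⟦∣⟧-unit {k} {x} {y} 1ℤ 1ℤ 1-unit (≋-trans (≡⇒≋ (ℤₚ.*-identityˡ (+ x))) x≋y)

negate-∸ : ∀ {k} n i → k ∣ n → i ≤ n → - 1ℤ * + i ≋ + (n ∸ i) mod + k
negate-∸ {k} n i k∣n i≤n = begin
  - 1ℤ * + i            ≡⟨ lemma (+ i) ⟩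
  0ℤ + - + i            ≈⟨ ≋-+ʳ (- + i) (∣⇒≋0 {a = + n} k∣n) ⟨
  + n + - + i           ≡⟨ cong (λ m → + m + - + i) (ℕₚ.m∸n+n≡m i≤n) ⟨
  + (n ∸ i ℕ.+ i) + - + i ≡⟨ lemma′ (+ (n ∸ i)) (+ i) ⟩
  + (n ∸ i)             ∎
  where
  open ≋-Reasoning (+ k)
  lemma : ∀ i → - 1ℤ * i ≡ 0ℤ + - i
  lemma = solve-∀
  lemma′ : ∀ a i → a + i + - i ≡ a
  lemma′ = solve-∀

coprime⇒inverse : ∀ {i k} → Coprime i k → ∃[ v ] v * + i ≋ 1ℤ mod + k
coprime⇒inverse {i} {k} c with coprime-Bézout c
... | Bézout.+- x y e = + x , by (+ y) (begin
  + x * + i        ≡⟨ ℤₚ.pos-* x i ⟨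
  + (x ℕ.* i)      ≡⟨ cong +_ e ⟨
  + (1 ℕ.+ y ℕ.* k) ≡⟨ cong (λ t → 1ℤ + t) (ℤₚ.pos-* y k) ⟩
  1ℤ + + y * + k   ∎)
  where open ≡-Reasoning
... | Bézout.-+ x y e = - + x , by (- + y) (begin
  - + x * + i                       ≡⟨ lemma (+ x) (+ i) ⟩
  1ℤ - (1ℤ + + x * + i)             ≡⟨ cong (λ t → 1ℤ - (1ℤ + t)) (ℤₚ.pos-* x i) ⟨
  1ℤ - + (1 ℕ.+ x ℕ.* i)            ≡⟨ cong (λ t → 1ℤ - + t) e ⟩
  1ℤ - + (y ℕ.* k)                  ≡⟨ cong (λ t → 1ℤ - t) (ℤₚ.pos-* y k) ⟩
  1ℤ - + y * + k                    ≡⟨ cong (λ t → 1ℤ + t) (ℤₚ.neg-distribˡ-* (+ y) (+ k)) ⟩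
  1ℤ + - + y * + k                  ∎)
  where
  open ≡-Reasoning
  lemma : ∀ x i → - x * i ≡ 1ℤ - (1ℤ + x * i)
  lemma = solve-∀

∤⇒coprime : ∀ {p i} → Prime p → ¬ p ∣ i → Coprime i p
∤⇒coprime {p} pp p∤i {d} (d∣i , d∣p) with prime⇒irreducible pp d∣p
... | inj₁ d≡1 = d≡1
... | inj₂ d≡p = ⊥-elim (p∤i (subst (_∣ _) d≡p d∣i))

coprime-*ʳ : ∀ {i j k} → Coprime i j → Coprime i k → Coprime i (j ℕ.* k)
coprime-*ʳ i⊥j i⊥k {d} (d∣i , d∣jk) = i⊥k (d∣i , Coprimality.coprime-divisor {d} (λ (e∣d , e∣j) → i⊥j (ℕ∣.∣-trans e∣d d∣i , e∣j)) d∣jk)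

coprime-^ : ∀ {i k} e → Coprime i k → Coprime i (k ^ e)
coprime-^ zero    c (_ , d∣1) = ℕ∣.∣1⇒≡1 d∣1
coprime-^ (suc e) c = coprime-*ʳ c (coprime-^ e c)

∤-inverse : ∀ {p i} e → Prime p → ¬ p ∣ i → ∃[ v ] v * + i ≋ 1ℤ mod + (p ^ e)
∤-inverse e pp p∤i = coprime⇒inverse (coprime-^ e (∤⇒coprime pp p∤i))

residue : ∀ a k .{{_ : ℕ.NonZero k}} → + (a %ℕ k) ≋ a mod + k
residue a k = ≋-sym (by (a /ℕ k) (a≡a%ℕn+[a/ℕn]*n a k))

residue-unique : ∀ {k i j} → i < k → j < k → + i ≋ + j mod + k → i ≡ j
residue-unique {k} {i} {j} i<k j<k e = [ (λ i≤j → sym (go i≤j j<k (≋-sym e))) , (λ j≤i → go j≤i i<k e) ]′ (ℕₚ.≤-total i j)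
  where
  go : ∀ {i j} → j ≤ i → i < k → + i ≋ + j mod + k → i ≡ j
  go {i} {j} j≤i i<k e with i ∸ j in eq
  ... | zero  = ℕₚ.≤-antisym (ℕₚ.m∸n≡0⇒m≤n eq) j≤i
  ... | suc d = ⊥-elim (ℕₚ.<⇒≱ (ℕₚ.≤-<-trans (ℕₚ.≤-trans (ℕₚ.≤-reflexive (sym eq)) (ℕₚ.m∸n≤m i j)) i<k) (ℕ∣.∣⇒≤ k∣))
    where
    k∣ : k ∣ suc d
    k∣ = subst (k ∣_) eq (≋0⇒∣ (begin
      + (i ∸ j)               ≡⟨ lemma (+ (i ∸ j)) (+ j) ⟩
      + (i ∸ j ℕ.+ j) - + j   ≡⟨ cong (λ m → + m - + j) (ℕₚ.m∸n+n≡m j≤i) ⟩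
      + i - + j               ≈⟨ ≋⇒≋0 e ⟩
      0ℤ                      ∎))
      where
      open ≋-Reasoning (+ k)
      lemma : ∀ a j → a ≡ a + j - j
      lemma = solve-∀

-- A period contains exactly one member of the class of `a`. The predicate is kept abstract because
-- in use it is the divisibility of a linear expression in `c`.
∑-residue : ∀ k .{{_ : ℕ.NonZero k}} {P : ℕ → Set} (P? : ∀ c → Dec (P c)) a (g : ℕ → ℤ) →
  (∀ c → P c → + c ≋ a mod + k) → (∀ c → + c ≋ a mod + k → P c) →
  ∑ k (λ c → ⟦ P? c ⟧ * g c) ≡ g (a %ℕ k)
∑-residue k {P} P? a g to from = trans
  (∑-cong< k λ c c<k → cong (_* g c) (⟦⟧-⇔ (P? c) (c ℕ.≟ a %ℕ k)
    (λ pc → residue-unique c<k (n%ℕd<d a k) (≋-trans (to c pc) (≋-sym (residue a k))))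
    (λ e → from c (≋-trans (≋-pos-cong e) (residue a k)))))
  (∑-δ k (a %ℕ k) g (n%ℕd<d a k))

-- Odd moduli and signs.

Odd : ℕ → Set
Odd n = ∃[ m ] n ≡ suc (m ℕ.+ m)

odd-prime : ∀ {p} → Prime p → p ≢ 2 → Odd p
odd-prime {p} pp p≢2 with parity p
  where
  parity : ∀ n → ∃[ m ] (n ≡ m ℕ.+ m ⊎ n ≡ suc (m ℕ.+ m))
  parity zero    = 0 , inj₁ refl
  parity (suc n) with parity n
  ... | m , inj₁ e = m , inj₂ (cong suc e)
  ... | m , inj₂ e = suc m , inj₁ (trans (cong suc e) (cong suc (sym (ℕₚ.+-suc m m))))
... | m , inj₂ e = m , e
... | m , inj₁ e with prime⇒irreducible pp (divides {2} m (trans e (twice m)))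
  where
  twice : ∀ m → m ℕ.+ m ≡ m ℕ.* 2
  twice = ℕ-solve-∀
... | inj₁ ()
... | inj₂ 2≡p = ⊥-elim (p≢2 (sym 2≡p))

odd-* : ∀ {a b} → Odd a → Odd b → Odd (a ℕ.* b)
odd-* (m , refl) (l , refl) = m ℕ.+ l ℕ.+ (m ℕ.+ m) ℕ.* l , lemma m l
  where
  lemma : ∀ m l → suc (m ℕ.+ m) ℕ.* suc (l ℕ.+ l)
    ≡ suc (m ℕ.+ l ℕ.+ (m ℕ.+ m) ℕ.* l ℕ.+ (m ℕ.+ l ℕ.+ (m ℕ.+ m) ℕ.* l))
  lemma = ℕ-solve-∀

odd-^ : ∀ {a} e → Odd a → Odd (a ^ e)
odd-^ zero    o = 0 , refl
odd-^ (suc e) o = odd-* o (odd-^ e o)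

2-inverse : ∀ {n} → Odd n → ∃[ t ] t * + 2 ≋ 1ℤ mod + n
2-inverse (m , refl) = 1ℤ + + m , by 1ℤ (lemma (+ m))
  where
  lemma : ∀ m → (1ℤ + m) * + 2 ≡ 1ℤ + 1ℤ * (1ℤ + (m + m))
  lemma = solve-∀

2*≋0 : ∀ {n x} → Odd n → + 2 * x ≋ 0ℤ mod + n → x ≋ 0ℤ mod + n
2*≋0 o e = ≋-cancel (+ 2) (proj₁ (2-inverse o)) (proj₂ (2-inverse o)) e

∑-signℤ : ∀ n → Odd n → ∑ n signℤ ≡ 1ℤ
∑-signℤ n (m , refl) = go m
  where
  go : ∀ m → ∑ (suc (m ℕ.+ m)) signℤ ≡ 1ℤ
  go zero    = refl
  go (suc m) rewrite ℕₚ.+-suc m m = trans (lemma (∑ (suc (m ℕ.+ m)) signℤ) (signℤ (m ℕ.+ m))) (go m)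
    where
    lemma : ∀ a s → a + - s + - - s ≡ a
    lemma = solve-∀

signℤ-* : ∀ {n} i → Odd n → signℤ (i ℕ.* n) ≡ signℤ i
signℤ-* i (m , refl) = begin
  signℤ (i ℕ.* suc (m ℕ.+ m))           ≡⟨ cong signℤ (lemma i m) ⟩
  signℤ (i ℕ.+ (i ℕ.* m ℕ.+ i ℕ.* m))   ≡⟨ signℤ-+ i _ ⟩
  signℤ i * signℤ (i ℕ.* m ℕ.+ i ℕ.* m) ≡⟨ cong (signℤ i *_) (signℤ-double (i ℕ.* m)) ⟩
  signℤ i * 1ℤ                          ≡⟨ ℤₚ.*-identityʳ _ ⟩
  signℤ i                               ∎
  where
  open ≡-Reasoning
  lemma : ∀ i m → i ℕ.* suc (m ℕ.+ m) ≡ i ℕ.+ (i ℕ.* m ℕ.+ i ℕ.* m)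
  lemma = ℕ-solve-∀

-- Inverses modulo a power of p and their sums.

module PrimeInverse {p : ℕ} (pp : Prime p) (e : ℕ) where

  N : ℕ
  N = p ^ suc e

  -- The value 0 at multiples of `p` drops exactly the terms that the sums must skip. The inverse is
  -- some integer rather than a reduced residue, so periodicity holds only as a congruence.
  inv : ℕ → ℤ
  inv i with p ∣? i
  ... | yes _   = 0ℤ
  ... | no  p∤i = proj₁ (∤-inverse (suc e) pp p∤i)

  inv-∣ : ∀ {i} → p ∣ i → inv i ≡ 0ℤ
  inv-∣ {i} p∣i with p ∣? i
  ... | yes _   = refl
  ... | no  p∤i = ⊥-elim (p∤i p∣i)

  inv-∤ : ∀ {i} → ¬ p ∣ i → inv i * + i ≋ 1ℤ mod + N
  inv-∤ {i} p∤i with p ∣? i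
  ... | yes p∣i = ⊥-elim (p∤i p∣i)
  ... | no  p∤i = proj₂ (∤-inverse (suc e) pp p∤i)

  N≡p* : + N ≡ + p * + (p ^ e)
  N≡p* = ℤₚ.pos-* p (p ^ e)

  N≡*p : + N ≡ + (p ^ e) * + p
  N≡*p = trans N≡p* (ℤₚ.*-comm (+ p) _)

  ≋N⇒≋p : ∀ {a b} → a ≋ b mod + N → a ≋ b mod + p
  ≋N⇒≋p = ≋-modulus (+ (p ^ e)) N≡p*

  -- One rule covers oddness, doubling, multiples of q and periodicity. A unit preserves
  -- divisibility by `p`; away from it `s * inv y` is another inverse of `x`.
  inv-unit : ∀ {x y} s t → t * s ≋ 1ℤ mod + N → s * + x ≋ + y mod + N → inv x ≋ s * inv y mod + N
  inv-unit {x} {y} s t ts sx≋y with p ∣? y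
  ... | yes p∣y = ≡⇒≋ (trans (inv-∣ (proj₂ (∣-unit s t (≋N⇒≋p ts) (≋N⇒≋p sx≋y)) p∣y)) (sym (ℤₚ.*-zeroʳ s)))
  ... | no  p∤y = ≋-inverse-unique (+ x)
    (≋-trans (≡⇒≋ (ℤₚ.*-comm (+ x) (inv x))) (inv-∤ (λ p∣x → p∤y (proj₁ (∣-unit s t (≋N⇒≋p ts) (≋N⇒≋p sx≋y)) p∣x))))
    (begin
      + x * (s * v)  ≡⟨ lemma (+ x) s v ⟩
      v * (s * + x)  ≈⟨ ≋-*ˡ v sx≋y ⟩
      v * + y        ≈⟨ proj₂ (∤-inverse (suc e) pp p∤y) ⟩
      1ℤ             ∎)
    where
    open ≋-Reasoning (+ N)
    v = proj₁ (∤-inverse (suc e) pp p∤y)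
    lemma : ∀ x s v → x * (s * v) ≡ v * (s * x)
    lemma = solve-∀

  inv-periodic : ∀ {x y} → + x ≋ + y mod + N → inv x ≋ inv y mod + N
  inv-periodic {x} {y} x≋y = ≋-trans
    (inv-unit {x} {y} 1ℤ 1ℤ 1-unit (≋-trans (≡⇒≋ (ℤₚ.*-identityˡ (+ x))) x≋y))
    (≡⇒≋ (ℤₚ.*-identityˡ (inv y)))

  inv-*-indicator : ∀ i → + i * inv i ≋ 1ℤ - ⟦ p ∣? i ⟧ mod + N
  inv-*-indicator i with p ∣? i
  ... | yes _   = ≡⇒≋ (ℤₚ.*-zeroʳ (+ i))
  ... | no  p∤i = ≋-trans (≡⇒≋ (ℤₚ.*-comm (+ i) v)) (proj₂ (∤-inverse (suc e) pp p∤i))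
    where v = proj₁ (∤-inverse (suc e) pp p∤i)

  module _ (p-odd : Odd p) where

    instance
      p≢0 : ℕ.NonZero p
      p≢0 = prime⇒nonZero pp
      N≢0 : ℕ.NonZero N
      N≢0 = ℕₚ.m^n≢0 p (suc e)

    private
      P : ℕ
      P = p ^ e

    p∣N : p ∣ N
    p∣N = ℕ∣.m∣m*n P

    -- Pairing c with N - c negates each inverse, so twice the sum vanishes, and N is odd.
    ∑-inv≋0 : ∑ N inv ≋ 0ℤ mod + N
    ∑-inv≋0 = 2*≋0 (odd-^ (suc e) p-odd) (begin
      + 2 * ∑ N inv                       ≡⟨ two (∑ N inv) ⟩
      ∑ N inv + ∑ N inv                   ≡⟨ cong (λ s → ∑ N inv + s) (∑-reverse N inv (trans (inv-∣ p∣N) (sym (inv-∣ (p ℕ∣.∣0))))) ⟩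
      ∑ N inv + ∑ N (λ c → inv (N ∸ c))   ≈⟨ ≋-+ˡ (∑ N inv) (∑-≋< N λ c c<N → reversed c (ℕₚ.<⇒≤ c<N)) ⟩
      ∑ N inv + ∑ N (λ c → - inv c)       ≡⟨ cong (λ s → ∑ N inv + s) (∑-neg N inv) ⟩
      ∑ N inv + - ∑ N inv                 ≡⟨ ℤₚ.+-inverseʳ (∑ N inv) ⟩
      0ℤ                                  ∎)
      where
      open ≋-Reasoning (+ N)
      two : ∀ s → + 2 * s ≡ s + s
      two = solve-∀
      reversed : ∀ c → c ≤ N → inv (N ∸ c) ≋ - inv c mod + N
      reversed c c≤N = begin
        inv (N ∸ c)                ≡⟨ lemma (inv (N ∸ c)) ⟩
        - (- 1ℤ * inv (N ∸ c))     ≈⟨ ≋-neg (inv-unit {c} {N ∸ c} (- 1ℤ) (- 1ℤ) -1-unit (negate-∸ N c ℕ∣.∣-refl c≤N)) ⟨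
        - inv c                    ∎
        where
        lemma : ∀ a → a ≡ - (- 1ℤ * a)
        lemma = solve-∀

    ∑-id≋0 : ∑ P (λ d → + d) ≋ 0ℤ mod + P
    ∑-id≋0 = 2*≋0 (odd-^ e p-odd) (≋-trans (≡⇒≋ (gauss P)) (by (+ P - 1ℤ) (lemma (+ P))))
      where
      gauss : ∀ n → + 2 * ∑ n (λ d → + d) ≡ + n * (+ n - 1ℤ)
      gauss zero    = refl
      gauss (suc n) = begin
        + 2 * (∑ n (λ d → + d) + + n)        ≡⟨ ℤₚ.*-distribˡ-+ (+ 2) (∑ n (λ d → + d)) (+ n) ⟩
        + 2 * ∑ n (λ d → + d) + + 2 * + n    ≡⟨ cong (_+ + 2 * + n) (gauss n) ⟩
        + n * (+ n - 1ℤ) + + 2 * + n         ≡⟨ step (+ n) ⟩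
        (1ℤ + + n) * (1ℤ + + n - 1ℤ)         ∎
        where
        open ≡-Reasoning
        step : ∀ n → n * (n - 1ℤ) + + 2 * n ≡ (1ℤ + n) * (1ℤ + n - 1ℤ)
        step = solve-∀
      lemma : ∀ P → P * (P - 1ℤ) ≡ 0ℤ + (P - 1ℤ) * P
      lemma = solve-∀

    block-p : ∀ d c → + (d ℕ.* p ℕ.+ c) ≡ + d * + p + + c
    block-p d c = trans (ℤₚ.pos-+ (d ℕ.* p) c) (cong (_+ + c) (ℤₚ.pos-* d p))

    -- The members c = c₀ + d p of the class of - i add up to P c₀ + p (0 + ⋯ + (P - 1)), and p P = N.
    ∑-class : ∀ i → ∑ N (λ y → ⟦ p ∣? (i ℕ.+ y) ⟧ * + y) ≋ - (+ P * + i) mod + N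
    ∑-class i = begin
      ∑ N (λ y → ⟦ p ∣? (i ℕ.+ y) ⟧ * + y)
        ≡⟨ cong (λ n → ∑ n (λ y → ⟦ p ∣? (i ℕ.+ y) ⟧ * + y)) (ℕₚ.*-comm p P) ⟩
      ∑ (P ℕ.* p) (λ y → ⟦ p ∣? (i ℕ.+ y) ⟧ * + y)
        ≡⟨ ∑-block P p _ ⟩
      ∑ P (λ d → ∑ p (λ c → ⟦ p ∣? (i ℕ.+ (d ℕ.* p ℕ.+ c)) ⟧ * + (d ℕ.* p ℕ.+ c)))
        ≡⟨ ∑-cong P (λ d → ∑-residue p (λ c → p ∣? (i ℕ.+ (d ℕ.* p ℕ.+ c))) (- + i) (λ c → + (d ℕ.* p ℕ.+ c)) (to d) (from d)) ⟩
      ∑ P (λ d → + (d ℕ.* p ℕ.+ c₀))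
        ≡⟨ ∑-cong P (λ d → block-p d c₀) ⟩
      ∑ P (λ d → + d * + p + + c₀)
        ≡⟨ trans (∑-+ P (λ d → + d * + p) (λ _ → + c₀)) (cong₂ _+_ (∑-*ʳ P (+ p) (λ d → + d)) (∑-const P (+ c₀))) ⟩
      ∑ P (λ d → + d) * + p + + P * + c₀
        ≈⟨ ≋-+ p-part P-part ⟩
      0ℤ + + P * - + i
        ≡⟨ lemma (+ P) (+ i) ⟩
      - (+ P * + i) ∎
      where
      open ≋-Reasoning (+ N)
      c₀ = (- + i) %ℕ p
      lemma : ∀ P i → 0ℤ + P * - i ≡ - (P * i)
      lemma = solve-∀
      expand : ∀ d c → + (i ℕ.+ (d ℕ.* p ℕ.+ c)) ≡ + i + (+ d * + p + + c)
      expand d c = trans (ℤₚ.pos-+ i _) (cong (λ t → + i + t) (block-p d c))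
      c-minus : ∀ d c → + c - (- + i) ≋ + (i ℕ.+ (d ℕ.* p ℕ.+ c)) mod + p
      c-minus d c = by (- + d) (trans (lem (+ i) (+ d) (+ p) (+ c)) (cong (_+ - + d * + p) (sym (expand d c))))
        where
        lem : ∀ i d p c → c - (- i) ≡ i + (d * p + c) + - d * p
        lem = solve-∀
      to : ∀ d c → p ∣ i ℕ.+ (d ℕ.* p ℕ.+ c) → + c ≋ - + i mod + p
      to d c h = ≋0⇒≋ (≋-trans (c-minus d c) (∣⇒≋0 h))
      from : ∀ d c → + c ≋ - + i mod + p → p ∣ i ℕ.+ (d ℕ.* p ℕ.+ c)
      from d c h = ≋0⇒∣ (≋-trans (≋-sym (c-minus d c)) (≋⇒≋0 h))
      p-part : ∑ P (λ d → + d) * + p ≋ 0ℤ mod + N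
      p-part with ∑-id≋0
      ... | by c e = by c (trans (cong (_* + p) e) (trans (assoc c (+ P) (+ p)) (cong (λ t → 0ℤ + c * t) (sym N≡*p))))
        where
        assoc : ∀ c P p → (0ℤ + c * P) * p ≡ 0ℤ + c * (P * p)
        assoc = solve-∀
      P-part : + P * + c₀ ≋ + P * - + i mod + N
      P-part = subst (λ M → + P * + c₀ ≋ + P * - + i mod M) (sym N≡*p) (≋-scale (+ P) (residue (- + i) p))

    -- The involution c ↦ i² / c of the residue class of - i turns the sum of the inverses into the sum of ∑-class.
    ∑-inv-class : ∀ i → ¬ p ∣ i → ∑ N (λ c → ⟦ p ∣? (i ℕ.+ c) ⟧ * inv c) ≋ - (+ P * inv i) mod + N
    ∑-inv-class i p∤i = begin
      ∑ N (λ c → δ c * inv c)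
        ≈⟨ ∑-≋ N (λ c → scale c) ⟩
      ∑ N (λ c → v * v * (δ c * + σ c))
        ≡⟨ ∑-*ˡ N (v * v) _ ⟩
      v * v * ∑ N (λ c → δ c * + σ c)
        -- Each term is spread over all y by the indicator of y = σ c. Once the sums are swapped,
        -- `exchange` reads the same pairs from the side of y; this replaces an appeal to
        -- bijections.
        ≡⟨ cong (v * v *_) (∑-cong N λ c → trans (cong (δ c *_) (sym (∑-δ N (σ c) (λ y → + y) (σ<N c)))) (sym (∑-*ˡ N (δ c) _))) ⟩
      v * v * ∑ N (λ c → ∑ N (λ y → δ c * (⟦ y ℕ.≟ σ c ⟧ * + y)))
        ≡⟨ cong (v * v *_) (trans (∑-swap N N _) (∑-cong< N λ y y<N → ∑-cong< N λ c c<N → exchange y<N c<N)) ⟩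
      v * v * ∑ N (λ y → ∑ N (λ c → ⟦ c ℕ.≟ σ y ⟧ * (δ y * + y)))
        ≡⟨ cong (v * v *_) (∑-cong N λ y → ∑-δ N (σ y) (λ _ → δ y * + y) (σ<N y)) ⟩
      v * v * ∑ N (λ y → δ y * + y)
        ≈⟨ ≋-*ˡ (v * v) (∑-class i) ⟩
      v * v * - (+ P * + i)
        ≡⟨ rearrange₁ v (+ P) (+ i) ⟩
      - (+ P * v) * (v * + i)
        ≈⟨ ≋-*ˡ (- (+ P * v)) vi≋1 ⟩
      - (+ P * v) * 1ℤ
        ≡⟨ ℤₚ.*-identityʳ _ ⟩
      - (+ P * v) ∎
      where
      v = inv i
      vi≋1 : v * + i ≋ 1ℤ mod + N
      vi≋1 = inv-∤ p∤i
      δ : ℕ → ℤ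
      δ c = ⟦ p ∣? (i ℕ.+ c) ⟧
      σ : ℕ → ℕ
      σ c = (+ i * + i * inv c) %ℕ N
      σ<N : ∀ c → σ c < N
      σ<N c = n%ℕd<d (+ i * + i * inv c) N
      rearrange₁ : ∀ v P i → v * v * - (P * i) ≡ - (P * v) * (v * i)
      rearrange₁ = solve-∀
      scale : ∀ c → δ c * inv c ≋ v * v * (δ c * + σ c) mod + N
      scale c = begin
        δ c * inv c                                   ≡⟨ ring₁ (δ c) (inv c) ⟩
        δ c * inv c * (1ℤ * 1ℤ)                       ≈⟨ ≋-*ˡ (δ c * inv c) (≋-* vi≋1 vi≋1) ⟨
        δ c * inv c * (v * + i * (v * + i))           ≡⟨ ring₂ (δ c) (inv c) v (+ i) ⟩
        v * v * (δ c * (+ i * + i * inv c))           ≈⟨ ≋-*ˡ (v * v) (≋-*ˡ (δ c) (residue (+ i * + i * inv c) N)) ⟨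
        v * v * (δ c * + σ c)                         ∎
        where
        open ≋-Reasoning (+ N)
        ring₁ : ∀ d c → d * c ≡ d * c * (1ℤ * 1ℤ)
        ring₁ = solve-∀
        ring₂ : ∀ d c v i → d * c * (v * i * (v * i)) ≡ v * v * (d * (i * i * c))
        ring₂ = solve-∀
      -- The relation y c ≡ i² modulo N is symmetric in c and y, and c ≡ - i modulo p gives y ≡ i² /
      -- (- i) = - i, so the class is preserved.
      partner : ∀ {c y} → y < N → c < N → p ∣ i ℕ.+ c → y ≡ σ c → (c ≡ σ y) × (p ∣ i ℕ.+ y)
      partner {c} {y} y<N c<N p∣i+c y≡σc = residue-unique c<N (σ<N y) c≋σy , p∣i+y
        where
        c≋-i : + c ≋ - + i mod + p
        c≋-i = ≋0⇒≋ (≋-trans (≡⇒≋ (trans (ring (+ i) (+ c)) (sym (ℤₚ.pos-+ i c)))) (∣⇒≋0 p∣i+c))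
          where
          ring : ∀ i c → c - (- i) ≡ i + c
          ring = solve-∀
        p∤c : ¬ p ∣ c
        p∤c p∣c = p∤i (proj₂ (∣-unit {p} {i} {c} (- 1ℤ) (- 1ℤ) -1-unit (≋-trans (≡⇒≋ (ℤₚ.-1*i≡-i (+ i))) (≋-sym c≋-i))) p∣c)
        y*c : + y * + c ≋ + i * + i mod + N
        y*c = begin
          + y * + c                       ≈⟨ ≋-*ʳ (+ c) (≋-trans (≋-pos-cong y≡σc) (residue (+ i * + i * inv c) N)) ⟩
          + i * + i * inv c * + c         ≡⟨ ℤₚ.*-assoc (+ i * + i) (inv c) (+ c) ⟩
          + i * + i * (inv c * + c)       ≈⟨ ≋-*ˡ (+ i * + i) (inv-∤ p∤c) ⟩
          + i * + i * 1ℤ                  ≡⟨ ℤₚ.*-identityʳ _ ⟩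
          + i * + i                       ∎
          where open ≋-Reasoning (+ N)
        p∣i+y : p ∣ i ℕ.+ y
        p∣i+y = ≋0⇒∣ (≋-cancel (+ i) v (≋N⇒≋p vi≋1) (begin
          + i * + (i ℕ.+ y)                 ≡⟨ trans (cong (+ i *_) (ℤₚ.pos-+ i y)) (ring (+ i) (+ y)) ⟩
          + i * + i - + y * - + i           ≈⟨ ≋-+ˡ (+ i * + i) (≋-neg (≋-*ˡ (+ y) c≋-i)) ⟨
          + i * + i - + y * + c             ≈⟨ ≋-+ˡ (+ i * + i) (≋-neg (≋N⇒≋p y*c)) ⟩
          + i * + i - + i * + i             ≡⟨ ring′ (+ i) ⟩
          + i * 0ℤ                          ∎))
          where
          open ≋-Reasoning (+ p)
          ring : ∀ i y → i * (i + y) ≡ i * i - y * - i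
          ring = solve-∀
          ring′ : ∀ i → i * i - i * i ≡ i * 0ℤ
          ring′ = solve-∀
        p∤y : ¬ p ∣ y
        p∤y p∣y = p∤i (ℕ∣.∣m+n∣m⇒∣n (subst (p ∣_) (ℕₚ.+-comm i y) p∣i+y) p∣y)
        c≋σy : + c ≋ + σ y mod + N
        c≋σy = begin
          + c                         ≡⟨ ℤₚ.*-identityˡ (+ c) ⟨
          1ℤ * + c                    ≈⟨ ≋-*ʳ (+ c) (inv-∤ p∤y) ⟨
          inv y * + y * + c           ≡⟨ ℤₚ.*-assoc (inv y) (+ y) (+ c) ⟩
          inv y * (+ y * + c)         ≈⟨ ≋-*ˡ (inv y) y*c ⟩
          inv y * (+ i * + i)         ≡⟨ ℤₚ.*-comm (inv y) _ ⟩
          + i * + i * inv y           ≈⟨ residue (+ i * + i * inv y) N ⟨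
          + σ y                       ∎
          where open ≋-Reasoning (+ N)
      exchange : ∀ {y c} → y < N → c < N → δ c * (⟦ y ℕ.≟ σ c ⟧ * + y) ≡ ⟦ c ℕ.≟ σ y ⟧ * (δ y * + y)
      exchange {y} {c} y<N c<N = begin
        δ c * (⟦ y ℕ.≟ σ c ⟧ * + y)
          ≡⟨ ℤₚ.*-assoc (δ c) ⟦ y ℕ.≟ σ c ⟧ (+ y) ⟨
        δ c * ⟦ y ℕ.≟ σ c ⟧ * + y
          ≡⟨ cong (_* + y) both ⟩
        ⟦ c ℕ.≟ σ y ⟧ * δ y * + y
          ≡⟨ ℤₚ.*-assoc ⟦ c ℕ.≟ σ y ⟧ (δ y) (+ y) ⟩
        ⟦ c ℕ.≟ σ y ⟧ * (δ y * + y) ∎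
        where
        open ≡-Reasoning
        both : δ c * ⟦ y ℕ.≟ σ c ⟧ ≡ ⟦ c ℕ.≟ σ y ⟧ * δ y
        both = trans (trans (⟦⟧-× (p ∣? (i ℕ.+ c)) (y ℕ.≟ σ c))
          (⟦⟧-⇔ ((p ∣? (i ℕ.+ c)) ×-dec (y ℕ.≟ σ c)) ((c ℕ.≟ σ y) ×-dec (p ∣? (i ℕ.+ y)))
            (λ (a , b) → partner y<N c<N a b)
            (λ (a , b) → let (c≡ , d) = partner c<N y<N b a in d , c≡)))
          (sym (⟦⟧-× (c ℕ.≟ σ y) (p ∣? (i ℕ.+ y))))
      open ≋-Reasoning (+ N)

-- Bernoulli numbers modulo p.

nC0≡1 : ∀ n → n C 0 ≡ 1
nC0≡1 n = trans (nCk≡nC[n∸k] {0} {n} z≤n) (nCn≡1 n)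

[n+1]Cn≡n+1 : ∀ n → suc n C n ≡ suc n
[n+1]Cn≡n+1 n = trans (nCk≡nC[n∸k] (ℕₚ.n≤1+n n)) (trans (cong (suc n C_) (ℕₚ.m+n∸n≡m 1 n)) (nC1≡n (suc n)))

absorption : ∀ n k → suc k ℕ.* (suc n C suc k) ≡ suc n ℕ.* (n C k)
absorption zero    zero    = refl
absorption zero    (suc k) = trans (cong (suc (suc k) ℕ.*_) (k>n⇒nCk≡0 (s≤s (s≤s (z≤n {k})))))
  (trans (ℕₚ.*-zeroʳ (suc (suc k))) (sym (cong (1 ℕ.*_) (k>n⇒nCk≡0 (s≤s (z≤n {k}))))))
absorption (suc n) zero    = trans (cong (1 ℕ.*_) (nC1≡n (suc (suc n)))) (trans (ℕₚ.*-comm 1 (suc (suc n)))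
  (cong (suc (suc n) ℕ.*_) (sym (nC0≡1 (suc n)))))
absorption (suc n) (suc k) = begin
  suc (suc k) ℕ.* (suc (suc n) C suc (suc k))
    ≡⟨ cong (suc (suc k) ℕ.*_) (nCk+nC[k+1]≡[n+1]C[k+1] (suc n) (suc k)) ⟨
  suc (suc k) ℕ.* (a ℕ.+ b)
    ≡⟨ expand k a b ⟩
  a ℕ.+ suc k ℕ.* a ℕ.+ suc (suc k) ℕ.* b
    ≡⟨ cong₂ (λ x y → a ℕ.+ x ℕ.+ y) (absorption n k) (absorption n (suc k)) ⟩
  a ℕ.+ suc n ℕ.* (n C k) ℕ.+ suc n ℕ.* (n C suc k)
    ≡⟨ collect n a (n C k) (n C suc k) ⟩
  a ℕ.+ suc n ℕ.* (n C k ℕ.+ n C suc k)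
    ≡⟨ cong (λ c → a ℕ.+ suc n ℕ.* c) (nCk+nC[k+1]≡[n+1]C[k+1] n k) ⟩
  suc (suc n) ℕ.* a ∎
  where
  open ≡-Reasoning
  a = suc n C suc k
  b = suc n C suc (suc k)
  expand : ∀ k a b → suc (suc k) ℕ.* (a ℕ.+ b) ≡ a ℕ.+ suc k ℕ.* a ℕ.+ suc (suc k) ℕ.* b
  expand = ℕ-solve-∀
  collect : ∀ n a x y → a ℕ.+ suc n ℕ.* x ℕ.+ suc n ℕ.* y ≡ a ℕ.+ suc n ℕ.* (x ℕ.+ y)
  collect = ℕ-solve-∀

binomial-theorem : ∀ n x → (1ℤ + x) ℤ.^ n ≡ ∑ (suc n) (λ i → + (n C i) * x ℤ.^ i)
binomial-theorem zero    x = refl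
binomial-theorem (suc n) x = sym (begin
  ∑ (suc (suc n)) (λ i → + (suc n C i) * x ℤ.^ i)
    ≡⟨ ∑-head (suc n) _ ⟩
  + (suc n C 0) * 1ℤ + ∑ (suc n) (λ i → + (suc n C suc i) * (x * x ℤ.^ i))
    ≡⟨ cong₂ _+_ (cong (λ c → + c * 1ℤ) (trans (nC0≡1 (suc n)) (sym (nC0≡1 n)))) (∑-cong (suc n) λ i → pascal i) ⟩
  + (n C 0) * 1ℤ + ∑ (suc n) (λ i → x * (+ (n C i) * x ℤ.^ i) + + (n C suc i) * (x * x ℤ.^ i))
    ≡⟨ cong (λ s → + (n C 0) * 1ℤ + s) (trans (∑-+ (suc n) _ _) (cong (_+ T) (∑-*ˡ (suc n) x _))) ⟩
  + (n C 0) * 1ℤ + (x * S + T)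
    ≡⟨ rearrange (+ (n C 0) * 1ℤ) (x * S) T ⟩
  x * S + (+ (n C 0) * 1ℤ + T)
    ≡⟨ cong (λ s → x * S + s) (trans (sym (∑-head (suc n) (λ i → + (n C i) * x ℤ.^ i))) top) ⟩
  x * S + S
    ≡⟨ factor x S ⟩
  (1ℤ + x) * S
    ≡⟨ cong ((1ℤ + x) *_) (binomial-theorem n x) ⟨
  (1ℤ + x) * (1ℤ + x) ℤ.^ n ∎)
  where
  open ≡-Reasoning
  S = ∑ (suc n) (λ i → + (n C i) * x ℤ.^ i)
  T = ∑ (suc n) (λ i → + (n C suc i) * (x * x ℤ.^ i))
  ring : ∀ a b x y → (a + b) * (x * y) ≡ x * (a * y) + b * (x * y)
  ring = solve-∀
  pascal : ∀ i → + (suc n C suc i) * (x * x ℤ.^ i) ≡ x * (+ (n C i) * x ℤ.^ i) + + (n C suc i) * (x * x ℤ.^ i)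
  pascal i = trans
    (cong (_* (x * x ℤ.^ i)) (trans (cong +_ (sym (nCk+nC[k+1]≡[n+1]C[k+1] n i))) (ℤₚ.pos-+ (n C i) (n C suc i))))
    (ring (+ (n C i)) (+ (n C suc i)) x (x ℤ.^ i))
  rearrange : ∀ a b c → a + (b + c) ≡ b + (a + c)
  rearrange = solve-∀
  factor : ∀ x s → x * s + s ≡ (1ℤ + x) * s
  factor = solve-∀
  top : S + + (n C suc n) * x ℤ.^ suc n ≡ S
  top = trans (cong (λ c → S + + c * x ℤ.^ suc n) (k>n⇒nCk≡0 (ℕₚ.n<1+n n))) (ℤₚ.+-identityʳ S)

∑-telescope : ∀ n (g : ℕ → ℤ) → ∑ n (λ i → g (suc i) - g i) ≡ g n - g 0
∑-telescope zero    g = sym (ℤₚ.+-inverseʳ (g 0))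
∑-telescope (suc n) g = trans (cong (_+ (g (suc n) - g n)) (∑-telescope n g)) (lemma (g n) (g 0) (g (suc n)))
  where
  lemma : ∀ a b c → a - b + (c - a) ≡ c - b
  lemma = solve-∀

≋-^ : ∀ {a b M} k → a ≋ b mod M → a ℤ.^ k ≋ b ℤ.^ k mod M
≋-^ zero    e = ≋-refl
≋-^ (suc k) e = ≋-* e (≋-^ k e)

-- The power sums satisfy the recursion of the Bernoulli numbers up to p ^ (n + 1).
∑-power-recursion : ∀ p n → ∑ (suc n) (λ i → + (suc n C i) * ∑ p (λ x → (+ x) ℤ.^ i)) ≡ (+ p) ℤ.^ suc n
∑-power-recursion p n = begin
  ∑ (suc n) (λ i → + (suc n C i) * ∑ p (λ x → (+ x) ℤ.^ i))
    ≡⟨ trans (∑-cong (suc n) λ i → sym (∑-*ˡ p (+ (suc n C i)) _)) (∑-swap (suc n) p _) ⟩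
  ∑ p (λ x → ∑ (suc n) (λ i → + (suc n C i) * (+ x) ℤ.^ i))
    ≡⟨ ∑-cong p difference ⟩
  ∑ p (λ x → (+ suc x) ℤ.^ suc n - (+ x) ℤ.^ suc n)
    ≡⟨ ∑-telescope p (λ x → (+ x) ℤ.^ suc n) ⟩
  (+ p) ℤ.^ suc n - (+ 0) ℤ.^ suc n
    ≡⟨ ℤₚ.+-identityʳ _ ⟩
  (+ p) ℤ.^ suc n ∎
  where
  open ≡-Reasoning
  difference : ∀ x → ∑ (suc n) (λ i → + (suc n C i) * (+ x) ℤ.^ i) ≡ (+ suc x) ℤ.^ suc n - (+ x) ℤ.^ suc n
  difference x = begin
    S                                                       ≡⟨ lemma S ((+ x) ℤ.^ suc n) ⟩
    S + 1ℤ * (+ x) ℤ.^ suc n - (+ x) ℤ.^ suc n                  ≡⟨ cong (λ c → S + + c * (+ x) ℤ.^ suc n - (+ x) ℤ.^ suc n) (nCn≡1 (suc n)) ⟨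
    S + + (suc n C suc n) * (+ x) ℤ.^ suc n - (+ x) ℤ.^ suc n   ≡⟨ cong (_- (+ x) ℤ.^ suc n) (binomial-theorem (suc n) (+ x)) ⟨
    (+ suc x) ℤ.^ suc n - (+ x) ℤ.^ suc n                       ∎
    where
    S = ∑ (suc n) (λ i → + (suc n C i) * (+ x) ℤ.^ i)
    lemma : ∀ s x → s ≡ s + 1ℤ * x - x
    lemma = solve-∀

-- By `absorption`, p divides k times the binomial coefficient, and it cannot divide k.
∣-binomial : ∀ {p} → Prime p → ∀ k → 0 < k → k < p → p ∣ p C k
∣-binomial {suc p} pp (suc k) 0<k k<p with euclidsLemma (suc k) (suc p C suc k) pp
  (subst (suc p ∣_) (sym (absorption p k)) (ℕ∣.m∣m*n (p C k)))
... | inj₁ p∣k = ⊥-elim (ℕₚ.<⇒≱ k<p (ℕ∣.∣⇒≤ p∣k))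
... | inj₂ p∣C = p∣C

fermat : ∀ {p} → Prime p → ∀ x → (+ x) ℤ.^ p ≋ + x mod + p
fermat {zero}  pp = ⊥-elim (ℕₚ.<⇒≱ (ℕ.nonTrivial⇒n>1 0 {{prime⇒nonTrivial pp}}) z≤n)
fermat {suc p} pp zero = ≋-refl
fermat {suc p} pp (suc x) = begin
  (+ suc x) ℤ.^ suc p
    ≡⟨ binomial-theorem (suc p) (+ x) ⟩
  ∑ (suc p) g + + (suc p C suc p) * (+ x) ℤ.^ suc p
    ≡⟨ cong₂ _+_ (∑-head p g) (trans (cong (λ c → + c * (+ x) ℤ.^ suc p) (nCn≡1 (suc p))) (ℤₚ.*-identityˡ _)) ⟩
  + (suc p C 0) * 1ℤ + ∑ p (g ∘ suc) + (+ x) ℤ.^ suc p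
    ≈⟨ ≋-+ (≋-+ (≡⇒≋ (cong (λ c → + c * 1ℤ) (nC0≡1 (suc p)))) (∑-≋< p λ i i<p → ≋-trans
         (≋-*ʳ ((+ x) ℤ.^ suc i) (∣⇒≋0 {a = + (suc p C suc i)} (∣-binomial pp (suc i) (s≤s z≤n) (s≤s i<p)))) (≡⇒≋ refl))) (fermat pp x) ⟩
  1ℤ + ∑ p (λ _ → 0ℤ) + + x
    ≡⟨ cong (λ s → 1ℤ + s + + x) (∑-0 p) ⟩
  + suc x ∎
  where
  open ≋-Reasoning (+ suc p)
  g : ℕ → ℤ
  g i = + (suc p C i) * (+ x) ℤ.^ i

fermat′ : ∀ {p} → Prime (suc p) → ∀ x → ¬ suc p ∣ x → (+ x) ℤ.^ p ≋ 1ℤ mod + suc p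
fermat′ {p} pp x p∤x = ≋-cancel (+ x) (proj₁ v) (subst (λ k → proj₁ v * + x ≋ 1ℤ mod + k) (ℕₚ.*-identityʳ (suc p)) (proj₂ v))
  (≋-trans (fermat pp x) (≡⇒≋ (sym (ℤₚ.*-identityʳ (+ x)))))
  where
  v = ∤-inverse 1 pp p∤x

*-^ : ∀ x y k → (x * y) ℤ.^ k ≡ x ℤ.^ k * y ℤ.^ k
*-^ x y zero    = refl
*-^ x y (suc k) = trans (cong (x * y *_) (*-^ x y k)) (lemma x y (x ℤ.^ k) (y ℤ.^ k))
  where
  lemma : ∀ x y a b → x * y * (a * b) ≡ x * a * (y * b)
  lemma = solve-∀

-- The linear part of the binomial expansion; every further term contains P².
power-shift : ∀ x P y j → (x + P * y) ℤ.^ suc j ≋ x ℤ.^ suc j + + suc j * (P * y * x ℤ.^ j) mod (P * P)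
power-shift x P y zero    = ≡⇒≋ (lemma x P y)
  where
  lemma : ∀ x P y → (x + P * y) * 1ℤ ≡ x * 1ℤ + 1ℤ * (P * y * 1ℤ)
  lemma = solve-∀
power-shift x P y (suc j) = begin
  (x + P * y) * (x + P * y) ℤ.^ suc j
    ≈⟨ ≋-*ˡ (x + P * y) (power-shift x P y j) ⟩
  (x + P * y) * (x * X + + suc j * (P * y * X))
    ≈⟨ by (+ suc j * (y * y * X)) (lemma x P y X (+ suc j)) ⟩
  x * (x * X) + (1ℤ + + suc j) * (P * y * (x * X)) ∎
  where
  open ≋-Reasoning (P * P)
  X = x ℤ.^ j
  lemma : ∀ x P y X c → (x + P * y) * (x * X + c * (P * y * X))
    ≡ x * (x * X) + (1ℤ + c) * (P * y * (x * X)) + c * (y * y * X) * (P * P)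
  lemma = solve-∀

module BernoulliMod {p : ℕ} (pp : Prime p) (b : ℕ → ℤ) (b₀ : b 0 ≋ 1ℤ mod + p)
  (b-recursion : ∀ n → 0 < n → suc n < p → ∑ (suc n) (λ i → + (suc n C i) * b i) ≋ 0ℤ mod + p) where

  powerSum : ℕ → ℤ
  powerSum k = ∑ p (λ x → (+ x) ℤ.^ k)

  -- The differences D satisfy the Bernoulli recursion modulo p²: the power p ^ n left by the power
  -- sums has n ≥ 2, and p times the recursion of `b` holds modulo p². The leading coefficient n = k
  -- + 1 is less than p, hence invertible, so D vanishes by strong induction.
  powerSum≋ : ∀ k → suc k < p → powerSum k ≋ + p * b k mod (+ p * + p)
  powerSum≋ = ℕ-Ind.<-rec _ step
    where
    D : ℕ → ℤ
    D k = powerSum k - + p * b k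
    step : ∀ k → (∀ {i} → i < k → suc i < p → powerSum i ≋ + p * b i mod (+ p * + p)) →
      suc k < p → powerSum k ≋ + p * b k mod (+ p * + p)
    -- The index x = 0 contributes 0 ^ 0 = 1, so the sum is exactly p.
    step zero    _  _ = ≋-trans (≡⇒≋ (∑-const p 1ℤ)) (≋-scale (+ p) (≋-sym b₀))
    step (suc k) ih 1+k<p = ≋0⇒≋ (≋-cancel (+ suc (suc k)) (proj₁ v) inverse (begin
      + n * D (suc k)
        ≡⟨ cong (λ c → + c * D (suc k)) ([n+1]Cn≡n+1 (suc k)) ⟨
      + (n C suc k) * D (suc k)
        ≡⟨ ℤₚ.+-identityˡ _ ⟨
      0ℤ + + (n C suc k) * D (suc k)
        ≈⟨ ≋-+ʳ (+ (n C suc k) * D (suc k)) lower ⟨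
      ∑ (suc (suc k)) (λ i → + (n C i) * D i)
        ≡⟨ trans (∑-cong (suc (suc k)) λ i → ring (+ (n C i)) (powerSum i) (+ p) (b i)) (trans (∑-- (suc (suc k)) _ _)
             (cong₂ _-_ (∑-power-recursion p (suc k)) (∑-*ˡ (suc (suc k)) (+ p) _))) ⟩
      (+ p) ℤ.^ n - + p * ∑ (suc (suc k)) (λ i → + (n C i) * b i)
        ≈⟨ ≋-+ {b = 0ℤ} (by ((+ p) ℤ.^ k) (pow (+ p) ((+ p) ℤ.^ k))) (≋-neg (≋-scale (+ p) (b-recursion (suc k) (s≤s z≤n) 1+k<p))) ⟩
      0ℤ - + p * 0ℤ
        ≡⟨ zeros (+ p) (+ n) ⟩
      + n * 0ℤ ∎))
      where
      open ≋-Reasoning (+ p * + p)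
      n = suc (suc k)
      p∤n : ¬ p ∣ n
      p∤n p∣n = ℕₚ.<⇒≱ 1+k<p (ℕ∣.∣⇒≤ p∣n)
      v = ∤-inverse 2 pp p∤n
      inverse : proj₁ v * + n ≋ 1ℤ mod (+ p * + p)
      inverse = subst (λ M → proj₁ v * + n ≋ 1ℤ mod M) (trans (cong +_ (square p)) (ℤₚ.pos-* p p)) (proj₂ v)
        where
        square : ∀ p → p ℕ.* (p ℕ.* 1) ≡ p ℕ.* p
        square = ℕ-solve-∀
      lower : ∑ (suc k) (λ i → + (n C i) * D i) ≋ 0ℤ mod (+ p * + p)
      lower = ≋-trans (∑-≋< (suc k) λ i i<1+k → ≋-trans
        (≋-*ˡ (+ (n C i)) (≋⇒≋0 (ih i<1+k (ℕₚ.<-trans (s≤s i<1+k) 1+k<p))))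
        (≡⇒≋ (ℤₚ.*-zeroʳ (+ (n C i))))) (≡⇒≋ (∑-0 (suc k)))
      ring : ∀ c s p b → c * (s - p * b) ≡ c * s - p * (c * b)
      ring = solve-∀
      pow : ∀ p x → p * (p * x) ≡ 0ℤ + x * (p * p)
      pow = solve-∀
      zeros : ∀ p n → 0ℤ - p * 0ℤ ≡ n * 0ℤ
      zeros = solve-∀

  -- The representatives of 2 x mod p are 2 x and 2 x - p, the latter for x > p / 2. Modulo p², summing their powers
  -- instead of those of x brings in Σ x ^ j over x > p / 2, which is also what the alternating sum reduces to.
  module _ (p-odd : Odd p) where

    private
      m = proj₁ p-odd
      β : ℕ → ℤ
      β a = + big m a

    alternatingPowerSum : ℕ → ℤ
    alternatingPowerSum j = ∑ p (λ x → signℤ x * (+ x) ℤ.^ j)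

    private
      Q : ℕ → ℤ
      Q j = ∑ p (λ a → β a * (+ a) ℤ.^ j)

      ∑-double-p : ∀ g → ∑ p g ≡ ∑ p (g ∘ double m)
      ∑-double-p g = subst (λ n → ∑ n g ≡ ∑ n (g ∘ double m)) (sym (proj₂ p-odd)) (∑-double m g)

      double≡ : ∀ a → + double m a ≡ + 2 * + a + + p * - β a
      double≡ a = begin
        + double m a                                      ≡⟨ lemma (+ double m a) (+ p) (β a) ⟩
        + double m a + + p * β a + + p * - β a            ≡⟨ cong (λ t → + double m a + t + + p * - β a) (ℤₚ.pos-* p (big m a)) ⟨
        + double m a + + (p ℕ.* big m a) + + p * - β a    ≡⟨ cong (_+ + p * - β a) (ℤₚ.pos-+ (double m a) (p ℕ.* big m a)) ⟨
        + (double m a ℕ.+ p ℕ.* big m a) + + p * - β a    ≡⟨ cong (λ t → + t + + p * - β a) (trans (cong (λ n → double m a ℕ.+ n ℕ.* big m a) (proj₂ p-odd)) (double-big m a)) ⟩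
        + (a ℕ.+ a) + + p * - β a                         ≡⟨ cong (_+ + p * - β a) (trans (ℤₚ.pos-+ a a) (two (+ a))) ⟩
        + 2 * + a + + p * - β a                           ∎
        where
        open ≡-Reasoning
        lemma : ∀ d p b → d ≡ d + p * b + p * - b
        lemma = solve-∀
        two : ∀ a → a + a ≡ + 2 * a
        two = solve-∀

      powerSum-double : ∀ j → powerSum (suc j) ≋
        (+ 2) ℤ.^ suc j * powerSum (suc j) + - (+ suc j * (+ p * (+ 2) ℤ.^ j * Q j)) mod (+ p * + p)
      powerSum-double j = begin
        powerSum (suc j)
          ≡⟨ ∑-double-p _ ⟩
        ∑ p (λ a → (+ double m a) ℤ.^ suc j)
          ≈⟨ ∑-≋ p (λ a → ≋-trans (≡⇒≋ (cong (ℤ._^ suc j) (double≡ a))) (≋-trans (power-shift (+ 2 * + a) (+ p) (- β a) j)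
               (≡⇒≋ (trans (cong₂ (λ x y → x + + suc j * (+ p * - β a * y)) (*-^ (+ 2) (+ a) (suc j)) (*-^ (+ 2) (+ a) j))
                 (ring ((+ 2) ℤ.^ suc j) ((+ a) ℤ.^ suc j) (+ suc j) (+ p) (β a) ((+ 2) ℤ.^ j) ((+ a) ℤ.^ j)))))) ⟩
        ∑ p (λ a → (+ 2) ℤ.^ suc j * (+ a) ℤ.^ suc j + - (+ suc j * (+ p * (+ 2) ℤ.^ j)) * (β a * (+ a) ℤ.^ j))
          ≡⟨ trans (∑-+ p _ _) (cong₂ _+_ (∑-*ˡ p ((+ 2) ℤ.^ suc j) _) (∑-*ˡ p (- (+ suc j * (+ p * (+ 2) ℤ.^ j))) _)) ⟩
        (+ 2) ℤ.^ suc j * powerSum (suc j) + - (+ suc j * (+ p * (+ 2) ℤ.^ j)) * Q j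
          ≡⟨ cong (λ t → (+ 2) ℤ.^ suc j * powerSum (suc j) + t) (ring′ (+ suc j) (+ p * (+ 2) ℤ.^ j) (Q j)) ⟩
        (+ 2) ℤ.^ suc j * powerSum (suc j) + - (+ suc j * (+ p * (+ 2) ℤ.^ j * Q j)) ∎
        where
        open ≋-Reasoning (+ p * + p)
        ring : ∀ A x c p b B y → A * x + c * (p * - b * (B * y)) ≡ A * x + - (c * (p * B)) * (b * y)
        ring = solve-∀
        ring′ : ∀ c x q → - (c * x) * q ≡ - (c * (x * q))
        ring′ = solve-∀

      alternating-double : ∀ j → alternatingPowerSum j ≋ (+ 2) ℤ.^ j * (powerSum j - + 2 * Q j) mod + p
      alternating-double j = begin
        alternatingPowerSum j
          ≡⟨ ∑-double-p _ ⟩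
        ∑ p (λ a → signℤ (double m a) * (+ double m a) ℤ.^ j)
          ≈⟨ ∑-≋ p (λ a → ≋-* (≡⇒≋ (signℤ-double-big m a)) (≋-trans (≋-^ j (double≋ a)) (≡⇒≋ (*-^ (+ 2) (+ a) j)))) ⟩
        ∑ p (λ a → (1ℤ - + 2 * β a) * ((+ 2) ℤ.^ j * (+ a) ℤ.^ j))
          ≡⟨ ∑-cong p (λ a → ring (β a) ((+ 2) ℤ.^ j) ((+ a) ℤ.^ j)) ⟩
        ∑ p (λ a → (+ 2) ℤ.^ j * ((+ a) ℤ.^ j - + 2 * (β a * (+ a) ℤ.^ j)))
          ≡⟨ trans (∑-*ˡ p ((+ 2) ℤ.^ j) _) (cong ((+ 2) ℤ.^ j *_) (trans (∑-- p _ _) (cong (λ t → powerSum j - t) (∑-*ˡ p (+ 2) _)))) ⟩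
        (+ 2) ℤ.^ j * (powerSum j - + 2 * Q j) ∎
        where
        open ≋-Reasoning (+ p)
        double≋ : ∀ a → + double m a ≋ + 2 * + a mod + p
        double≋ a = by (- β a) (trans (double≡ a) (cong (λ t → + 2 * + a + t) (ℤₚ.*-comm (+ p) (- β a))))
        ring : ∀ b A x → (1ℤ - + 2 * b) * (A * x) ≡ A * (x - + 2 * (b * x))
        ring = solve-∀

    -- Write s for the power sums and A for the alternating one. Doubling gives (1 - 2 ^ (j + 1)) s
    -- (j + 1) ≡ - (j + 1) p 2 ^ j Q j modulo p² and, since s j ≡ 0, A j ≡ - 2 ^ (j + 1) Q j modulo
    -- p. Eliminating Q j, putting p b (j + 1) for s (j + 1) and dividing by p yields the claim.
    alternating-bernoulli : ∀ j → suc (suc j) < p →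
      + 2 * ((1ℤ - (+ 2) ℤ.^ suc j) * b (suc j)) ≋ + suc j * alternatingPowerSum j mod + p
    alternating-bernoulli j j+2<p = ≋-unscale (+ p) {{ℤ-nonZero}} (begin
      + p * (+ 2 * ((1ℤ - T) * b (suc j)))
        ≡⟨ ring₁ (+ p) T (b (suc j)) ⟩
      + 2 * ((1ℤ - T) * (+ p * b (suc j)))
        ≈⟨ ≋-*ˡ (+ 2) (≋-*ˡ (1ℤ - T) (powerSum≋ (suc j) j+2<p)) ⟨
      + 2 * ((1ℤ - T) * powerSum (suc j))
        ≡⟨ ring₂ T (powerSum (suc j)) ⟩
      + 2 * (powerSum (suc j) + - (T * powerSum (suc j)))
        ≈⟨ ≋-*ˡ (+ 2) (≋-+ʳ (- (T * powerSum (suc j))) (powerSum-double j)) ⟩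
      + 2 * (T * powerSum (suc j) + - (+ suc j * (+ p * t * Q j)) + - (T * powerSum (suc j)))
        ≡⟨ ring₃ (T * powerSum (suc j)) (+ suc j) (+ p) t (Q j) ⟩
      + p * (+ suc j * (t * (0ℤ - + 2 * Q j)))
        ≈⟨ ≋-scale (+ p) (≋-*ˡ (+ suc j) (≋-*ˡ t (≋-+ʳ (- (+ 2 * Q j)) powerSum≋0))) ⟨
      + p * (+ suc j * (t * (powerSum j - + 2 * Q j)))
        ≈⟨ ≋-scale (+ p) (≋-*ˡ (+ suc j) (alternating-double j)) ⟨
      + p * (+ suc j * alternatingPowerSum j) ∎)
      where
      open ≋-Reasoning (+ p * + p)
      T = (+ 2) ℤ.^ suc j
      t = (+ 2) ℤ.^ j
      ℤ-nonZero : ℤ.NonZero (+ p)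
      ℤ-nonZero = prime⇒nonZero pp
      powerSum≋0 : powerSum j ≋ 0ℤ mod + p
      powerSum≋0 = ≋-trans (≋-weaken (+ p) (+ p) (powerSum≋ j (ℕₚ.<-trans (ℕₚ.n<1+n (suc j)) j+2<p)))
        (≋-trans (≡⇒≋ (ℤₚ.*-comm (+ p) (b j))) (multiple≋0 (b j) (+ p)))
      ring₁ : ∀ p T b → p * (+ 2 * ((1ℤ - T) * b)) ≡ + 2 * ((1ℤ - T) * (p * b))
      ring₁ = solve-∀
      ring₂ : ∀ T s → + 2 * ((1ℤ - T) * s) ≡ + 2 * (s + - (T * s))
      ring₂ = solve-∀
      ring₃ : ∀ x c p t q → + 2 * (x + - (c * (p * t * q)) + - x) ≡ p * (c * (t * (0ℤ - + 2 * q)))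
      ring₃ = solve-∀

-- Inverse cubes and the index p - 3 for p at least 5.

module _ {p : ℕ} (pp : Prime p) (r : ℕ) (p≡ : p ≡ 5 ℕ.+ r) where

  private
    fermat-p : ∀ x → ¬ p ∣ x → (+ x) ℤ.^ (4 ℕ.+ r) ≋ 1ℤ mod + p
    fermat-p x = subst (λ p → Prime p → ¬ p ∣ x → (+ x) ℤ.^ (4 ℕ.+ r) ≋ 1ℤ mod + p) (sym p≡)
      (λ pp′ → fermat′ pp′ x) pp

    p>3 : 3 < p
    p>3 = subst (3 <_) (sym p≡) (s≤s (s≤s (s≤s (s≤s z≤n))))

    p∤2 : ¬ p ∣ 2
    p∤2 h = ℕₚ.<⇒≱ p>3 (ℕₚ.≤-trans (ℕ∣.∣⇒≤ h) (ℕₚ.n≤1+n 2))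

    p∤3 : ¬ p ∣ 3
    p∤3 h = ℕₚ.<⇒≱ p>3 (ℕ∣.∣⇒≤ h)

  ≋-cancel-6 : ∀ {a b} e → + 6 * a ≋ + 6 * b mod + (p ^ e) → a ≋ b mod + (p ^ e)
  ≋-cancel-6 e = ≋-cancel (+ 6) (proj₁ v) (proj₂ v)
    where
    p∤6 : ¬ p ∣ 6
    p∤6 h = [ p∤2 , p∤3 ]′ (euclidsLemma 2 3 pp h)
    v = ∤-inverse e pp p∤6

  -- The exponent `suc r` is p - 4, which is - 3 modulo p - 1.
  inverse-cube : ∀ {i} v → ¬ p ∣ i → v * + i ≋ 1ℤ mod + p → v * v * v ≋ (+ i) ℤ.^ suc r mod + p
  inverse-cube {i} v p∤i vi≋1 = begin
    v * v * v                                           ≡⟨ ℤₚ.*-identityʳ _ ⟨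
    v * v * v * 1ℤ                                      ≈⟨ ≋-*ˡ (v * v * v) (fermat-p i p∤i) ⟨
    v * v * v * (+ i * (+ i * (+ i * x)))               ≡⟨ ring v (+ i) x ⟩
    v * + i * (v * + i) * (v * + i) * x                 ≈⟨ ≋-*ʳ x (≋-* (≋-* vi≋1 vi≋1) vi≋1) ⟩
    1ℤ * 1ℤ * 1ℤ * x                                    ≡⟨ ℤₚ.*-identityˡ x ⟩
    x                                                   ∎
    where
    open ≋-Reasoning (+ p)
    x = (+ i) ℤ.^ suc r
    ring : ∀ v i x → v * v * v * (i * (i * (i * x))) ≡ v * i * (v * i) * (v * i) * x
    ring = solve-∀

  module _ (p-odd : Odd p) (b : ℕ → ℤ) (b₀ : b 0 ≋ 1ℤ mod + p)
    (b-recursion : ∀ n → 0 < n → suc n < p → ∑ (suc n) (λ i → + (suc n C i) * b i) ≋ 0ℤ mod + p) where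

    open BernoulliMod pp b b₀ b-recursion using (alternatingPowerSum; alternating-bernoulli)

    -- In `alternating-bernoulli` at j = p - 4, Fermat gives 2 ^ (p - 3) ≡ 1 / 4 and the factor j +
    -- 1 = p - 3 is ≡ - 3. Multiplication by - 4 clears the fraction and leaves a common factor 6.
    alternating-p-4 : + 2 * alternatingPowerSum p-odd (suc r) ≋ - b (2 ℕ.+ r) mod + p
    alternating-p-4 = ≋-sym (subst (λ k → - b (2 ℕ.+ r) ≋ + 2 * A mod + k) (ℕₚ.*-identityʳ p) (≋-cancel-6 1
      (subst (λ k → + 6 * - b (2 ℕ.+ r) ≋ + 6 * (+ 2 * A) mod + k) (sym (ℕₚ.*-identityʳ p)) (begin
        + 6 * - β
          ≡⟨ ring₁ β ⟩
        - (+ 4 * (+ 2 * ((1ℤ - 0ℤ) * β)) - + 2 * β * 1ℤ)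
          ≈⟨ ≋-neg (≋-+ˡ (+ 4 * (+ 2 * ((1ℤ - 0ℤ) * β))) (≋-neg (≋-*ˡ (+ 2 * β) (fermat-p 2 p∤2)))) ⟨
        - (+ 4 * (+ 2 * ((1ℤ - 0ℤ) * β)) - + 2 * β * (+ 2 * (+ 2 * T)))
          ≡⟨ ring₂ β T ⟩
        - + 4 * (+ 2 * ((1ℤ - T) * β))
          ≈⟨ ≋-*ˡ (- + 4) (alternating-bernoulli p-odd (suc r) (subst (3 ℕ.+ r <_) (sym p≡) (ℕₚ.n≤1+n (4 ℕ.+ r)))) ⟩
        - + 4 * ((+ 2 + + r) * A)
          ≡⟨ ring₃ (+ r) A ⟩
        + 6 * (+ 2 * A) + - + 4 * A * (+ 5 + + r)
          ≡⟨ cong (λ k → + 6 * (+ 2 * A) + - + 4 * A * + k) p≡ ⟨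
        + 6 * (+ 2 * A) + - + 4 * A * + p
          ≈⟨ ≋-+ˡ (+ 6 * (+ 2 * A)) (multiple≋0 (- + 4 * A) (+ p)) ⟩
        + 6 * (+ 2 * A) + 0ℤ
          ≡⟨ ℤₚ.+-identityʳ _ ⟩
        + 6 * (+ 2 * A) ∎))))
      where
      open ≋-Reasoning (+ p)
      A = alternatingPowerSum p-odd (suc r)
      β = b (2 ℕ.+ r)
      T = (+ 2) ℤ.^ (2 ℕ.+ r)
      ring₁ : ∀ b → + 6 * - b ≡ - (+ 4 * (+ 2 * ((1ℤ - 0ℤ) * b)) - + 2 * b * 1ℤ)
      ring₁ = solve-∀
      ring₂ : ∀ b t → - (+ 4 * (+ 2 * ((1ℤ - 0ℤ) * b)) - + 2 * b * (+ 2 * (+ 2 * t))) ≡ - + 4 * (+ 2 * ((1ℤ - t) * b))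
      ring₂ = solve-∀
      ring₃ : ∀ r a → - + 4 * ((+ 2 + r) * a) ≡ + 6 * (+ 2 * a) + - + 4 * a * (+ 5 + r)
      ring₃ = solve-∀

-- Reduction of p-integral rationals.

module LocalRationals {p : ℕ} (pp : Prime p) (e : ℕ) where

  open PrimeInverse pp e using (N; inv; inv-∤; ≋N⇒≋p; N≡p*)

  infix 4 _∼_

  -- x is p-integral and congruent to a modulo N.
  record _∼_ (x : ℚ) (a : ℤ) : Set where
    constructor reduces
    field
      num     : ℤ
      den-1   : ℕ
      repr    : toℚᵘ x ≃ᵘ mkℚᵘ num den-1
      p∤den   : ¬ p ∣ suc den-1
      num≋    : num ≋ a * + suc den-1 mod + N

  ∤-* : ∀ {i j} → ¬ p ∣ i → ¬ p ∣ j → ¬ p ∣ i ℕ.* j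
  ∤-* {i} {j} p∤i p∤j p∣ij = [ p∤i , p∤j ]′ (euclidsLemma i j pp p∣ij)

  p∤1 : ¬ p ∣ 1
  p∤1 p∣1 = ℕₚ.<⇒≢ (ℕ.nonTrivial⇒n>1 p {{prime⇒nonTrivial pp}}) (sym (ℕ∣.∣1⇒≡1 p∣1))

  ∼-/ : ∀ s d .{{_ : ℕ.NonZero d}} {a} → ¬ p ∣ d → s ≋ a * + d mod + N → s ℚ./ d ∼ a
  ∼-/ s (suc d-1) p∤d e = reduces s d-1 (ℚₚ.toℚᵘ-fromℚᵘ (mkℚᵘ s d-1)) p∤d e

  ∼-integer : ∀ a → a ℚ./ 1 ∼ a
  ∼-integer a = ∼-/ a 1 p∤1 (≡⇒≋ (sym (ℤₚ.*-identityʳ a)))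

  ∼-0 : ℚ.0ℚ ∼ 0ℤ
  ∼-0 = ∼-integer 0ℤ

  ∼-+ : ∀ {x y a b} → x ∼ a → y ∼ b → x ℚ.+ y ∼ a + b
  ∼-+ {x} {y} {a} {b} (reduces n d r p∤d n≋) (reduces n′ d′ r′ p∤d′ n′≋) = reduces _ _
    (ℚᵘₚ.≃-trans (ℚₚ.toℚᵘ-homo-+ x y) (ℚᵘₚ.+-cong r r′))
    (∤-* p∤d p∤d′)
    (begin
      n * + suc d′ + n′ * + suc d
        ≈⟨ ≋-+ (≋-*ʳ (+ suc d′) n≋) (≋-*ʳ (+ suc d) n′≋) ⟩
      a * + suc d * + suc d′ + b * + suc d′ * + suc d
        ≡⟨ ring a b (+ suc d) (+ suc d′) ⟩
      (a + b) * (+ suc d * + suc d′)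
        ≡⟨ cong ((a + b) *_) (ℤₚ.pos-* (suc d) (suc d′)) ⟨
      (a + b) * + (suc d ℕ.* suc d′) ∎)
    where
    open ≋-Reasoning (+ N)
    ring : ∀ a b d e → a * d * e + b * e * d ≡ (a + b) * (d * e)
    ring = solve-∀

  ∼-* : ∀ {x y a b} → x ∼ a → y ∼ b → x ℚ.* y ∼ a * b
  ∼-* {x} {y} {a} {b} (reduces n d r p∤d n≋) (reduces n′ d′ r′ p∤d′ n′≋) = reduces _ _
    (ℚᵘₚ.≃-trans (ℚₚ.toℚᵘ-homo-* x y) (ℚᵘₚ.*-cong r r′))
    (∤-* p∤d p∤d′)
    (begin
      n * n′
        ≈⟨ ≋-* n≋ n′≋ ⟩
      a * + suc d * (b * + suc d′)
        ≡⟨ ring a b (+ suc d) (+ suc d′) ⟩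
      a * b * (+ suc d * + suc d′)
        ≡⟨ cong (a * b *_) (ℤₚ.pos-* (suc d) (suc d′)) ⟨
      a * b * + (suc d ℕ.* suc d′) ∎)
    where
    open ≋-Reasoning (+ N)
    ring : ∀ a b d e → a * d * (b * e) ≡ a * b * (d * e)
    ring = solve-∀

  ∼-neg : ∀ {x a} → x ∼ a → ℚ.- x ∼ - a
  ∼-neg {x} {a} (reduces n d r p∤d n≋) = reduces (- n) d
    (ℚᵘₚ.≃-trans (ℚₚ.toℚᵘ-homo‿- x) (ℚᵘₚ.-‿cong r))
    p∤d
    (≋-trans (≋-neg n≋) (≡⇒≋ (ℤₚ.neg-distribˡ-* a (+ suc d))))

  ∼-≋ : ∀ {x a b} → x ∼ a → a ≋ b mod + N → x ∼ b
  ∼-≋ (reduces n d r p∤d n≋) a≋b = reduces n d r p∤d (≋-trans n≋ (≋-*ʳ (+ suc d) a≋b))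

  ∼-cross : ∀ {x a} (h : x ∼ a) → ↥ x * + suc (_∼_.den-1 h) ≡ _∼_.num h * ↧ x
  ∼-cross {ℚ.mkℚ _ _ _} (reduces n d (*≡* eq) _ _) = eq

  -- The reduced denominator divides any other denominator of `x`, being coprime to the numerator.
  ∼-denominator : ∀ {x a} → x ∼ a → ¬ p ∣ ↧ₙ x
  ∼-denominator {x@(ℚ.mkℚ nx d-1 c)} h p∣↧x = _∼_.p∤den h (ℕ∣.∣-trans p∣↧x
    (Coprimality.coprime-divisor {↧ₙ x} {ℤ.∣ ↥ x ∣} (Coprimality.sym (Coprimality.recompute c))
      (subst (↧ₙ x ∣_) abs-eq (ℕ∣.n∣m*n ℤ.∣ _∼_.num h ∣))))
    where
    abs-eq : ℤ.∣ _∼_.num h ∣ ℕ.* ↧ₙ x ≡ ℤ.∣ ↥ x ∣ ℕ.* suc (_∼_.den-1 h)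
    abs-eq = trans (sym (ℤₚ.abs-* (_∼_.num h) (↧ x))) (trans (cong ℤ.∣_∣ (sym (∼-cross h))) (ℤₚ.abs-* (↥ x) _))

  ∼-numerator : ∀ {x a} → x ∼ a → ↥ x ≋ a * ↧ x mod + N
  ∼-numerator {x} {a} h@(reduces n d r p∤d n≋) = ≋-cancel (+ suc d) (inv (suc d)) (inv-∤ p∤d) (begin
    + suc d * ↥ x         ≡⟨ trans (ℤₚ.*-comm (+ suc d) (↥ x)) (∼-cross h) ⟩
    n * ↧ x               ≈⟨ ≋-*ʳ (↧ x) n≋ ⟩
    a * + suc d * ↧ x     ≡⟨ ring a (+ suc d) (↧ x) ⟩
    + suc d * (a * ↧ x)   ∎)
    where
    open ≋-Reasoning (+ N)
    ring : ∀ a d e → a * d * e ≡ d * (a * e)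
    ring = solve-∀

  -- A canonical representative modulo `N`, meaningful for p-integral `x`; being total, it turns the
  -- Bernoulli numbers into an integer sequence.
  reduction : ℚ → ℤ
  reduction x = ↥ x * inv (↧ₙ x)

  ∼⇒reduction : ∀ {x a} → x ∼ a → a ≋ reduction x mod + N
  ∼⇒reduction {x} {a} h = begin
    a                          ≡⟨ ℤₚ.*-identityʳ a ⟨
    a * 1ℤ                     ≈⟨ ≋-*ˡ a (inv-∤ (∼-denominator h)) ⟨
    a * (inv (↧ₙ x) * ↧ x)     ≡⟨ ring a (inv (↧ₙ x)) (↧ x) ⟩
    a * ↧ x * inv (↧ₙ x)       ≈⟨ ≋-*ʳ (inv (↧ₙ x)) (∼-numerator h) ⟨
    ↥ x * inv (↧ₙ x)           ∎
    where
    open ≋-Reasoning (+ N)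
    ring : ∀ a v d → a * (v * d) ≡ a * d * v
    ring = solve-∀

  ∼-CongMod : ∀ {x y a b} → x ∼ a → y ∼ b → a ≋ b mod + N → CongMod p (suc e) x y
  ∼-CongMod {x} {y} {a} {b} x∼a y∼b a≋b =
    ≋0⇒∣ (≋-trans (∼-numerator x-y∼) (≋-trans (≋-*ʳ (↧ z) (≋⇒≋0 a≋b)) (≡⇒≋ refl))) ,
    ∤⇒coprime pp (∼-denominator x-y∼)
    where
    z = x ℚ.- y
    x-y∼ : z ∼ a - b
    x-y∼ = ∼-+ x∼a (∼-neg y∼b)

-- The auxiliary functions of the definitions of B and tripleSum are private. Each is recovered here as the
-- solution of a metavariable: an equation whose two sides agree by computation determines it.
mutual
  extendB : List ℚ → List ℚ
  extendB = _

  -- With `bernList n` generalised to a variable, the equation determines `extendB` as a function of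
  -- that variable.
  bernList-suc : ∀ n → bernList (suc n) ≡ extendB (bernList n)
  bernList-suc n with bernList n
  ... | bs = refl {x = extendB bs}

mutual
  nextB : List ℚ → ℚ
  nextB = _

  nextB-∷ : ℚ → List ℚ → ℚ
  nextB-∷ = _

  -- `extendB` uses its argument twice. Comparing its values at `bs` and `y ∷ bs`, the head dropped
  -- from the latter, leaves the appended elements as the only difference, which isolates `nextB`.
  nextB-exposed : ∀ y bs → nextB bs ≡ nextB-∷ y bs → extendB bs ≡ drop 1 (extendB (y ∷ bs))
  nextB-exposed y bs with bs
  ... | bs = λ e → cong! e

mutual
  snoc : List ℚ → ℚ → List ℚ
  snoc = _

  extendB≡ : ∀ bs → extendB bs ≡ snoc bs (nextB bs)
  extendB≡ bs with nextB bs
  ... | x = refl {x = snoc bs x}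

mutual
  weighted₁ : ℕ → List ℚ → ℚ
  weighted₁ = _

  weighted₁-exposed : ∀ y ys → nextB (y ∷ ys) ≡
    ℚ.- ((+ 1 ℚ./ suc (suc (length ys))) ℚ.* ((+ (suc (suc (length ys)) C 0) ℚ./ 1) ℚ.* y ℚ.+ weighted₁ (length ys) ys))
  weighted₁-exposed y ys with length ys
  ... | l = refl

mutual
  -- The parameter l stands for the binomial row l + 2, the form in which it occurs in the
  -- recursion.
  weighted : ℕ → ℕ → List ℚ → ℚ
  weighted = _

  weighted-exposed : ∀ l ys → weighted₁ l ys ≡ weighted l 1 ys
  weighted-exposed l ys with suc zero
  ... | i = refl {x = weighted l i ys}

mutual
  summand : (m n : ℕ) (s : ℕ → ℤ) (a b : ℕ) → ℚ
  summand = _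

  tripleSum≡ : ∀ m n s → tripleSum m n s ≡ sumℚ (concatMap (λ a → map (summand m n s a) (upTo n)) (upTo n))
  tripleSum≡ m n s = refl

nextB-cons : ∀ l bs → length bs ≡ suc l → nextB bs ≡ ℚ.- ((+ 1 ℚ./ suc (suc l)) ℚ.* weighted l 0 bs)
nextB-cons l (y ∷ ys) refl = refl

length-snoc : ∀ bs x → length (snoc bs x) ≡ suc (length bs)
length-snoc []       x = refl
length-snoc (b ∷ bs) x = cong suc (length-snoc bs x)

lastOr-snoc : ∀ bs x → lastOr (snoc bs x) ≡ x
lastOr-snoc []           x = refl
lastOr-snoc (b ∷ [])     x = refl
lastOr-snoc (b ∷ c ∷ bs) x = lastOr-snoc (c ∷ bs) x

bernList≡ : ∀ n → bernList (suc n) ≡ snoc (bernList n) (B n)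
bernList≡ n = trans step (cong (snoc (bernList n)) (sym (trans (cong lastOr step) (lastOr-snoc (bernList n) (nextB (bernList n))))))
  where
  step : bernList (suc n) ≡ snoc (bernList n) (nextB (bernList n))
  step = trans (bernList-suc n) (extendB≡ (bernList n))

B≡nextB : ∀ n → B n ≡ nextB (bernList n)
B≡nextB n = trans (cong lastOr (trans (bernList-suc n) (extendB≡ (bernList n)))) (lastOr-snoc (bernList n) (nextB (bernList n)))

length-bernList : ∀ n → length (bernList n) ≡ n
length-bernList zero    = refl
length-bernList (suc n) = trans (cong length (bernList≡ n)) (trans (length-snoc (bernList n) (B n)) (cong suc (length-bernList n)))

weighted-snoc : ∀ l i bs x → weighted l i (snoc bs x) ≡ weighted l i bs ℚ.+ (+ (suc (suc l) C (i ℕ.+ length bs)) ℚ./ 1) ℚ.* x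
weighted-snoc l i []       x = trans (ℚₚ.+-comm ((+ (suc (suc l) C i) ℚ./ 1) ℚ.* x) ℚ.0ℚ)
  (cong (λ j → ℚ.0ℚ ℚ.+ (+ (suc (suc l) C j) ℚ./ 1) ℚ.* x) (sym (ℕₚ.+-identityʳ i)))
weighted-snoc l i (b ∷ bs) x = begin
  c ℚ.+ weighted l (suc i) (snoc bs x)
    ≡⟨ cong (c ℚ.+_) (weighted-snoc l (suc i) bs x) ⟩
  c ℚ.+ (weighted l (suc i) bs ℚ.+ (+ (suc (suc l) C (suc i ℕ.+ length bs)) ℚ./ 1) ℚ.* x)
    ≡⟨ ℚₚ.+-assoc c _ _ ⟨
  c ℚ.+ weighted l (suc i) bs ℚ.+ (+ (suc (suc l) C (suc i ℕ.+ length bs)) ℚ./ 1) ℚ.* x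
    ≡⟨ cong (λ j → c ℚ.+ weighted l (suc i) bs ℚ.+ (+ (suc (suc l) C j) ℚ./ 1) ℚ.* x) (sym (ℕₚ.+-suc i (length bs))) ⟩
  c ℚ.+ weighted l (suc i) bs ℚ.+ (+ (suc (suc l) C (i ℕ.+ suc (length bs))) ℚ./ 1) ℚ.* x ∎
  where
  open ≡-Reasoning
  c = (+ (suc (suc l) C i) ℚ./ 1) ℚ.* b

weighted-bernList : ∀ l n → weighted l 0 (bernList (suc n)) ≡ weighted l 0 (bernList n) ℚ.+ (+ (suc (suc l) C n) ℚ./ 1) ℚ.* B n
weighted-bernList l n = begin
  weighted l 0 (bernList (suc n))
    ≡⟨ cong (weighted l 0) (bernList≡ n) ⟩
  weighted l 0 (snoc (bernList n) (B n))
    ≡⟨ weighted-snoc l 0 (bernList n) (B n) ⟩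
  weighted l 0 (bernList n) ℚ.+ (+ (suc (suc l) C (length (bernList n))) ℚ./ 1) ℚ.* B n
    ≡⟨ cong (λ j → weighted l 0 (bernList n) ℚ.+ (+ (suc (suc l) C j) ℚ./ 1) ℚ.* B n) (length-bernList n) ⟩
  weighted l 0 (bernList n) ℚ.+ (+ (suc (suc l) C n) ℚ./ 1) ℚ.* B n ∎
  where open ≡-Reasoning

B-suc : ∀ n → B (suc n) ≡ ℚ.- ((+ 1 ℚ./ suc (suc n)) ℚ.* weighted n 0 (bernList (suc n)))
B-suc n = trans (B≡nextB (suc n)) (nextB-cons n (bernList (suc n)) (length-bernList (suc n)))

-- Reduction of Bernoulli numbers and of sums over lists.

module BernoulliReduction {p : ℕ} (pp : Prime p) (e : ℕ) where

  open PrimeInverse pp e using (N; inv; inv-∤)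
  open LocalRationals pp e

  b : ℕ → ℤ
  b k = reduction (B k)

  weighted∼ : ∀ l n → (∀ i → i < n → B i ∼ b i) → weighted l 0 (bernList n) ∼ ∑ n (λ i → + (suc (suc l) C i) * b i)
  weighted∼ l zero    h = ∼-0
  weighted∼ l (suc n) h = subst (_∼ ∑ (suc n) (λ i → + (suc (suc l) C i) * b i)) (sym (weighted-bernList l n))
    (∼-+ (weighted∼ l n (λ i i<n → h i (ℕₚ.m<n⇒m<1+n i<n))) (∼-* (∼-integer (+ (suc (suc l) C n))) (h n (ℕₚ.n<1+n n))))

  p∤2+ : ∀ {n} → suc (suc n) < p → ¬ p ∣ suc (suc n)
  p∤2+ n<p p∣n = ℕₚ.<⇒≱ n<p (ℕ∣.∣⇒≤ p∣n)

  B-suc∼ : ∀ n → suc (suc n) < p → (∀ i → i < suc n → B i ∼ b i) →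
    B (suc n) ∼ - (inv (suc (suc n)) * ∑ (suc n) (λ i → + (suc (suc n) C i) * b i))
  B-suc∼ n n<p h = subst (_∼ - (inv (suc (suc n)) * ∑ (suc n) (λ i → + (suc (suc n) C i) * b i))) (sym (B-suc n))
    (∼-neg (∼-* (∼-/ (+ 1) (suc (suc n)) {inv (suc (suc n))} (p∤2+ n<p) (≋-sym (inv-∤ (p∤2+ n<p)))) (weighted∼ n (suc n) h)))

  -- The recursion for the Bernoulli numbers up to index k divides only by numbers up to k + 1 < p,
  -- so p never enters a denominator.
  B∼b : ∀ k → suc k < p → B k ∼ b k
  B∼b = ℕ-Ind.<-rec _ λ
    { zero    _  _   → canonical (∼-integer 1ℤ)
    ; (suc n) ih n<p → canonical (B-suc∼ n n<p λ i i<1+n → ih i<1+n (ℕₚ.<-trans (s≤s i<1+n) n<p))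
    }
    where
    canonical : ∀ {x a} → x ∼ a → x ∼ reduction x
    canonical h = ∼-≋ h (∼⇒reduction h)

  b₀≋1 : b 0 ≋ 1ℤ mod + N
  b₀≋1 = ≋-sym (∼⇒reduction (∼-integer 1ℤ))

  b-recursion : ∀ n → 0 < n → suc n < p → ∑ (suc n) (λ i → + (suc n C i) * b i) ≋ 0ℤ mod + N
  b-recursion (suc n) _ n<p = begin
    Σ + + (suc (suc n) C suc n) * b (suc n)
      ≡⟨ cong (λ c → Σ + + c * b (suc n)) ([n+1]Cn≡n+1 (suc n)) ⟩
    Σ + + suc (suc n) * b (suc n)
      ≈⟨ ≋-+ˡ Σ (≋-*ˡ (+ suc (suc n)) (∼⇒reduction (B-suc∼ n n<p λ i i<1+n → B∼b i (ℕₚ.<-trans (s≤s i<1+n) n<p)))) ⟨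
    Σ + + suc (suc n) * - (v * Σ)
      ≡⟨ ring Σ (+ suc (suc n)) v ⟩
    Σ - v * + suc (suc n) * Σ
      ≈⟨ ≋-+ˡ Σ (≋-neg (≋-*ʳ Σ (inv-∤ (p∤2+ n<p)))) ⟩
    Σ - 1ℤ * Σ
      ≡⟨ ring′ Σ ⟩
    0ℤ ∎
    where
    open ≋-Reasoning (+ N)
    Σ = ∑ (suc n) (λ i → + (suc (suc n) C i) * b i)
    v = inv (suc (suc n))
    ring : ∀ s n v → s + n * - (v * s) ≡ s - v * n * s
    ring = solve-∀
    ring′ : ∀ s → s - 1ℤ * s ≡ 0ℤ
    ring′ = solve-∀

module _ {p : ℕ} (pp : Prime p) (e : ℕ) where

  open LocalRationals pp e

  sumℚ-++ : ∀ xs ys → sumℚ (xs ++ ys) ≡ sumℚ xs ℚ.+ sumℚ ys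
  sumℚ-++ []       ys = sym (ℚₚ.+-identityˡ (sumℚ ys))
  sumℚ-++ (x ∷ xs) ys = trans (cong (x ℚ.+_) (sumℚ-++ xs ys)) (sym (ℚₚ.+-assoc x (sumℚ xs) (sumℚ ys)))

  sumℚ-map∼ : ∀ n h {t : ℕ → ℚ} {g : ℕ → ℤ} → (∀ i → t i ∼ g i) → sumℚ (map t (applyUpTo h n)) ∼ ∑ n (g ∘ h)
  sumℚ-map∼ zero    h t∼g = ∼-0
  sumℚ-map∼ (suc n) h {g = g} t∼g =
    ∼-≋ (∼-+ (t∼g (h 0)) (sumℚ-map∼ n (h ∘ suc) t∼g)) (≡⇒≋ (sym (∑-head n (g ∘ h))))

  sumℚ-concatMap∼ : ∀ n h {F : ℕ → List ℚ} {g : ℕ → ℤ} → (∀ i → sumℚ (F i) ∼ g i) →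
    sumℚ (concatMap F (applyUpTo h n)) ∼ ∑ n (g ∘ h)
  sumℚ-concatMap∼ zero    h F∼g = ∼-0
  sumℚ-concatMap∼ (suc n) h {F} {g} F∼g =
    subst (_∼ ∑ (suc n) (g ∘ h)) (sym (sumℚ-++ (F (h 0)) (concatMap F (applyUpTo (h ∘ suc) n))))
      (∼-≋ (∼-+ (F∼g (h 0)) (sumℚ-concatMap∼ n (h ∘ suc) F∼g)) (≡⇒≋ (sym (∑-head n (g ∘ h)))))

prime-∤-prime : ∀ {p q} → Prime p → Prime q → p ≢ q → ¬ p ∣ q
prime-∤-prime pp qp p≢q p∣q with prime⇒irreducible qp p∣q
... | inj₂ p≡q = p≢q p≡q
... | inj₁ refl = ℕₚ.<-irrefl refl (ℕ.nonTrivial⇒n>1 1 {{prime⇒nonTrivial pp}})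

∑-δ-shift : ∀ n s t (g : ℕ → ℤ) → s ≤ t → t ∸ s < n → ∑ n (λ k → ⟦ s ℕ.+ k ℕ.≟ t ⟧ * g k) ≡ g (t ∸ s)
∑-δ-shift n s t g s≤t t∸s<n = trans
  (∑-cong n λ k → cong (_* g k) (⟦⟧-⇔ (s ℕ.+ k ℕ.≟ t) (k ℕ.≟ t ∸ s)
    (λ e → trans (sym (ℕₚ.m+n∸m≡n s k)) (cong (_∸ s) e))
    (λ e → trans (cong (s ℕ.+_) e) (ℕₚ.m+[n∸m]≡n s≤t))))
  (∑-δ n (t ∸ s) g t∸s<n)

∑-δ-shift-out : ∀ n s t (g : ℕ → ℤ) → (∀ k → k < n → s ℕ.+ k ≢ t) → ∑ n (λ k → ⟦ s ℕ.+ k ℕ.≟ t ⟧ * g k) ≡ 0ℤ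
∑-δ-shift-out n s t g out = trans
  (∑-cong< n λ k k<n → cong (_* g k) (⟦⟧-no (s ℕ.+ k ℕ.≟ t) (out k k<n)))
  (∑-0 n)

-- The two primes, the modulus n and the function f.

module Setting {p q : ℕ} (pp : Prime p) (qp : Prime q) (p≢q : p ≢ q) (p≢2 : p ≢ 2) (q≢2 : q ≢ 2) (α β : ℕ) where

  open PrimeInverse pp α public

  P w L : ℕ
  P = p ^ α
  w = q ^ β
  L = q ^ suc β

  p-odd : Odd p
  p-odd = odd-prime pp p≢2

  q-odd : Odd q
  q-odd = odd-prime qp q≢2

  n-odd : Odd (N ℕ.* L)
  n-odd = odd-* (odd-^ (suc α) p-odd) (odd-^ (suc β) q-odd)

  -- The product N * L is used in the form 1 + 2m demanded by `double m`; `n≡` translates back at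
  -- the end.
  m n : ℕ
  m = proj₁ n-odd
  n = suc (m ℕ.+ m)

  n≡ : N ℕ.* L ≡ n
  n≡ = proj₂ n-odd

  instance
    q≢0 : ℕ.NonZero q
    q≢0 = prime⇒nonZero qp

  N∣n : N ∣ n
  N∣n = subst (N ∣_) n≡ (ℕ∣.m∣m*n L)

  q∣n : q ∣ n
  q∣n = subst (q ∣_) n≡ (ℕ∣.∣-trans (ℕ∣.m∣m*n w) (ℕ∣.n∣m*n N))

  p∣n : p ∣ n
  p∣n = ℕ∣.∣-trans (ℕ∣.m∣m*n P) N∣n

  p∤q : ¬ p ∣ q
  p∤q = prime-∤-prime pp qp p≢q

  ≋n⇒≋N : ∀ {a b} → a ≋ b mod + n → a ≋ b mod + N
  ≋n⇒≋N = ≋-modulus (+ L) (trans (cong +_ (sym n≡)) (ℤₚ.pos-* N L))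

  ≋n⇒≋q : ∀ {a b} → a ≋ b mod + n → a ≋ b mod + q
  ≋n⇒≋q with q∣n
  ... | divides c e = ≋-modulus (+ c) (trans (cong +_ (trans e (ℕₚ.*-comm c q))) (ℤₚ.pos-* q c))

  -- f i is 1 / i modulo N for i prime to p q and 0 otherwise; U is the indicator of these i.
  χ π U f : ℕ → ℤ
  χ i = 1ℤ - ⟦ q ∣? i ⟧
  π i = 1ℤ - ⟦ p ∣? i ⟧
  U i = π i * χ i
  f i = inv i * χ i

  χ-unit : ∀ {x y} s t → t * s ≋ 1ℤ mod + n → s * + x ≋ + y mod + n → χ x ≡ χ y
  χ-unit {x} {y} s t ts sx≋y = cong (λ z → 1ℤ - z) (⟦∣⟧-unit {q} {x} {y} s t (≋n⇒≋q ts) (≋n⇒≋q sx≋y))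

  π-unit : ∀ {x y} s t → t * s ≋ 1ℤ mod + n → s * + x ≋ + y mod + n → π x ≡ π y
  π-unit {x} {y} s t ts sx≋y = cong (λ z → 1ℤ - z) (⟦∣⟧-unit {p} {x} {y} s t (≋N⇒≋p (≋n⇒≋N ts)) (≋N⇒≋p (≋n⇒≋N sx≋y)))

  f-unit : ∀ {x y} s t → t * s ≋ 1ℤ mod + n → s * + x ≋ + y mod + n → f x ≋ s * f y mod + N
  f-unit {x} {y} s t ts sx≋y = begin
    inv x * χ x         ≈⟨ ≋-* (inv-unit {x} {y} s t (≋n⇒≋N ts) (≋n⇒≋N sx≋y)) (≡⇒≋ (χ-unit {x} {y} s t ts sx≋y)) ⟩
    s * inv y * χ y     ≡⟨ ℤₚ.*-assoc s (inv y) (χ y) ⟩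
    s * (inv y * χ y)   ∎
    where open ≋-Reasoning (+ N)

  f-∣p : ∀ {i} → p ∣ i → f i ≡ 0ℤ
  f-∣p {i} p∣i = cong (_* χ i) (inv-∣ p∣i)

  f-∣q : ∀ {i} → q ∣ i → f i ≡ 0ℤ
  f-∣q {i} q∣i = trans (cong (λ z → inv i * (1ℤ - z)) (⟦⟧-yes (q ∣? i) q∣i)) (ℤₚ.*-zeroʳ (inv i))

  U-negate : ∀ t s → n ∣ t → s ≤ t → U (t ∸ s) ≡ U s
  U-negate t s n∣t s≤t = sym (cong₂ _*_
    (π-unit {s} {t ∸ s} (- 1ℤ) (- 1ℤ) -1-unit (negate-∸ t s n∣t s≤t))
    (χ-unit {s} {t ∸ s} (- 1ℤ) (- 1ℤ) -1-unit (negate-∸ t s n∣t s≤t)))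

  f-neg : ∀ i → i ≤ n → f (n ∸ i) ≋ - f i mod + N
  f-neg i i≤n = begin
    f (n ∸ i)             ≡⟨ lemma (f (n ∸ i)) ⟩
    - (- 1ℤ * f (n ∸ i))  ≈⟨ ≋-neg (f-unit {i} {n ∸ i} (- 1ℤ) (- 1ℤ) -1-unit (negate-∸ n i ℕ∣.∣-refl i≤n)) ⟨
    - f i                 ∎
    where
    open ≋-Reasoning (+ N)
    lemma : ∀ a → a ≡ - (- 1ℤ * a)
    lemma = solve-∀

  f-double : ∀ a → + 2 * f (double m a) ≋ f a mod + N
  f-double a = ≋-sym (f-unit {a} {double m a} (+ 2) (proj₁ half-n) (proj₂ half-n) (by (+ big m a) (begin
    + 2 * + a                                    ≡⟨ two (+ a) ⟩
    + a + + a                                    ≡⟨ ℤₚ.pos-+ a a ⟨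
    + (a ℕ.+ a)                                  ≡⟨ cong +_ (double-big m a) ⟨
    + (double m a ℕ.+ n ℕ.* big m a)             ≡⟨ cong (λ t → + double m a + t) (trans (ℤₚ.pos-* n (big m a)) (ℤₚ.*-comm (+ n) _)) ⟩
    + double m a + + big m a * + n               ∎)))
    where
    open ≡-Reasoning
    half-n = 2-inverse {n} (m , refl)
    two : ∀ a → + 2 * a ≡ a + a
    two = solve-∀

  open OddTripleSums m (+ N) f (f-∣p (p ℕ∣.∣0)) (f-∣p p∣n) f-neg public using (W₁; W₂; Z′; S′; alternating-relation; twice-alternating-sum)

  -- The inner sum over j and k.

  W : ℕ → ℕ → ℕ → ℤ
  W i j k = W₁ i j k + W₂ i j k

  ∑-W-U : ∀ i j → 0 < i → i < n → j < n → ∑ n (λ k → W i j k * U k) ≡ U (i ℕ.+ j)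
  ∑-W-U i j 0<i i<n j<n = trans
    (trans (∑-cong n λ k → ℤₚ.*-distribʳ-+ (U k) (W₁ i j k) (W₂ i j k)) (∑-+ n (λ k → W₁ i j k * U k) (λ k → W₂ i j k * U k)))
    ([ low , high ]′ (ℕₚ.≤-<-connex s n))
    where
    s = i ℕ.+ j
    0<s : 0 < s
    0<s = ℕₚ.<-≤-trans 0<i (ℕₚ.m≤m+n i j)
    s<2n : s < n ℕ.+ n
    s<2n = ℕₚ.+-mono-< i<n j<n
    low : s ≤ n → ∑ n (λ k → W₁ i j k * U k) + ∑ n (λ k → W₂ i j k * U k) ≡ U s
    low s≤n = trans (cong₂ _+_
      (trans (∑-δ-shift n s n U s≤n (ℕₚ.∸-monoʳ-< 0<s s≤n)) (U-negate n s ℕ∣.∣-refl s≤n))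
      (∑-δ-shift-out n s (n ℕ.+ n) U λ k k<n → ℕₚ.<⇒≢ (ℕₚ.+-mono-≤-< s≤n k<n)))
      (ℤₚ.+-identityʳ (U s))
    high : n < s → ∑ n (λ k → W₁ i j k * U k) + ∑ n (λ k → W₂ i j k * U k) ≡ U s
    high n<s = trans (cong₂ _+_
      (∑-δ-shift-out n s n U λ k k<n e → ℕₚ.<⇒≢ (ℕₚ.<-≤-trans n<s (ℕₚ.m≤m+n s k)) (sym e))
      (trans (∑-δ-shift n s (n ℕ.+ n) U (ℕₚ.<⇒≤ s<2n) 2n∸s<n) (U-negate (n ℕ.+ n) s (ℕ∣.∣m∣n⇒∣m+n ℕ∣.∣-refl ℕ∣.∣-refl) (ℕₚ.<⇒≤ s<2n))))
      (ℤₚ.+-identityˡ (U s))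
      where
      2n∸s<n : n ℕ.+ n ∸ s < n
      2n∸s<n = subst (n ℕ.+ n ∸ s <_) (ℕₚ.m+n∸n≡m n n) (ℕₚ.∸-monoʳ-< n<s (ℕₚ.<⇒≤ s<2n))

  W-index : ∀ i j k → W i j k * + i ≋ W i j k * - (+ j + + k) mod + N
  W-index i j k = begin
    W i j k * + i                                          ≡⟨ ℤₚ.*-distribʳ-+ (+ i) (W₁ i j k) (W₂ i j k) ⟩
    W₁ i j k * + i + W₂ i j k * + i                        ≈⟨ ≋-+ (on n ℕ∣.∣-refl) (on (n ℕ.+ n) (ℕ∣.∣m∣n⇒∣m+n ℕ∣.∣-refl ℕ∣.∣-refl)) ⟩
    W₁ i j k * - (+ j + + k) + W₂ i j k * - (+ j + + k)    ≡⟨ ℤₚ.*-distribʳ-+ (- (+ j + + k)) (W₁ i j k) (W₂ i j k) ⟨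
    W i j k * - (+ j + + k)                                ∎
    where
    on : ∀ t → n ∣ t → ⟦ i ℕ.+ j ℕ.+ k ℕ.≟ t ⟧ * + i ≋ ⟦ i ℕ.+ j ℕ.+ k ℕ.≟ t ⟧ * - (+ j + + k) mod + N
    on t n∣t = ⟦⟧-cases (i ℕ.+ j ℕ.+ k ℕ.≟ t) (λ x → x * + i ≋ x * - (+ j + + k) mod + N)
      (λ e → ≋-*ˡ 1ℤ (≋0⇒≋ (≋-trans (≡⇒≋ (sum e)) (≋n⇒≋N (∣⇒≋0 {a = + t} n∣t)))))
      (λ _ → ≋-refl)
      where
      sum : i ℕ.+ j ℕ.+ k ≡ t → + i - - (+ j + + k) ≡ + t
      sum e = trans (lemma (+ i) (+ j) (+ k)) (trans (sym (trans (ℤₚ.pos-+ (i ℕ.+ j) k) (cong (_+ + k) (ℤₚ.pos-+ i j)))) (cong +_ e))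
        where
        lemma : ∀ i j k → i - - (j + k) ≡ i + j + k
        lemma = solve-∀
    open ≋-Reasoning (+ N)

  W-swap : ∀ i j k → W i j k ≡ W i k j
  W-swap i j k = cong₂ _+_ (cong (λ s → ⟦ s ℕ.≟ n ⟧) swap) (cong (λ s → ⟦ s ℕ.≟ n ℕ.+ n ⟧) swap)
    where
    swap : i ℕ.+ j ℕ.+ k ≡ i ℕ.+ k ℕ.+ j
    swap = trans (ℕₚ.+-assoc i j k) (trans (cong (i ℕ.+_) (ℕₚ.+-comm j k)) (sym (ℕₚ.+-assoc i k j)))

  i*f≋U : ∀ i → + i * f i ≋ U i mod + N
  i*f≋U i = ≋-trans (≡⇒≋ (sym (ℤₚ.*-assoc (+ i) (inv i) (χ i)))) (≋-*ʳ (χ i) (inv-*-indicator i))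

  R Y : ℕ → ℤ
  R i = ∑ n λ j → f j * U (i ℕ.+ j)
  Y i = ∑ n λ j → ∑ n λ k → W i j k * (f j * f k)

  -- Partial fractions: i ≡ - (j + k) on the support of `W`, and (j + k) / (j k) = 1 / k + 1 / j.
  -- Exchanging j and k makes the two halves equal.
  i*Y≋R : ∀ i → 0 < i → i < n → + i * Y i ≋ - (+ 2 * R i) mod + N
  i*Y≋R i 0<i i<n = begin
    + i * Y i
      ≡⟨ trans (sym (∑-*ˡ n (+ i) _)) (∑-cong n λ j → sym (∑-*ˡ n (+ i) _)) ⟩
    ∑ n (λ j → ∑ n (λ k → + i * (W i j k * (f j * f k))))
      ≈⟨ ∑-≋ n (λ j → ∑-≋ n (λ k → pointwise j k)) ⟩
    ∑ n (λ j → ∑ n (λ k → - 1ℤ * (f k * (W i k j * U j)) + - 1ℤ * (f j * (W i j k * U k))))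
      ≡⟨ trans (∑-cong n λ j → ∑-+ n _ _) (∑-+ n _ _) ⟩
    ∑ n (λ j → ∑ n (λ k → - 1ℤ * (f k * (W i k j * U j)))) + X
      ≡⟨ cong (_+ X) (∑-swap n n _) ⟩
    X + X
      ≡⟨ cong₂ _+_ X≡R X≡R ⟩
    - 1ℤ * R i + - 1ℤ * R i
      ≡⟨ two (R i) ⟩
    - (+ 2 * R i) ∎
    where
    open ≋-Reasoning (+ N)
    X = ∑ n (λ j → ∑ n (λ k → - 1ℤ * (f j * (W i j k * U k))))
    X≡R : X ≡ - 1ℤ * R i
    X≡R = trans (∑-cong< n λ j j<n → trans (∑-*ˡ n (- 1ℤ) _) (cong (- 1ℤ *_) (trans (∑-*ˡ n (f j) _) (cong (f j *_) (∑-W-U i j 0<i i<n j<n)))))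
      (∑-*ˡ n (- 1ℤ) (λ j → f j * U (i ℕ.+ j)))
    two : ∀ r → - 1ℤ * r + - 1ℤ * r ≡ - (+ 2 * r)
    two = solve-∀
    pointwise : ∀ j k → + i * (W i j k * (f j * f k)) ≋ - 1ℤ * (f k * (W i k j * U j)) + - 1ℤ * (f j * (W i j k * U k)) mod + N
    pointwise j k = begin
      + i * (W i j k * (f j * f k))
        ≡⟨ ring₁ (+ i) (W i j k) (f j) (f k) ⟩
      W i j k * + i * (f j * f k)
        ≈⟨ ≋-*ʳ (f j * f k) (W-index i j k) ⟩
      W i j k * - (+ j + + k) * (f j * f k)
        ≡⟨ ring₂ (W i j k) (+ j) (+ k) (f j) (f k) ⟩
      - 1ℤ * (f k * (W i j k * (+ j * f j))) + - 1ℤ * (f j * (W i j k * (+ k * f k)))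
        ≈⟨ ≋-+ (≋-*ˡ (- 1ℤ) (≋-*ˡ (f k) (≋-*ˡ (W i j k) (i*f≋U j)))) (≋-*ˡ (- 1ℤ) (≋-*ˡ (f j) (≋-*ˡ (W i j k) (i*f≋U k)))) ⟩
      - 1ℤ * (f k * (W i j k * U j)) + - 1ℤ * (f j * (W i j k * U k))
        ≡⟨ cong (λ w → - 1ℤ * (f k * (w * U j)) + - 1ℤ * (f j * (W i j k * U k))) (W-swap i j k) ⟩
      - 1ℤ * (f k * (W i k j * U j)) + - 1ℤ * (f j * (W i j k * U k)) ∎
      where
      ring₁ : ∀ i w a b → i * (w * (a * b)) ≡ w * i * (a * b)
      ring₁ = solve-∀
      ring₂ : ∀ w j k a b → w * - (j + k) * (a * b) ≡ - 1ℤ * (b * (w * (j * a))) + - 1ℤ * (a * (w * (k * b)))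
      ring₂ = solve-∀

  -- N is invertible modulo q, so d N + c meets every residue once.
  ∑-N-step : ∀ c → ∑ q (λ d → ⟦ q ∣? (d ℕ.* N ℕ.+ c) ⟧) ≡ 1ℤ
  ∑-N-step c = trans (∑-cong q λ d → sym (ℤₚ.*-identityʳ _))
    (∑-residue q (λ d → q ∣? (d ℕ.* N ℕ.+ c)) (t * - + c) (λ _ → 1ℤ) to from)
    where
    q∤N : ¬ q ∣ N
    q∤N q∣N = prime-∤-prime qp pp (λ q≡p → p≢q (sym q≡p)) (∣-prime-power (suc α) q∣N)
      where
      ∣-prime-power : ∀ e → q ∣ p ^ e → q ∣ p
      ∣-prime-power zero    q∣1 = ⊥-elim (ℕₚ.<⇒≢ (ℕ.nonTrivial⇒n>1 q {{prime⇒nonTrivial qp}}) (sym (ℕ∣.∣1⇒≡1 q∣1)))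
      ∣-prime-power (suc e) h   = [ (λ q∣p → q∣p) , ∣-prime-power e ]′ (euclidsLemma p (p ^ e) qp h)
    t = proj₁ (coprime⇒inverse (∤⇒coprime qp q∤N))
    tN≋1 = proj₂ (coprime⇒inverse (∤⇒coprime qp q∤N))
    value : ∀ d → + (d ℕ.* N ℕ.+ c) ≡ + N * + d + + c
    value d = trans (ℤₚ.pos-+ (d ℕ.* N) c) (cong (_+ + c) (trans (ℤₚ.pos-* d N) (ℤₚ.*-comm (+ d) (+ N))))
    to : ∀ d → q ∣ d ℕ.* N ℕ.+ c → + d ≋ t * - + c mod + q
    to d h = begin
      + d                                 ≡⟨ ℤₚ.*-identityˡ (+ d) ⟨
      1ℤ * + d                            ≈⟨ ≋-*ʳ (+ d) tN≋1 ⟨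
      t * + N * + d                       ≡⟨ ring t (+ N) (+ d) (+ c) ⟩
      t * (+ N * + d + + c) + t * - + c   ≡⟨ cong (λ z → t * z + t * - + c) (value d) ⟨
      t * + (d ℕ.* N ℕ.+ c) + t * - + c   ≈⟨ ≋-+ʳ (t * - + c) (≋-*ˡ t (∣⇒≋0 h)) ⟩
      t * 0ℤ + t * - + c                  ≡⟨ ring′ t (+ c) ⟩
      t * - + c                           ∎
      where
      open ≋-Reasoning (+ q)
      ring : ∀ t n d c → t * n * d ≡ t * (n * d + c) + t * - c
      ring = solve-∀
      ring′ : ∀ t c → t * 0ℤ + t * - c ≡ t * - c
      ring′ = solve-∀
    from : ∀ d → + d ≋ t * - + c mod + q → q ∣ d ℕ.* N ℕ.+ c
    from d h = ≋0⇒∣ (begin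
      + (d ℕ.* N ℕ.+ c)         ≡⟨ value d ⟩
      + N * + d + + c           ≈⟨ ≋-+ʳ (+ c) (≋-*ˡ (+ N) h) ⟩
      + N * (t * - + c) + + c   ≡⟨ ring (+ N) t (+ c) ⟩
      t * + N * - + c + + c     ≈⟨ ≋-+ʳ (+ c) (≋-*ʳ (- + c) tN≋1) ⟩
      1ℤ * - + c + + c          ≡⟨ ring′ (+ c) ⟩
      0ℤ                        ∎)
      where
      open ≋-Reasoning (+ q)
      ring : ∀ n t c → n * (t * - c) + c ≡ t * n * - c + c
      ring = solve-∀
      ring′ : ∀ c → 1ℤ * - c + c ≡ 0ℤ
      ring′ = solve-∀

  module _ (i : ℕ) (q∤i : ¬ q ∣ i) where

    private
      K : ℕ → ℤ
      K x = χ x * χ (i ℕ.+ x)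

    K≡ : ∀ x → K x ≡ 1ℤ - ⟦ q ∣? x ⟧ - ⟦ q ∣? (i ℕ.+ x) ⟧
    K≡ x = trans (expand ⟦ q ∣? x ⟧ ⟦ q ∣? (i ℕ.+ x) ⟧) (trans (cong (λ z → 1ℤ - ⟦ q ∣? x ⟧ - ⟦ q ∣? (i ℕ.+ x) ⟧ + z) disjoint) (ℤₚ.+-identityʳ _))
      where
      expand : ∀ a b → (1ℤ - a) * (1ℤ - b) ≡ 1ℤ - a - b + a * b
      expand = solve-∀
      disjoint : ⟦ q ∣? x ⟧ * ⟦ q ∣? (i ℕ.+ x) ⟧ ≡ 0ℤ
      disjoint = trans (⟦⟧-× (q ∣? x) (q ∣? (i ℕ.+ x))) (⟦⟧-no ((q ∣? x) ×-dec (q ∣? (i ℕ.+ x)))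
        λ (q∣x , q∣i+x) → q∤i (ℕ∣.∣m+n∣m⇒∣n (subst (q ∣_) (ℕₚ.+-comm i x) q∣i+x) q∣x))

    -- Of the q residues x, the two with x ≡ 0 and x ≡ - i are excluded; they differ because q does
    -- not divide i.
    ∑-K : ∀ c → ∑ q (λ d → K (d ℕ.* N ℕ.+ c)) ≡ + q - + 2
    ∑-K c = begin
      ∑ q (λ d → K (d ℕ.* N ℕ.+ c))
        ≡⟨ ∑-cong q (λ d → K≡ (d ℕ.* N ℕ.+ c)) ⟩
      ∑ q (λ d → 1ℤ - ⟦ q ∣? (d ℕ.* N ℕ.+ c) ⟧ - ⟦ q ∣? (i ℕ.+ (d ℕ.* N ℕ.+ c)) ⟧)
        ≡⟨ trans (∑-- q _ _) (cong (_- ∑ q (λ d → ⟦ q ∣? (i ℕ.+ (d ℕ.* N ℕ.+ c)) ⟧)) (∑-- q _ _)) ⟩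
      ∑ q (λ _ → 1ℤ) - ∑ q (λ d → ⟦ q ∣? (d ℕ.* N ℕ.+ c) ⟧) - ∑ q (λ d → ⟦ q ∣? (i ℕ.+ (d ℕ.* N ℕ.+ c)) ⟧)
        ≡⟨ cong₂ _-_ (cong₂ _-_ (∑-const q 1ℤ) (∑-N-step c))
             (trans (∑-cong q λ d → cong (λ s → ⟦ q ∣? s ⟧) (shuffle i (d ℕ.* N) c)) (∑-N-step (i ℕ.+ c))) ⟩
      + q * 1ℤ - 1ℤ - 1ℤ
        ≡⟨ lemma (+ q) ⟩
      + q - + 2 ∎
      where
      open ≡-Reasoning
      shuffle : ∀ i d c → i ℕ.+ (d ℕ.+ c) ≡ d ℕ.+ (i ℕ.+ c)
      shuffle = ℕ-solve-∀
      lemma : ∀ q → q * 1ℤ - 1ℤ - 1ℤ ≡ q - + 2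
      lemma = solve-∀

    ∑-K-L : ∀ c → ∑ L (λ d → K (d ℕ.* N ℕ.+ c)) ≡ + w * (+ q - + 2)
    ∑-K-L c = begin
      ∑ L (λ d → K (d ℕ.* N ℕ.+ c))
        ≡⟨ cong (λ l → ∑ l (λ d → K (d ℕ.* N ℕ.+ c))) (ℕₚ.*-comm q w) ⟩
      ∑ (w ℕ.* q) (λ d → K (d ℕ.* N ℕ.+ c))
        ≡⟨ ∑-block w q _ ⟩
      ∑ w (λ e → ∑ q (λ d → K ((e ℕ.* q ℕ.+ d) ℕ.* N ℕ.+ c)))
        ≡⟨ ∑-cong w (λ e → trans (∑-cong q λ d → cong K (shuffle e q d N c)) (∑-K (e ℕ.* q ℕ.* N ℕ.+ c))) ⟩
      ∑ w (λ _ → + q - + 2)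
        ≡⟨ ∑-const w _ ⟩
      + w * (+ q - + 2) ∎
      where
      open ≡-Reasoning
      shuffle : ∀ e q d N c → (e ℕ.* q ℕ.+ d) ℕ.* N ℕ.+ c ≡ d ℕ.* N ℕ.+ (e ℕ.* q ℕ.* N ℕ.+ c)
      shuffle = ℕ-solve-∀

    -- With j = d N + c, the factors belonging to p depend on c only, and the sum over d of those
    -- belonging to q is the same for every c. What remains is the sum of all inverses, which
    -- vanishes, minus that over the class of - i.
    R≋ : ¬ p ∣ i → R i ≋ + P * (+ w * (+ q - + 2)) * inv i mod + N
    R≋ p∤i = begin
      R i
        ≡⟨ cong (λ k → ∑ k (λ j → f j * U (i ℕ.+ j))) (trans (sym n≡) (ℕₚ.*-comm N L)) ⟩
      ∑ (L ℕ.* N) (λ j → f j * U (i ℕ.+ j))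
        ≡⟨ ∑-block L N _ ⟩
      ∑ L (λ d → ∑ N (λ c → f (d ℕ.* N ℕ.+ c) * U (i ℕ.+ (d ℕ.* N ℕ.+ c))))
        ≈⟨ ∑-≋ L (λ d → ∑-≋ N (λ c → pointwise d c)) ⟩
      ∑ L (λ d → ∑ N (λ c → inv c * π (i ℕ.+ c) * K (d ℕ.* N ℕ.+ c)))
        ≡⟨ ∑-swap L N _ ⟩
      ∑ N (λ c → ∑ L (λ d → inv c * π (i ℕ.+ c) * K (d ℕ.* N ℕ.+ c)))
        ≡⟨ ∑-cong N (λ c → trans (∑-*ˡ L (inv c * π (i ℕ.+ c)) _) (cong (inv c * π (i ℕ.+ c) *_) (∑-K-L c))) ⟩
      ∑ N (λ c → inv c * π (i ℕ.+ c) * κ)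
        ≡⟨ ∑-*ʳ N κ _ ⟩
      ∑ N (λ c → inv c * π (i ℕ.+ c)) * κ
        ≡⟨ cong (_* κ) (trans (∑-cong N λ c → expand (inv c) ⟦ p ∣? (i ℕ.+ c) ⟧) (∑-- N inv _)) ⟩
      (∑ N inv - ∑ N (λ c → ⟦ p ∣? (i ℕ.+ c) ⟧ * inv c)) * κ
        ≈⟨ ≋-*ʳ κ (≋-+ (∑-inv≋0 p-odd) (≋-neg (∑-inv-class p-odd i p∤i))) ⟩
      (0ℤ - - (+ P * inv i)) * κ
        ≡⟨ ring (+ P) (inv i) κ ⟩
      + P * κ * inv i ∎
      where
      open ≋-Reasoning (+ N)
      κ = + w * (+ q - + 2)
      expand : ∀ a d → a * (1ℤ - d) ≡ a - d * a
      expand = solve-∀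
      ring : ∀ P v κ → (0ℤ - - (P * v)) * κ ≡ P * κ * v
      ring = solve-∀
      rearrange : ∀ v x a b → v * x * (a * b) ≡ v * a * (x * b)
      rearrange = solve-∀
      block≋ : ∀ d c → + (d ℕ.* N ℕ.+ c) ≋ + c mod + N
      block≋ d c = by (+ d) (trans (ℤₚ.pos-+ (d ℕ.* N) c) (trans (cong (_+ + c) (ℤₚ.pos-* d N)) (ℤₚ.+-comm (+ d * + N) (+ c))))
      i+block≋ : ∀ d c → + (i ℕ.+ (d ℕ.* N ℕ.+ c)) ≋ + (i ℕ.+ c) mod + N
      i+block≋ d c = ≋-trans (≡⇒≋ (ℤₚ.pos-+ i _)) (≋-trans (≋-+ˡ (+ i) (block≋ d c)) (≡⇒≋ (sym (ℤₚ.pos-+ i c))))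
      pointwise : ∀ d c → f (d ℕ.* N ℕ.+ c) * U (i ℕ.+ (d ℕ.* N ℕ.+ c)) ≋ inv c * π (i ℕ.+ c) * K (d ℕ.* N ℕ.+ c) mod + N
      pointwise d c = begin
        inv x * χ x * (π (i ℕ.+ x) * χ (i ℕ.+ x))   ≡⟨ rearrange (inv x) (χ x) (π (i ℕ.+ x)) (χ (i ℕ.+ x)) ⟩
        inv x * π (i ℕ.+ x) * K x                   ≈⟨ ≋-*ʳ (K x) (≋-* (inv-periodic (block≋ d c)) (≡⇒≋ (cong (λ z → 1ℤ - z) (⟦∣⟧-periodic (i ℕ.+ x) (i ℕ.+ c) (≋N⇒≋p (i+block≋ d c)))))) ⟩
        inv c * π (i ℕ.+ c) * K x                   ∎
        where x = d ℕ.* N ℕ.+ c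

  -- The alternating sum of inverse cubes.

  Λ : ℤ
  Λ = ∑ n λ i → signℤ i * (f i * f i * f i)

  c₀ : ℤ
  c₀ = - (+ 2 * (+ P * (+ w * (+ q - + 2))))

  f*Y≋ : ∀ i → i < n → f i * Y i ≋ c₀ * (f i * f i * f i) mod + N
  f*Y≋ i i<n = cases (p ∣? i) (q ∣? i)
    where
    v = inv i
    vanishing : f i ≡ 0ℤ → f i * Y i ≋ c₀ * (f i * f i * f i) mod + N
    vanishing f≡0 = ≡⇒≋ (trans (cong (_* Y i) f≡0) (sym (trans (cong (λ z → c₀ * (z * z * z)) f≡0) (ℤₚ.*-zeroʳ c₀))))
    f≡v : ¬ q ∣ i → f i ≡ v
    f≡v q∤i = trans (cong (λ z → v * (1ℤ - z)) (⟦⟧-no (q ∣? i) q∤i)) (ℤₚ.*-identityʳ v)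
    0<i : ¬ p ∣ i → 0 < i
    0<i p∤i = ℕₚ.n≢0⇒n>0 λ i≡0 → p∤i (subst (p ∣_) (sym i≡0) (p ℕ∣.∣0))
    open ≋-Reasoning (+ N)
    κ = + w * (+ q - + 2)
    ring₁ : ∀ v y → v * y ≡ v * 1ℤ * y
    ring₁ = solve-∀
    ring₂ : ∀ v i y → v * (v * i) * y ≡ v * v * (i * y)
    ring₂ = solve-∀
    ring₃ : ∀ v c P → v * v * - (+ 2 * (P * c * v)) ≡ - (+ 2 * (P * c)) * (v * v * v)
    ring₃ = solve-∀
    unit-case : ¬ p ∣ i → ¬ q ∣ i → v * Y i ≋ c₀ * (v * v * v) mod + N
    unit-case p∤i q∤i = begin
      v * Y i                         ≡⟨ ring₁ v (Y i) ⟩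
      v * 1ℤ * Y i                    ≈⟨ ≋-*ʳ (Y i) (≋-*ˡ v (inv-∤ p∤i)) ⟨
      v * (v * + i) * Y i             ≡⟨ ring₂ v (+ i) (Y i) ⟩
      v * v * (+ i * Y i)             ≈⟨ ≋-*ˡ (v * v) (i*Y≋R i (0<i p∤i) i<n) ⟩
      v * v * - (+ 2 * R i)           ≈⟨ ≋-*ˡ (v * v) (≋-neg (≋-*ˡ (+ 2) (R≋ i q∤i p∤i))) ⟩
      v * v * - (+ 2 * (+ P * κ * v)) ≡⟨ ring₃ v κ (+ P) ⟩
      c₀ * (v * v * v)                ∎
    cases : Dec (p ∣ i) → Dec (q ∣ i) → f i * Y i ≋ c₀ * (f i * f i * f i) mod + N
    cases (yes p∣i) _         = vanishing (f-∣p p∣i)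
    cases (no _)    (yes q∣i) = vanishing (f-∣q q∣i)
    cases (no p∤i)  (no q∤i)  = ≋-trans (≋-*ʳ (Y i) (≡⇒≋ (f≡v q∤i)))
      (≋-trans (unit-case p∤i q∤i) (≡⇒≋ (cong (λ z → c₀ * (z * z * z)) (sym (f≡v q∤i)))))

  2S≋Λ : + 2 * S′ ≋ c₀ * Λ mod + N
  2S≋Λ = begin
    + 2 * S′
      ≈⟨ twice-alternating-sum ⟩
    ∑ n (λ i → ∑ n (λ j → ∑ n (λ k → W i j k * (signℤ i * f i * f j * f k))))
      ≡⟨ ∑-cong n (λ i → trans (∑-cong n λ j → trans (∑-cong n λ k → ring (W i j k) (signℤ i) (f i) (f j) (f k)) (∑-*ˡ n (signℤ i * f i) _)) (∑-*ˡ n (signℤ i * f i) _)) ⟩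
    ∑ n (λ i → signℤ i * f i * Y i)
      ≈⟨ ∑-≋< n (λ i i<n → ≋-trans (≡⇒≋ (ℤₚ.*-assoc (signℤ i) (f i) (Y i))) (≋-trans (≋-*ˡ (signℤ i) (f*Y≋ i i<n)) (≡⇒≋ (ring′ (signℤ i) c₀ (f i * f i * f i))))) ⟩
    ∑ n (λ i → c₀ * (signℤ i * (f i * f i * f i)))
      ≡⟨ ∑-*ˡ n c₀ _ ⟩
    c₀ * Λ ∎
    where
    open ≋-Reasoning (+ N)
    ring : ∀ w s a b c → w * (s * a * b * c) ≡ s * a * (w * (b * c))
    ring = solve-∀
    ring′ : ∀ s c x → s * (c * x) ≡ c * (s * x)
    ring′ = solve-∀

  G : ℕ → ℤ
  G i = signℤ i * (inv i * inv i * inv i)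

  Γ : ℤ
  Γ = ∑ p G

  -- Since p is odd, block d carries the sign (-1) ^ d, and an odd number of alternating signs adds
  -- up to 1.
  ∑-G-blocks : ∀ M → Odd M → ∑ (M ℕ.* p) G ≋ Γ mod + p
  ∑-G-blocks M M-odd = begin
    ∑ (M ℕ.* p) G
      ≡⟨ ∑-block M p G ⟩
    ∑ M (λ d → ∑ p (λ c → G (d ℕ.* p ℕ.+ c)))
      ≈⟨ ∑-≋ M (λ d → ∑-≋ p (λ c → pointwise d c)) ⟩
    ∑ M (λ d → ∑ p (λ c → signℤ d * G c))
      ≡⟨ trans (∑-cong M λ d → ∑-*ˡ p (signℤ d) G) (∑-*ʳ M Γ signℤ) ⟩
    ∑ M signℤ * Γ
      ≡⟨ trans (cong (_* Γ) (∑-signℤ M M-odd)) (ℤₚ.*-identityˡ Γ) ⟩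
    Γ ∎
    where
    open ≋-Reasoning (+ p)
    block≋ : ∀ d c → 1ℤ * + (d ℕ.* p ℕ.+ c) ≋ + c mod + p
    block≋ d c = by (+ d) (trans (ℤₚ.*-identityˡ _) (trans (ℤₚ.pos-+ (d ℕ.* p) c) (trans (cong (_+ + c) (ℤₚ.pos-* d p)) (ℤₚ.+-comm (+ d * + p) (+ c)))))
    -- Here the arguments agree only modulo p, not modulo N as `inv-periodic` requires.
    inv≋ : ∀ d c → inv (d ℕ.* p ℕ.+ c) ≋ inv c mod + p
    inv≋ d c with p ∣? c
    ... | yes p∣c = ≡⇒≋ (inv-∣ (proj₂ (∣-unit {p} {d ℕ.* p ℕ.+ c} {c} 1ℤ 1ℤ 1-unit (block≋ d c)) p∣c))
    ... | no  p∤c = ≋-inverse-unique (+ c)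
      (≋-trans (≋-*ʳ (inv x) (≋-trans (≋-sym (block≋ d c)) (≡⇒≋ (ℤₚ.*-identityˡ (+ x)))))
        (≋-trans (≡⇒≋ (ℤₚ.*-comm (+ x) (inv x))) (≋N⇒≋p (inv-∤ (λ p∣x → p∤c (proj₁ (∣-unit {p} {x} {c} 1ℤ 1ℤ 1-unit (block≋ d c)) p∣x))))))
      (≋-trans (≡⇒≋ (ℤₚ.*-comm (+ c) v)) (≋N⇒≋p (proj₂ (∤-inverse (suc α) pp p∤c))))
      where
      x = d ℕ.* p ℕ.+ c
      v = proj₁ (∤-inverse (suc α) pp p∤c)
    pointwise : ∀ d c → G (d ℕ.* p ℕ.+ c) ≋ signℤ d * G c mod + p
    pointwise d c = begin
      G x                                              ≡⟨ cong (_* (inv x * inv x * inv x)) (trans (signℤ-+ (d ℕ.* p) c) (cong (_* signℤ c) (signℤ-* d p-odd))) ⟩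
      signℤ d * signℤ c * (inv x * inv x * inv x)      ≈⟨ ≋-*ˡ (signℤ d * signℤ c) (≋-* (≋-* (inv≋ d c) (inv≋ d c)) (inv≋ d c)) ⟩
      signℤ d * signℤ c * (inv c * inv c * inv c)      ≡⟨ ℤₚ.*-assoc (signℤ d) (signℤ c) _ ⟩
      signℤ d * G c                                    ∎
      where x = d ℕ.* p ℕ.+ c

  -- For i = d q the sign is that of d, because q is odd, and the inverse cube gains 1 / q³.
  ∑-G-multiples : ∀ M → ∑ (M ℕ.* q) (λ i → ⟦ q ∣? i ⟧ * G i) ≋ inv q * inv q * inv q * ∑ M G mod + N
  ∑-G-multiples M = begin
    ∑ (M ℕ.* q) (λ i → ⟦ q ∣? i ⟧ * G i)
      ≡⟨ ∑-block M q _ ⟩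
    ∑ M (λ d → ∑ q (λ c → ⟦ q ∣? (d ℕ.* q ℕ.+ c) ⟧ * G (d ℕ.* q ℕ.+ c)))
      ≡⟨ ∑-cong M (λ d → trans (∑-cong< q λ c c<q → cong (_* G (d ℕ.* q ℕ.+ c)) (only-0 d c c<q)) (∑-δ q 0 (λ c → G (d ℕ.* q ℕ.+ c)) (ℕ.>-nonZero⁻¹ q))) ⟩
    ∑ M (λ d → G (d ℕ.* q ℕ.+ 0))
      ≈⟨ ∑-≋ M pointwise ⟩
    ∑ M (λ d → u * u * u * G d)
      ≡⟨ ∑-*ˡ M (u * u * u) G ⟩
    u * u * u * ∑ M G ∎
    where
    u = inv q
    only-0 : ∀ d c → c < q → ⟦ q ∣? (d ℕ.* q ℕ.+ c) ⟧ ≡ ⟦ c ℕ.≟ 0 ⟧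
    only-0 d c c<q = ⟦⟧-⇔ (q ∣? (d ℕ.* q ℕ.+ c)) (c ℕ.≟ 0)
      (λ h → [ (λ 0<c → ⊥-elim (ℕₚ.<⇒≱ c<q (ℕ∣.∣⇒≤ {{ℕ.>-nonZero 0<c}} (ℕ∣.∣m+n∣m⇒∣n h (ℕ∣.n∣m*n d))))) , sym ]′ (ℕₚ.m≤n⇒m<n∨m≡n (z≤n {c})))
      (λ c≡0 → subst (λ c → q ∣ d ℕ.* q ℕ.+ c) (sym c≡0) (subst (q ∣_) (sym (ℕₚ.+-identityʳ (d ℕ.* q))) (ℕ∣.n∣m*n d)))
    inv-*q : ∀ d → inv (d ℕ.* q) ≋ u * inv d mod + N
    inv-*q d = ≋-sym (begin
      u * inv d                       ≈⟨ ≋-*ˡ u (inv-unit {d} {d ℕ.* q} (+ q) u (inv-∤ p∤q) (≡⇒≋ (trans (ℤₚ.*-comm (+ q) (+ d)) (sym (ℤₚ.pos-* d q))))) ⟩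
      u * (+ q * inv (d ℕ.* q))       ≡⟨ ℤₚ.*-assoc u (+ q) _ ⟨
      u * + q * inv (d ℕ.* q)         ≈⟨ ≋-*ʳ (inv (d ℕ.* q)) (inv-∤ p∤q) ⟩
      1ℤ * inv (d ℕ.* q)              ≡⟨ ℤₚ.*-identityˡ _ ⟩
      inv (d ℕ.* q)                   ∎)
      where open ≋-Reasoning (+ N)
    open ≋-Reasoning (+ N)
    pointwise : ∀ d → G (d ℕ.* q ℕ.+ 0) ≋ u * u * u * G d mod + N
    pointwise d = begin
      G (d ℕ.* q ℕ.+ 0)                                     ≡⟨ cong G (ℕₚ.+-identityʳ (d ℕ.* q)) ⟩
      signℤ (d ℕ.* q) * (inv x * inv x * inv x)             ≈⟨ ≋-* (≡⇒≋ (signℤ-* d q-odd)) (≋-* (≋-* (inv-*q d) (inv-*q d)) (inv-*q d)) ⟩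
      signℤ d * (u * inv d * (u * inv d) * (u * inv d))     ≡⟨ ring (signℤ d) u (inv d) ⟩
      u * u * u * G d                                       ∎
      where
      x = d ℕ.* q
      ring : ∀ s u v → s * (u * v * (u * v) * (u * v)) ≡ u * u * u * (s * (v * v * v))
      ring = solve-∀

  -- Removing the multiples of q yields the Euler factor at q. Both the full range and the multiples
  -- consist of an odd number of blocks of length p.
  Λ≋Γ : Λ ≋ (1ℤ - inv q * inv q * inv q) * Γ mod + p
  Λ≋Γ = begin
    Λ
      ≡⟨ ∑-cong n (λ i → cube i) ⟩
    ∑ n (λ i → G i - ⟦ q ∣? i ⟧ * G i)
      ≡⟨ ∑-- n G _ ⟩
    ∑ n G - ∑ n (λ i → ⟦ q ∣? i ⟧ * G i)
      ≡⟨ cong₂ (λ k l → ∑ k G - ∑ l (λ i → ⟦ q ∣? i ⟧ * G i)) (trans (sym n≡) (reorder₁ p P L)) (trans (sym n≡) (reorder₂ p P q w)) ⟩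
    ∑ (P ℕ.* L ℕ.* p) G - ∑ (P ℕ.* w ℕ.* p ℕ.* q) (λ i → ⟦ q ∣? i ⟧ * G i)
      ≈⟨ ≋-+ (∑-G-blocks (P ℕ.* L) (odd-* (odd-^ α p-odd) (odd-^ (suc β) q-odd)))
             (≋-neg (≋-trans (≋N⇒≋p (∑-G-multiples (P ℕ.* w ℕ.* p)))
               (≋-*ˡ (u * u * u) (∑-G-blocks (P ℕ.* w) (odd-* (odd-^ α p-odd) (odd-^ β q-odd)))))) ⟩
    Γ - u * u * u * Γ
      ≡⟨ ring (u * u * u) Γ ⟩
    (1ℤ - u * u * u) * Γ ∎
    where
    open ≋-Reasoning (+ p)
    u = inv q
    ring : ∀ u g → g - u * g ≡ (1ℤ - u) * g
    ring = solve-∀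
    reorder₁ : ∀ p P L → p ℕ.* P ℕ.* L ≡ P ℕ.* L ℕ.* p
    reorder₁ = ℕ-solve-∀
    reorder₂ : ∀ p P q w → p ℕ.* P ℕ.* (q ℕ.* w) ≡ P ℕ.* w ℕ.* p ℕ.* q
    reorder₂ = ℕ-solve-∀
    cube : ∀ i → signℤ i * (f i * f i * f i) ≡ G i - ⟦ q ∣? i ⟧ * G i
    cube i = ⟦⟧-cases (q ∣? i)
      (λ x → signℤ i * (inv i * (1ℤ - x) * (inv i * (1ℤ - x)) * (inv i * (1ℤ - x))) ≡ G i - x * G i)
      (λ _ → ring₁ (signℤ i) (inv i)) (λ _ → ring₀ (signℤ i) (inv i))
      where
      ring₁ : ∀ s v → s * (v * (1ℤ - 1ℤ) * (v * (1ℤ - 1ℤ)) * (v * (1ℤ - 1ℤ))) ≡ s * (v * v * v) - 1ℤ * (s * (v * v * v))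
      ring₁ = solve-∀
      ring₀ : ∀ s v → s * (v * (1ℤ - 0ℤ) * (v * (1ℤ - 0ℤ)) * (v * (1ℤ - 0ℤ))) ≡ s * (v * v * v) - 0ℤ * (s * (v * v * v))
      ring₀ = solve-∀

  -- From the rational triple sums to integers.

  open LocalRationals pp α
  open BernoulliReduction pp α

  U-unit : ∀ {i} → ¬ p ∣ i → ¬ q ∣ i → U i ≡ 1ℤ
  U-unit {i} p∤i q∤i = cong₂ (λ x y → (1ℤ - x) * (1ℤ - y)) (⟦⟧-no (p ∣? i) p∤i) (⟦⟧-no (q ∣? i) q∤i)

  -- Treats `p * q` and `n`, the two moduli of the statement, at once: both have the prime divisors
  -- p and q.
  Detects : ℕ → Set
  Detects M = ∀ i → (Coprime i M → ¬ p ∣ i × ¬ q ∣ i) × (¬ p ∣ i → ¬ q ∣ i → Coprime i M)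

  inP-cases : ∀ {M} → Detects M → ∀ i →
    (inP M i ≡ true × ¬ p ∣ i × ¬ q ∣ i) ⊎ (inP M i ≡ false × f i ≡ 0ℤ)
  inP-cases {M} detects i = cases (coprime? i M) (p ∣? i) (q ∣? i)
    where
    cases : Dec (Coprime i M) → Dec (p ∣ i) → Dec (q ∣ i) → _
    cases (yes c) _         _         = inj₁ (dec-true (coprime? i M) c , proj₁ (detects i) c)
    cases (no ¬c) (yes p∣i) _         = inj₂ (dec-false (coprime? i M) ¬c , f-∣p p∣i)
    cases (no ¬c) _         (yes q∣i) = inj₂ (dec-false (coprime? i M) ¬c , f-∣q q∣i)
    cases (no ¬c) (no p∤i)  (no q∤i)  = ⊥-elim (¬c (proj₂ (detects i) p∤i q∤i))

  module _ {M : ℕ} (detects : Detects M) (s : ℕ → ℤ) where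

    private
      X : ℕ → ℕ → ℕ → ℤ
      X i j k = s i * f i * f j * f k

    fraction∼ : ∀ i j k .{{_ : ℕ.NonZero (i ℕ.* j ℕ.* k)}} →
      (if inP M i ∧ inP M j ∧ inP M k then s i ℚ./ (i ℕ.* j ℕ.* k) else ℚ.0ℚ) ∼ X i j k
    fraction∼ i j k with inP M i | inP-cases detects i | inP M j | inP-cases detects j | inP M k | inP-cases detects k
    ... | _ | inj₂ (refl , f≡0) | _ | _ | _ | _ =
      ∼-≋ ∼-0 (≡⇒≋ (sym (trans (cong (λ z → s i * z * f j * f k) f≡0) (ring (s i) (f j) (f k)))))
      where
      ring : ∀ a b c → a * 0ℤ * b * c ≡ 0ℤ
      ring = solve-∀
    ... | _ | inj₁ (refl , _) | _ | inj₂ (refl , f≡0) | _ | _ =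
      ∼-≋ ∼-0 (≡⇒≋ (sym (trans (cong (λ z → s i * f i * z * f k) f≡0) (ring (s i * f i) (f k)))))
      where
      ring : ∀ a c → a * 0ℤ * c ≡ 0ℤ
      ring = solve-∀
    ... | _ | inj₁ (refl , _) | _ | inj₁ (refl , _) | _ | inj₂ (refl , f≡0) =
      ∼-≋ ∼-0 (≡⇒≋ (sym (trans (cong (s i * f i * f j *_) f≡0) (ℤₚ.*-zeroʳ (s i * f i * f j)))))
    ... | _ | inj₁ (refl , p∤i , q∤i) | _ | inj₁ (refl , p∤j , q∤j) | _ | inj₁ (refl , p∤k , q∤k) =
      ∼-/ (s i) (i ℕ.* j ℕ.* k) (∤-* (∤-* p∤i p∤j) p∤k) (≋-sym (begin
        X i j k * + (i ℕ.* j ℕ.* k)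
          ≡⟨ cong (X i j k *_) (trans (ℤₚ.pos-* (i ℕ.* j) k) (cong (_* + k) (ℤₚ.pos-* i j))) ⟩
        s i * f i * f j * f k * (+ i * + j * + k)
          ≡⟨ ring (s i) (f i) (f j) (f k) (+ i) (+ j) (+ k) ⟩
        s i * (+ i * f i * (+ j * f j) * (+ k * f k))
          ≈⟨ ≋-*ˡ (s i) (≋-* (≋-* (unit i p∤i q∤i) (unit j p∤j q∤j)) (unit k p∤k q∤k)) ⟩
        s i * 1ℤ
          ≡⟨ ℤₚ.*-identityʳ (s i) ⟩
        s i ∎))
      where
      open ≋-Reasoning (+ N)
      unit : ∀ i → ¬ p ∣ i → ¬ q ∣ i → + i * f i ≋ 1ℤ mod + N
      unit i p∤i q∤i = ≋-trans (i*f≋U i) (≡⇒≋ (U-unit p∤i q∤i))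
      ring : ∀ s a b c i j k → s * a * b * c * (i * j * k) ≡ s * (i * a * (j * b) * (k * c))
      ring = solve-∀

    summand∼ : ∀ n′ a b {g} → (n′ ∸ (suc a ℕ.+ suc b) ≡ 0 → g ≡ 0ℤ) →
      (∀ k → n′ ∸ (suc a ℕ.+ suc b) ≡ suc k → g ≡ X (suc a) (suc b) (suc k)) → summand M n′ s a b ∼ g
    summand∼ n′ a b none some with n′ ∸ (suc a ℕ.+ suc b)
    ... | zero  = ∼-≋ ∼-0 (≡⇒≋ (sym (none refl)))
    ... | suc k = ∼-≋ (fraction∼ (suc a) (suc b) (suc k)) (≡⇒≋ (sym (some k refl)))

    private
      H : ℕ → ℕ → ℤ
      H i j = ∑ n (λ k → W₁ i j k * X i j k)

      -- Truncated subtraction merges two cases: for i + j = n only k = 0 is left, where `f`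
      -- vanishes, and for i + j > n no k is left.
      H-none : ∀ i j → 0 < i → n ∸ (i ℕ.+ j) ≡ 0 → H i j ≡ 0ℤ
      H-none i j 0<i e = [ (λ i+j≤n → trans (∑-δ-shift n (i ℕ.+ j) n (X i j) i+j≤n (subst (_< n) (sym e) (s≤s z≤n))) (trans (cong (X i j) e) (trans (cong (s i * f i * f j *_) (f-∣p (p ℕ∣.∣0))) (ℤₚ.*-zeroʳ (s i * f i * f j)))))
        , (λ n<i+j → ∑-δ-shift-out n (i ℕ.+ j) n (X i j) λ k _ e′ → ℕₚ.<⇒≢ (ℕₚ.<-≤-trans n<i+j (ℕₚ.m≤m+n (i ℕ.+ j) k)) (sym e′)) ]′
        (ℕₚ.≤-<-connex (i ℕ.+ j) n)

      H-some : ∀ i j → 0 < i → ∀ k → n ∸ (i ℕ.+ j) ≡ suc k → H i j ≡ X i j (suc k)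
      H-some i j 0<i k e = trans (∑-δ-shift n (i ℕ.+ j) n (X i j) i+j≤n (ℕₚ.∸-monoʳ-< (ℕₚ.<-≤-trans 0<i (ℕₚ.m≤m+n i j)) i+j≤n)) (cong (X i j) e)
        where
        i+j≤n : i ℕ.+ j ≤ n
        i+j≤n = [ (λ h → h) , (λ h → ⊥-elim (ℕₚ.1+n≢0 (trans (sym e) (ℕₚ.m≤n⇒m∸n≡0 (ℕₚ.<⇒≤ h))))) ]′ (ℕₚ.≤-<-connex (i ℕ.+ j) n)

      X₁≡0 : ∀ i j k → f i ≡ 0ℤ → W₁ i j k * X i j k ≡ 0ℤ
      X₁≡0 i j k f≡0 = trans (cong (λ z → W₁ i j k * (s i * z * f j * f k)) f≡0) (ring (W₁ i j k) (s i) (f j) (f k))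
        where
        ring : ∀ w a b c → w * (a * 0ℤ * b * c) ≡ 0ℤ
        ring = solve-∀

      X₂≡0 : ∀ i j k → f j ≡ 0ℤ → W₁ i j k * X i j k ≡ 0ℤ
      X₂≡0 i j k f≡0 = trans (cong (λ z → W₁ i j k * (s i * f i * z * f k)) f≡0) (ring (W₁ i j k) (s i * f i) (f k))
        where
        ring : ∀ w a c → w * (a * 0ℤ * c) ≡ 0ℤ
        ring = solve-∀

    tripleSum∼ : tripleSum M n s ∼ ∑³ n (λ i j k → W₁ i j k * (s i * f i * f j * f k))
    tripleSum∼ = subst (_∼ ∑³ n (λ i j k → W₁ i j k * X i j k)) (sym (tripleSum≡ M n s))
      (∼-≋ (sumℚ-concatMap∼ pp α n (λ a → a) {F = λ a → map (summand M n s a) (upTo n)} {g = λ a → ∑ n (λ b → H (suc a) (suc b))} λ a →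
             sumℚ-map∼ pp α n (λ b → b) {t = summand M n s a} {g = λ b → H (suc a) (suc b)} λ b →
               summand∼ n a b (H-none (suc a) (suc b) (s≤s z≤n)) (H-some (suc a) (suc b) (s≤s z≤n)))
        (≡⇒≋ (trans
          -- The rational sum runs over 1, ..., n and the integer one over 0, ..., n - 1; the terms
          -- at 0 and n vanish.
          (∑-cong n λ a → ∑-shift n (H (suc a)) (∑-cong n λ k →
            trans (X₂≡0 (suc a) n k (f-∣p p∣n)) (sym (X₂≡0 (suc a) 0 k (f-∣p (p ℕ∣.∣0))))))
          (∑-shift n (λ i → ∑ n (H i)) (∑-cong n λ j → ∑-cong n λ k →
            trans (X₁≡0 n j k (f-∣p p∣n)) (sym (X₁≡0 0 j k (f-∣p (p ℕ∣.∣0)))))))))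

  -- The congruences for S, Z and the Bernoulli number.

  prime-size : p ≡ 3 ⊎ ∃[ r ] p ≡ 5 ℕ.+ r
  prime-size with p-odd
  ... | zero        , e = ⊥-elim (ℕₚ.<⇒≢ (ℕ.nonTrivial⇒n>1 p {{prime⇒nonTrivial pp}}) (sym e))
  ... | suc zero    , e = inj₁ e
  ... | suc (suc l) , e = inj₂ (l ℕ.+ l , trans e (shape l))
    where
    shape : ∀ l → suc (suc (suc l) ℕ.+ suc (suc l)) ≡ 5 ℕ.+ (l ℕ.+ l)
    shape = ℕ-solve-∀

  -- For p ≥ 5 the choice d = 1 makes the side conditions trivial, and 6 is invertible. For p = 3
  -- the choice d = 3 gives the relation modulo 3 N, from which 3 is divided out together with the
  -- modulus; the remaining 2 is a unit.
  4S+Z≋0 : + 4 * S′ + Z′ ≋ 0ℤ mod + N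
  4S+Z≋0 = [ three , five ]′ prime-size
    where
    collect : ∀ s z → + 6 * (+ 4 * s + z) ≡ + 8 * (+ 3 * s + z) - + 2 * z
    collect = solve-∀
    six : ∀ {d} → + 3 ≋ 0ℤ mod d → + N ≋ 0ℤ mod d → + 6 * (+ 4 * S′ + Z′) ≋ 0ℤ mod (+ N * d)
    six 3≋0 N≋0 = ≋-trans (≡⇒≋ (collect S′ Z′)) (≋⇒≋0 (alternating-relation 3≋0 N≋0 (λ a _ → f-double a)))
    five : ∃[ r ] p ≡ 5 ℕ.+ r → + 4 * S′ + Z′ ≋ 0ℤ mod + N
    five (r , p≡) = ≋-cancel-6 pp r p≡ (suc α) (≋-weaken (+ N) 1ℤ (six (mod-1 (+ 3)) (mod-1 (+ N))))
      where
      mod-1 : ∀ a → a ≋ 0ℤ mod 1ℤ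
      mod-1 a = ≋-trans (≡⇒≋ (sym (ℤₚ.*-identityʳ a))) (multiple≋0 a 1ℤ)
    three : p ≡ 3 → + 4 * S′ + Z′ ≋ 0ℤ mod + N
    three p≡3 = 2*≋0 (odd-^ (suc α) p-odd) (≋-unscale (+ 3) (begin
      + 3 * (+ 2 * (+ 4 * S′ + Z′))
        ≡⟨ ℤₚ.*-assoc (+ 3) (+ 2) (+ 4 * S′ + Z′) ⟨
      + 6 * (+ 4 * S′ + Z′)
        ≈⟨ subst (λ M → + 6 * (+ 4 * S′ + Z′) ≋ 0ℤ mod M) (ℤₚ.*-comm (+ N) (+ 3)) (six (multiple≋0 1ℤ (+ 3)) (∣⇒≋0 {a = + N} (subst (_∣ N) p≡3 (p∣N p-odd)))) ⟩
      0ℤ ∎))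
      where open ≋-Reasoning (+ 3 * + N)

  2Γ≋-B : + 2 * Γ ≋ - b (p ∸ 3) mod + p
  2Γ≋-B = [ three , five ]′ prime-size
    where
    three : p ≡ 3 → + 2 * Γ ≋ - b (p ∸ 3) mod + p
    three p≡3 = begin
      + 2 * Γ
        ≡⟨ cong (λ k → + 2 * ∑ k G) p≡3 ⟩
      + 2 * (0ℤ + G 0 + G 1 + G 2)
        ≈⟨ ≋-*ˡ (+ 2) (≋-+ (≋-+ (≋-+ˡ 0ℤ (≡⇒≋ (cong (λ v → 1ℤ * (v * v * v)) (inv-∣ (p ℕ∣.∣0)))))
             (≋-*ˡ (- 1ℤ) (cube (≋N⇒≋p (inv-1)))))
             (≋-*ˡ 1ℤ (cube inv-2))) ⟩
      -- Modulo 3 the inverse of 2 is 2, so the value is 2 (- 1 + 8) = 14 = - 1 + 15, and - 1 is - B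
      -- 0.
      - 1ℤ + + 5 * + 3
        ≡⟨ cong (λ k → - 1ℤ + + 5 * + k) p≡3 ⟨
      - 1ℤ + + 5 * + p
        ≈⟨ ≋-+ˡ (- 1ℤ) (multiple≋0 (+ 5) (+ p)) ⟩
      - 1ℤ
        ≈⟨ ≋-neg (≋N⇒≋p b₀≋1) ⟨
      - b 0
        ≡⟨ cong (λ k → - b (k ∸ 3)) p≡3 ⟨
      - b (p ∸ 3) ∎
      where
      open ≋-Reasoning (+ p)
      cube : ∀ {v w} → v ≋ w mod + p → v * v * v ≋ w * w * w mod + p
      cube e = ≋-* (≋-* e e) e
      p∤ : ∀ {i} → suc i < 3 → ¬ p ∣ suc i
      p∤ i<3 h = ℕₚ.<⇒≱ i<3 (subst (_≤ _) p≡3 (ℕ∣.∣⇒≤ h))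
      inv-1 : inv 1 ≋ 1ℤ mod + N
      inv-1 = ≋-trans (≡⇒≋ (sym (ℤₚ.*-identityʳ (inv 1)))) (inv-∤ (p∤ (s≤s (s≤s z≤n))))
      inv-2 : inv 2 ≋ + 2 mod + p
      inv-2 = ≋-inverse-unique (+ 2) (≋-trans (≡⇒≋ (ℤₚ.*-comm (+ 2) (inv 2))) (≋N⇒≋p (inv-∤ (p∤ (s≤s (s≤s (s≤s z≤n)))))))
        (by 1ℤ (cong (λ k → 1ℤ + 1ℤ * + k) (sym p≡3)))
    five : ∃[ r ] p ≡ 5 ℕ.+ r → + 2 * Γ ≋ - b (p ∸ 3) mod + p
    five (r , p≡) = begin
      + 2 * Γ
        ≈⟨ ≋-*ˡ (+ 2) (∑-≋ p λ i → ≋-*ˡ (signℤ i) (inverse-cube′ i (p ∣? i))) ⟩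
      + 2 * ∑ p (λ i → signℤ i * (+ i) ℤ.^ suc r)
        ≈⟨ alternating-p-4 pp r p≡ p-odd b (≋N⇒≋p b₀≋1) (λ n 0<n n<p → ≋N⇒≋p (b-recursion n 0<n n<p)) ⟩
      - b (2 ℕ.+ r)
        ≡⟨ cong (λ k → - b (k ∸ 3)) p≡ ⟨
      - b (p ∸ 3) ∎
      where
      open ≋-Reasoning (+ p)
      inverse-cube′ : ∀ i → Dec (p ∣ i) → inv i * inv i * inv i ≋ (+ i) ℤ.^ suc r mod + p
      inverse-cube′ i (no p∤i)  = inverse-cube pp r p≡ (inv i) p∤i (≋N⇒≋p (inv-∤ p∤i))
      inverse-cube′ i (yes p∣i) = ≋-trans (≡⇒≋ (cong (λ v → v * v * v) (inv-∣ p∣i)))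
        (≋-sym (≋-trans (≋-^ (suc r) (∣⇒≋0 {a = + i} p∣i)) (≡⇒≋ refl)))

  p-3 : suc (p ∸ 3) < p
  p-3 = [ (λ p≡3 → subst (λ k → suc (k ∸ 3) < k) (sym p≡3) (s≤s (s≤s z≤n)))
        , (λ (r , p≡) → subst (λ k → suc (k ∸ 3) < k) (sym p≡) (s≤s (s≤s (s≤s (s≤s (ℕₚ.n≤1+n r)))))) ]′ prime-size

  p∤2 : ¬ p ∣ 2
  p∤2 p∣2 = ℕₚ.<⇒≱ (ℕₚ.≤∧≢⇒< (ℕ.nonTrivial⇒n>1 p {{prime⇒nonTrivial pp}}) (λ 2≡p → p≢2 (sym 2≡p))) (ℕ∣.∣⇒≤ p∣2)

  q³ : ℕ
  q³ = q ^ 3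

  p∤q³ : ¬ p ∣ q³
  p∤q³ = ∤-* p∤q (∤-* p∤q (∤-* p∤q p∤1))

  rhs : ℤ
  rhs = inv 2 * (+ q - + 2) * ((+ q³ - 1ℤ) * inv q³) * + (P ℕ.* w) * b (p ∸ 3)

  -- The factor `P` in `2S≋Λ` is kept next to `Λ` and then to `Γ`, because their congruences hold
  -- only modulo p and become congruences modulo N when multiplied by `P`.
  S≋rhs : S′ ≋ rhs mod + N
  S≋rhs = ≋-cancel (+ 2) (inv 2) (inv-∤ p∤2) (begin
    + 2 * S′
      ≈⟨ 2S≋Λ ⟩
    - (+ 2 * (+ P * (+ w * (+ q - + 2)))) * Λ
      ≡⟨ ring₁ (+ P) (+ w * (+ q - + 2)) Λ ⟩
    - (+ 2 * (+ w * (+ q - + 2))) * (+ P * Λ)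
      ≈⟨ ≋-*ˡ (- (+ 2 * (+ w * (+ q - + 2)))) (scaled Λ≋Γ) ⟩
    - (+ 2 * (+ w * (+ q - + 2))) * (+ P * ((1ℤ - u * u * u) * Γ))
      ≡⟨ ring₂ (+ w * (+ q - + 2)) (+ P) (u * u * u) Γ ⟩
    - (+ w * (+ q - + 2) * (1ℤ - u * u * u)) * (+ P * (+ 2 * Γ))
      ≈⟨ ≋-*ˡ (- (+ w * (+ q - + 2) * (1ℤ - u * u * u))) (scaled 2Γ≋-B) ⟩
    - (+ w * (+ q - + 2) * (1ℤ - u * u * u)) * (+ P * - b (p ∸ 3))
      ≡⟨ ring₃ (+ w) (+ q) (u * u * u) (+ P) (b (p ∸ 3)) ⟩
    1ℤ * (+ q - + 2) * (1ℤ - u * u * u) * (+ P * + w) * b (p ∸ 3)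
      ≈⟨ ≋-*ʳ (b (p ∸ 3)) (≋-*ʳ (+ P * + w) (≋-* (≋-*ʳ (+ q - + 2) (inv-∤ p∤2)) euler-factor)) ⟨
    inv 2 * + 2 * (+ q - + 2) * ((+ q³ - 1ℤ) * inv q³) * (+ P * + w) * b (p ∸ 3)
      ≡⟨ ring₄ (inv 2) (+ q - + 2) ((+ q³ - 1ℤ) * inv q³) (+ P * + w) (b (p ∸ 3)) ⟩
    + 2 * (inv 2 * (+ q - + 2) * ((+ q³ - 1ℤ) * inv q³) * (+ P * + w) * b (p ∸ 3))
      ≡⟨ cong (λ x → + 2 * (inv 2 * (+ q - + 2) * ((+ q³ - 1ℤ) * inv q³) * x * b (p ∸ 3))) (ℤₚ.pos-* P w) ⟨
    + 2 * rhs ∎)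
    where
    open ≋-Reasoning (+ N)
    u = inv q
    scaled : ∀ {x y} → x ≋ y mod + p → + P * x ≋ + P * y mod + N
    scaled {x} {y} h = subst (λ M → + P * x ≋ + P * y mod M) (sym N≡*p) (≋-scale (+ P) h)
    q³≡ : + q³ ≡ + q * (+ q * (+ q * 1ℤ))
    q³≡ = trans (ℤₚ.pos-* q (q ℕ.* (q ℕ.* 1))) (cong (+ q *_) (trans (ℤₚ.pos-* q (q ℕ.* 1)) (cong (+ q *_) (ℤₚ.pos-* q 1))))
    inv-q³ : inv q³ ≋ u * u * u mod + N
    inv-q³ = ≋-inverse-unique (+ q³) (≋-trans (≡⇒≋ (ℤₚ.*-comm (+ q³) (inv q³))) (inv-∤ p∤q³)) (begin
      + q³ * (u * u * u)                  ≡⟨ trans (cong (_* (u * u * u)) q³≡) (ring (+ q) u) ⟩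
      u * + q * (u * + q) * (u * + q)     ≈⟨ ≋-* (≋-* (inv-∤ p∤q) (inv-∤ p∤q)) (inv-∤ p∤q) ⟩
      1ℤ                                  ∎)
      where
      ring : ∀ q u → q * (q * (q * 1ℤ)) * (u * u * u) ≡ u * q * (u * q) * (u * q)
      ring = solve-∀
    euler-factor : (+ q³ - 1ℤ) * inv q³ ≋ 1ℤ - u * u * u mod + N
    euler-factor = begin
      (+ q³ - 1ℤ) * inv q³          ≡⟨ ring (+ q³) (inv q³) ⟩
      inv q³ * + q³ - inv q³        ≈⟨ ≋-+ (inv-∤ p∤q³) (≋-neg inv-q³) ⟩
      1ℤ - u * u * u                ∎
      where
      ring : ∀ q v → (q - 1ℤ) * v ≡ v * q - v
      ring = solve-∀
    ring₁ : ∀ P κ l → - (+ 2 * (P * κ)) * l ≡ - (+ 2 * κ) * (P * l)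
    ring₁ = solve-∀
    ring₂ : ∀ κ P u g → - (+ 2 * κ) * (P * ((1ℤ - u) * g)) ≡ - (κ * (1ℤ - u)) * (P * (+ 2 * g))
    ring₂ = solve-∀
    ring₃ : ∀ w q u P b → - (w * (q - + 2) * (1ℤ - u)) * (P * - b) ≡ 1ℤ * (q - + 2) * (1ℤ - u) * (P * w) * b
    ring₃ = solve-∀
    ring₄ : ∀ v q x y b → v * + 2 * q * x * y * b ≡ + 2 * (v * q * x * y * b)
    ring₄ = solve-∀

  p∤4 : ¬ p ∣ 4
  p∤4 = ∤-* p∤2 p∤2

  -Z/4 : ℤ
  -Z/4 = - inv 4 * Z′

  S≋-Z/4 : S′ ≋ -Z/4 mod + N
  S≋-Z/4 = ≋-cancel (+ 4) (inv 4) (inv-∤ p∤4) (begin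
    + 4 * S′               ≡⟨ ring₁ S′ Z′ ⟩
    + 4 * S′ + Z′ - Z′     ≈⟨ ≋-+ʳ (- Z′) 4S+Z≋0 ⟩
    0ℤ - Z′                ≡⟨ ring₂ Z′ ⟩
    - (1ℤ * Z′)            ≈⟨ ≋-neg (≋-*ʳ Z′ (inv-∤ p∤4)) ⟨
    - (inv 4 * + 4 * Z′)   ≡⟨ ring₃ (inv 4) Z′ ⟩
    + 4 * (- inv 4 * Z′)   ∎)
    where
    open ≋-Reasoning (+ N)
    ring₁ : ∀ s z → + 4 * s ≡ + 4 * s + z - z
    ring₁ = solve-∀
    ring₂ : ∀ z → 0ℤ - z ≡ - (1ℤ * z)
    ring₂ = solve-∀
    ring₃ : ∀ v z → - (v * + 4 * z) ≡ + 4 * (- v * z)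
    ring₃ = solve-∀

  ¬coprime : ∀ {r i M} → Prime r → r ∣ M → Coprime i M → ¬ r ∣ i
  ¬coprime {r} rp r∣M c r∣i = ℕₚ.<⇒≢ (ℕ.nonTrivial⇒n>1 r {{prime⇒nonTrivial rp}}) (sym (c (r∣i , r∣M)))

  detects-pq : Detects (p ℕ.* q)
  detects-pq i = (λ c → ¬coprime pp (ℕ∣.m∣m*n q) c , ¬coprime qp (ℕ∣.n∣m*n p) c)
    , (λ p∤i q∤i → coprime-*ʳ (∤⇒coprime pp p∤i) (∤⇒coprime qp q∤i))

  detects-n : Detects n
  detects-n i = (λ c → ¬coprime pp p∣n c , ¬coprime qp q∣n c)
    , (λ p∤i q∤i → subst (Coprime i) n≡ (coprime-*ʳ (coprime-^ (suc α) (∤⇒coprime pp p∤i)) (coprime-^ (suc β) (∤⇒coprime qp q∤i))))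

  alternating∼ : tripleSum (p ℕ.* q) n signℤ ∼ S′
  alternating∼ = tripleSum∼ detects-pq signℤ

  Z∼ : Z n ∼ Z′
  Z∼ = ∼-≋ (tripleSum∼ detects-n (λ _ → + 1)) (≡⇒≋ (∑³-cong n λ i j k → cong (W₁ i j k *_) (cong (λ a → a * f j * f k) (ℤₚ.*-identityˡ (f i)))))

  -Z/4∼ : ℚ.- (+ 1 ℚ./ 4) ℚ.* Z n ∼ -Z/4
  -Z/4∼ = ∼-* (∼-neg (∼-/ (+ 1) 4 {inv 4} p∤4 (≋-sym (inv-∤ p∤4)))) Z∼

  rhsℚ : ℚ
  rhsℚ = (+ 1 ℚ./ 2) ℚ.* ((+ q - + 2) ℚ./ 1) ℚ.* (((+ (q ^ 3) - + 1) ℚ./ (q ^ 3)) {{ℕₚ.m^n≢0 q 3}})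
    ℚ.* (+ (P ℕ.* w) ℚ./ 1) ℚ.* B (p ∸ 3)

  rhs∼ : rhsℚ ∼ rhs
  rhs∼ = ∼-* (∼-* (∼-* (∼-* (∼-/ (+ 1) 2 {inv 2} p∤2 (≋-sym (inv-∤ p∤2))) (∼-integer (+ q - + 2)))
    (∼-/ (+ q³ - 1ℤ) q³ {{ℕₚ.m^n≢0 q 3}} {(+ q³ - 1ℤ) * inv q³} p∤q³ q³-quotient)) (∼-integer (+ (P ℕ.* w)))) (B∼b (p ∸ 3) p-3)
    where
    q³-quotient : + q³ - 1ℤ ≋ (+ q³ - 1ℤ) * inv q³ * + q³ mod + N
    q³-quotient = ≋-sym (≋-trans (≡⇒≋ (ℤₚ.*-assoc (+ q³ - 1ℤ) (inv q³) (+ q³)))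
      (≋-trans (≋-*ˡ (+ q³ - 1ℤ) (inv-∤ p∤q³)) (≡⇒≋ (ℤₚ.*-identityʳ (+ q³ - 1ℤ)))))

  congruences :
    CongMod p (suc α) (tripleSum (p ℕ.* q) (N ℕ.* L) signℤ) (ℚ.- (+ 1 ℚ./ 4) ℚ.* Z (N ℕ.* L)) ×
    CongMod p (suc α) (ℚ.- (+ 1 ℚ./ 4) ℚ.* Z (N ℕ.* L)) rhsℚ
  congruences =
    subst (λ k → CongMod p (suc α) (tripleSum (p ℕ.* q) k signℤ) (ℚ.- (+ 1 ℚ./ 4) ℚ.* Z k)) (sym n≡)
      (∼-CongMod alternating∼ -Z/4∼ S≋-Z/4) ,
    subst (λ k → CongMod p (suc α) (ℚ.- (+ 1 ℚ./ 4) ℚ.* Z k) rhsℚ) (sym n≡)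
      (∼-CongMod -Z/4∼ rhs∼ (≋-trans (≋-sym S≋-Z/4) S≋rhs))

theorem2 : ∀ (p q α β : ℕ) → Prime p → (hq : Prime q) → p ≢ q → p ≢ 2 → q ≢ 2 →
    let n = (p ^ suc α) ℕ.* (q ^ suc β) in
    CongMod p (suc α)
      (tripleSum (p ℕ.* q) n signℤ)
      (ℚ.- ((+ 1) ℚ./ 4) ℚ.* Z n)
    × CongMod p (suc α)
      (ℚ.- ((+ 1) ℚ./ 4) ℚ.* Z n)
      (((+ 1) ℚ./ 2) ℚ.* ((+ q - + 2) ℚ./ 1)
         ℚ.* ((+ (q ^ 3) - + 1) ℚ./ (q ^ 3)) {{ℕₚ.m^n≢0 q 3 {{prime⇒nonZero hq}}}}
         ℚ.* ((+ ((p ^ α) ℕ.* (q ^ β))) ℚ./ 1) ℚ.* B (p ∸ 3))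
theorem2 p q α β pp qp p≢q p≢2 q≢2 = congruences
  where open Setting pp qp p≢q p≢2 q≢2 α β
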